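{- Let $P\subset\mathbb{R}^d$ be a $d$-dimensional smooth polytope, and for $m\ge1$ write $b_m:=|\partial(mP)\cap\mathbb{Z}^d|$. (1) If $d=3$, the $f$-vector of $P$ is $(f_0,f_1,f_2)=(b_1,\;3b_1-6,\;2b_1-4)$. (2) If $d=4$, the $f$-vector of $P$ is $(f_0,f_1,f_2,f_3)=(b_1,\;b_2-b_1,\;2b_2-4b_1,\;b_2-2b_1)$. (3) If $d=5$, the $f$-vector of $P$ is $(f_0,f_1,f_2,f_3,f_4)=(b_1,\;b_2-b_1,\;4b_2-14b_1+20,\;5b_2-20b_1+30,\;2b_2-8b_1+12)$.
   Context: A lattice polytope in $\mathbb{R}^d$ is the convex hull of finitely many points of $\mathbb{Z}^d$; $mP$ is the $m$-th dilate and $\partial$ denotes boundary. A $d$-dimensional convex lattice polytope $P\subset\mathbb{R}^d$ containing the origin in its interior is called smooth if the vertices of every facet of $P$ form a $\mathbb{Z}$-basis of $\mathbb{Z}^d$. The $f$-vector of $P$ is $(f_0,f_1,\dots,f_{d-1})$, where $f_i$ is the number of $i$-dimensional faces of $P$. -}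

module Defs where

open import Level using (Level; suc; _⊔_)
open import Algebra.Bundles using (CommutativeRing)
open import Algebra.Structures using (IsCommutativeRing)
open import Data.Fin.Base using (Fin; toℕ)
open import Data.Integer.Base as ℤ using (ℤ; +_; -[1+_])
import Data.Integer.Properties as ℤ
open import Data.List.Base using (List)
open import Data.Nat.Base as ℕ using (ℕ)
open import Data.Product.Base using (Σ; ∃; ∃-syntax; Σ-syntax; _×_; proj₁)
open import Data.Vec.Base using (Vec; lookup; map; tabulate; replicate; toList)
open import Function.Base using (_∘_)
open import Function.Bundles using (Inverse; _⇔_)
open import Relation.Binary.Bundles using (Setoid)
open import Relation.Binary.Structures using (IsStrictTotalOrder)
open import Relation.Binary.PropositionalEquality using (_≡_; _≢_; setoid)
open import Relation.Unary using (Pred; _∈_; _⊆_; _≐_; _∩_; ∁; ｛_｝)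
open import Relation.Unary.Relation.Binary.Equality using (≐-setoid)
import Algebra.Definitions.RawMonoid as RawMonoid
import Algebra.Properties.Semiring.Sum as Sum
import Relation.Binary.Construct.On as On
import Relation.Binary.Construct.StrictToNonStrict as StrictToNonStrict

-- The library has no real numbers.  The geometry below is developed over an
-- arbitrary ordered field with decidable (trichotomous) order; classically ℝ
-- is one, and ℚ is one constructively.

record OrderedField (ℓ : Level) : Set (suc ℓ) where
  infixl 7 _*_
  infixl 6 _+_
  infix  8 -_
  infix  4 _<_
  field
    Carrier            : Set ℓ
    _<_                : Carrier → Carrier → Set ℓ
    _+_ _*_            : Carrier → Carrier → Carrier
    -_                 : Carrier → Carrier
    0# 1#              : Carrier
    isCommutativeRing  : IsCommutativeRing _≡_ _+_ _*_ -_ 0# 1#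
    isStrictTotalOrder : IsStrictTotalOrder _≡_ _<_
    0≢1                : 0# ≢ 1#
    inverse            : ∀ x → x ≢ 0# → ∃[ y ] x * y ≡ 1#
    +-monoˡ-<          : ∀ {x y} z → x < y → x + z < y + z
    *-pos              : ∀ {x y} → 0# < x → 0# < y → 0# < x * y

  commutativeRing : CommutativeRing ℓ ℓ
  commutativeRing = record { isCommutativeRing = isCommutativeRing }

  open StrictToNonStrict {A = Carrier} _≡_ _<_ public using (_≤_)

module LinearAlgebra {c ℓ} (R : CommutativeRing c ℓ) where
  open CommutativeRing R using (Carrier; _*_; semiring)
  open Sum semiring using (sum) public

  lincomb : ∀ {n d} → (Fin n → Carrier) → (Fin n → Vec Carrier d) → Vec Carrier d
  lincomb a v = tabulate λ j → sum λ i → a i * lookup (v i) j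

  dot : ∀ {d} → Vec Carrier d → Vec Carrier d → Carrier
  dot x y = sum λ j → lookup x j * lookup y j

module ℤ-LA = LinearAlgebra ℤ.+-*-commutativeRing

record IsℤBasis {n d} (e : Fin n → Vec ℤ d) : Set where
  field
    independent : ∀ a → ℤ-LA.lincomb a e ≡ replicate d ℤ.0ℤ → ∀ i → a i ≡ ℤ.0ℤ
    spanning    : ∀ z → ∃[ a ] ℤ-LA.lincomb a e ≡ z

HasCardinality : ∀ {a ℓ} → Setoid a ℓ → ℕ → Set (a ⊔ ℓ)
HasCardinality S n = Inverse (setoid (Fin n)) S

module Geometry {ℓ} (K : OrderedField ℓ) where
  open OrderedField K
  open CommutativeRing commutativeRing using (_-_; +-rawMonoid)
  open LinearAlgebra commutativeRing

  Point : ℕ → Set ℓ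
  Point d = Vec Carrier d

  Region : ℕ → Set (suc ℓ)
  Region d = Pred (Point d) ℓ

  origin : ∀ {d} → Point d
  origin {d} = replicate d 0#

  fromℤ : ℤ → Carrier
  fromℤ (+ n)    = n · 1#           where open RawMonoid +-rawMonoid renaming (_×_ to _·_)
  fromℤ -[1+ n ] = - (ℕ.suc n · 1#) where open RawMonoid +-rawMonoid renaming (_×_ to _·_)

  embed : ∀ {d} → Vec ℤ d → Point d
  embed = map fromℤ

  Conv : ∀ {n d} → (Fin n → Point d) → Region d
  Conv v x = ∃[ w ] (∀ i → 0# ≤ w i) × sum w ≡ 1# × lincomb w v ≡ x

  IsLatticePolytope : ∀ {d} → Region d → Set ℓ
  IsLatticePolytope {d} P = ∃[ n ] Σ[ v ∈ (Fin n → Vec ℤ d) ] P ≐ Conv (embed ∘ v)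

  dilate : ∀ {d} → ℕ → Region d → Region d
  dilate m P y = ∃[ x ] x ∈ P × y ≡ map (fromℤ (+ m) *_) x

  -- The product topology on Carrier ^ d, with open cubes as basic neighbourhoods.

  Cube : ∀ {d} → Point d → Carrier → Region d
  Cube x ε y = ∀ i → (- ε) < (lookup y i - lookup x i) × (lookup y i - lookup x i) < ε

  Interior : ∀ {d} → Region d → Region d
  Interior S x = ∃[ ε ] 0# < ε × Cube x ε ⊆ S

  Closure : ∀ {d} → Region d → Region d
  Closure S x = ∀ ε → 0# < ε → ∃[ y ] y ∈ Cube x ε × y ∈ S

  Boundary : ∀ {d} → Region d → Region d
  Boundary S = Closure S ∩ ∁ (Interior S)

  AffinelyIndependent : ∀ {n d} → (Fin n → Point d) → Set ℓ
  AffinelyIndependent p = ∀ a → sum a ≡ 0# → lincomb a p ≡ origin → ∀ i → a i ≡ 0#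

  -- The dimension of S is that of its affine hull, so it is one less than the
  -- largest size of an affinely independent family in S; the empty set, of
  -- dimension −1, has no dimension k : ℕ.

  record HasDim {d} (S : Region d) (k : ℕ) : Set ℓ where
    field
      attained : Σ[ p ∈ (Fin (ℕ.suc k) → Point d) ] AffinelyIndependent p × (∀ i → p i ∈ S)
      maximal  : ∀ {n} (p : Fin n → Point d) → AffinelyIndependent p → (∀ i → p i ∈ S) → n ℕ.≤ ℕ.suc k

  -- Intersection with a supporting hyperplane.  The improper faces P (for a = 0,
  -- c = 0) and ∅ are included; for full-dimensional P in dimension d they are not
  -- of dimension 0, …, d − 1.

  IsFace : ∀ {d} → Region d → Region d → Set ℓ
  IsFace P F = ∃[ a ] ∃[ c ] (∀ x → x ∈ P → dot a x ≤ c) × F ≐ (λ x → x ∈ P × dot a x ≡ c)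

  IsFacet : ∀ {d} → Region d → Region d → Set ℓ
  IsFacet {d} P F = IsFace P F × (∃[ k ] ℕ.suc k ≡ d × HasDim F k)

  IsVertex : ∀ {d} → Region d → Point d → Set ℓ
  IsVertex P x = IsFace P ｛ x ｝

  VerticesFormℤBasis : ∀ {d} → Region d → Set ℓ
  VerticesFormℤBasis {d} F =
    ∃[ n ] Σ[ e ∈ (Fin n → Vec ℤ d) ] IsℤBasis e × (∀ x → IsVertex F x ⇔ (∃[ i ] x ≡ embed (e i)))

  record IsSmoothPolytope {d} (P : Region d) : Set (suc ℓ) where
    field
      isLatticePolytope : IsLatticePolytope P
      fullDimensional   : HasDim P d
      originInside      : origin ∈ Interior P
      facetBases        : ∀ F → IsFacet P F → VerticesFormℤBasis F

  -- Points and faces are compared by their underlying vector, respectively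
  -- subset, disregarding the membership proof.

  latticePoints : ∀ {d} → Region d → Setoid ℓ _
  latticePoints {d} S = On.setoid {B = Σ (Vec ℤ d) λ z → embed z ∈ S} (setoid (Vec ℤ d)) proj₁

  faces : ∀ {d} → Region d → ℕ → Setoid (suc ℓ) ℓ
  faces {d} P k = On.setoid {B = Σ (Region d) λ F → IsFace P F × HasDim F k} (≐-setoid (Point d) ℓ) proj₁

  -- The entries are given as integers, so that formulas for them can involve
  -- genuine subtraction.

  HasFVector : ∀ {d} → Region d → List ℤ → Set (suc ℓ)
  HasFVector {d} P g =
    Σ[ f ∈ Vec ℕ d ] (∀ i → HasCardinality (faces P (toℕ i)) (lookup f i)) × toList (map +_ f) ≡ g

{-# OPTIONS --safe #-}
module Submission where

-- A facet is encoded by its normal a, for which a · x ≤ 1 on P with equality on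
-- the facet.  As the vertices of a facet form a ℤ-basis, a lattice point of the
-- cone over it has integer coordinates ≥ 0 adding up to its height.  So the
-- lattice points of ∂P are the vertices and those of ∂(2P) are the points 2 v and
-- v + w for vertices v and edges vw, whence b₁ = f₀ and b₂ = f₀ + f₁.
--
-- The other entries follow from the Dehn–Sommerville equations.  Fix a generic
-- vector g.  For every face G, the empty one included, exactly one facet F ⊇ G
-- is such that g has positive coordinates at all vertices of F outside G: the one
-- whose normal maximizes a · g among the facets containing G, since at a negative
-- coordinate a pivot to the neighbouring facet increases a · g.  Counting the
-- pairs (G, F) gives Σ_F C(p_F, j) faces with d − j vertices, where p_F is the
-- number of positive coordinates.  Replacing g by − g replaces p_F by d − p_F,
-- and comparing the two expressions yields the equations.

open import Defs
open import Algebra.Bundles using (CommutativeRing)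
import Algebra.Properties.CommutativeSemigroup as CommutativeSemigroup
open import Data.Bool.Base using (Bool; true; false; if_then_else_)
import Data.Bool.Properties as Bool
open import Data.Empty using (⊥-elim)
open import Data.Fin.Base using (Fin; zero; suc; toℕ; fromℕ<; punchIn; punchOut; combine; remQuot)
import Data.Fin.Properties as Fin
open import Data.Fin.Subset as Subset using (Subset; ∣_∣)
open import Data.Integer.Base as ℤ using (ℤ; -[1+_])
import Data.Integer.Properties as ℤ
open import Data.List.Base as List using (List; []; _∷_; _++_; filter; length)
open import Data.List.Membership.Propositional using (_∈_)
open import Data.List.Membership.Propositional.Properties
  using (∈-map⁺; ∈-map⁻; ∈-++⁺ˡ; ∈-++⁺ʳ; ∈-filter⁺; ∈-filter⁻; ∈-lookup; ∈-deduplicate⁺; ∈-deduplicate⁻; ∈-allFin)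
import Data.List.Properties as List
open import Data.List.Relation.Unary.All as All using (All; []; _∷_)
open import Data.List.Relation.Unary.AllPairs using ([]; _∷_)
open import Data.List.Relation.Unary.Any using (here; there; index)
open import Data.List.Relation.Unary.Any.Properties using (lookup-index)
open import Data.List.Relation.Unary.Unique.DecPropositional.Properties using (deduplicate-!)
open import Data.List.Relation.Unary.Unique.Propositional using (Unique)
import Data.List.Relation.Unary.Unique.Propositional.Properties as Unique
open import Data.Maybe.Base using (Maybe; just; nothing)
open import Data.Nat.Base as ℕ using (ℕ)
import Data.Nat.Properties as ℕ
open import Data.Product using (∃; ∃-syntax; Σ-syntax; _×_; _,_; proj₁; proj₂; map₂)
open import Data.Sum.Base as Sum using (_⊎_; inj₁; inj₂)
open import Data.Unit.Base using (⊤; tt)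
open import Data.Vec.Base as Vec using (Vec; []; _∷_; lookup; tabulate)
import Data.Vec.Properties as Vec
open import Function.Base using (_∘_; id; case_of_)
open import Function.Bundles using (Inverse; Equivalence; _⇔_)
open import Level using (Level) renaming (suc to lsuc)
open import Relation.Binary.Bundles using (Setoid)
open import Relation.Binary.Definitions using (Tri; tri<; tri≈; tri>)
open import Relation.Binary.PropositionalEquality
  using (_≡_; _≢_; refl; sym; trans; cong; cong₂; subst; subst₂; _≗_; module ≡-Reasoning)
open import Relation.Binary.Structures using (IsStrictTotalOrder)
open import Relation.Nullary using (¬_; Dec; yes; no; contradiction)
import Relation.Nullary.Decidable as Dec
open import Relation.Nullary.Decidable using (True; toWitness; ⌊_⌋; _×-dec_; _→-dec_; _⊎-dec_; ¬?)

-- Nothing says which of the generators `p` are vertices, and a face may be cut out by any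
-- hyperplane, so the facets have to be found. Their normals are the vertices of the polar dual:
-- each is determined by the generators tight on it, and a search through all sets of generators
-- yields them.
--
-- The pivot that assigns a facet to each face shows, for the empty face, that the cones over the
-- facets cover the space. This gives the inequalities of `P` and its dilates, hence their
-- boundaries.
--
-- The number of facets with p_F = i is the entry h_i of the h-vector, and replacing g by - g is the
-- symmetry of h_i and h_(d - i). The symmetry leaves only ⌊d/2⌋ face numbers free, so f₀ and f₁,
-- that is b₁ and b₂, suffice up to d = 5.
--
-- The dilates stop at 2 because 3 = 1 + 2 is the first sum of unequal positive parts: up to height
-- 2, a lattice point of a cone is a multiple of the sum of the vertices of a single face.

module OrderedFieldProperties {ℓ} (K : OrderedField ℓ) where
  open OrderedField K
  open CommutativeRing commutativeRing public
    using (_-_; +-assoc; +-comm; +-identityˡ; +-identityʳ; -‿inverseʳ;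
           *-assoc; *-comm; *-identityˡ; *-identityʳ; zeroˡ; zeroʳ)
  open CommutativeRing commutativeRing using (ring; +-monoid; semiring)
  open IsStrictTotalOrder isStrictTotalOrder public
    using (compare; _≟_; _<?_) renaming (trans to <-trans; irrefl to <-irrefl; asym to <-asym)
  open Geometry K using (fromℤ) public
  open import Algebra.Properties.Ring ring using (-0#≈0#; -‿distribˡ-*; -‿distribʳ-*; -‿involutive)
  open import Algebra.Properties.Monoid.Mult +-monoid using (×-homo-+) renaming (_×_ to _·_)
  open import Algebra.Properties.Semiring.Mult semiring using (×1-homo-*)
  open import Algebra.Solver.Ring.AlmostCommutativeRing
    using (fromCommutativeRing; _-Raw-AlmostCommutative⟶_)

  -- The ring homomorphism from the integers.

  module ℤHomomorphism where
    open import Algebra.Properties.AbelianGroup (CommutativeRing.+-abelianGroup commutativeRing)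
      using (⁻¹-∙-comm)
    open ≡-Reasoning

    fromℤ-neg : ∀ i → fromℤ (ℤ.- i) ≡ - fromℤ i
    fromℤ-neg (ℤ.+ 0)         = sym -0#≈0#
    fromℤ-neg (ℤ.+ (ℕ.suc n)) = refl
    fromℤ-neg -[1+ n ]      = sym (-‿involutive _)

    fromℤ-⊖ : ∀ m n → fromℤ (m ℤ.⊖ n) ≡ (m · 1#) - (n · 1#)
    fromℤ-⊖ m 0 = sym (trans (cong (_+_ _) -0#≈0#) (+-identityʳ _))
    fromℤ-⊖ 0 (ℕ.suc n) = sym (+-identityˡ _)
    fromℤ-⊖ (ℕ.suc m) (ℕ.suc n) = begin
      fromℤ (ℕ.suc m ℤ.⊖ ℕ.suc n)  ≡⟨ cong fromℤ (ℤ.[1+m]⊖[1+n]≡m⊖n m n) ⟩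
      fromℤ (m ℤ.⊖ n)  ≡⟨ fromℤ-⊖ m n ⟩
      (m · 1#) - (n · 1#)  ≡⟨ cong (_+ (- (n · 1#))) (+-identityˡ _) ⟨
      (0# + m · 1#) - (n · 1#)  ≡⟨ cong (λ z → (z + m · 1#) - (n · 1#)) (-‿inverseʳ 1#) ⟨
      (1# - 1# + m · 1#) - (n · 1#)  ≡⟨ cong (_+ (- (n · 1#))) (trans (+-assoc _ _ _) (trans (cong (_+_ 1#) (+-comm _ _)) (sym (+-assoc _ _ _)))) ⟩
      (1# + m · 1# - 1#) - (n · 1#)  ≡⟨ +-assoc _ _ _ ⟩
      (1# + m · 1#) + (- 1# - (n · 1#))  ≡⟨ cong (_+_ _) (⁻¹-∙-comm 1# (n · 1#)) ⟩
      (1# + m · 1#) - (1# + n · 1#)  ∎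

    fromℤ-+ : ∀ i j → fromℤ (i ℤ.+ j) ≡ fromℤ i + fromℤ j
    fromℤ-+ (ℤ.+ m)    (ℤ.+ n)    = ×-homo-+ 1# m n
    fromℤ-+ (ℤ.+ m)    -[1+ n ] = fromℤ-⊖ m (ℕ.suc n)
    fromℤ-+ -[1+ m ] (ℤ.+ n)    = trans (fromℤ-⊖ n (ℕ.suc m)) (+-comm _ _)
    fromℤ-+ -[1+ m ] -[1+ n ] = trans
      (cong (λ k → - (k · 1#)) (cong ℕ.suc (sym (ℕ.+-suc m n))))
      (trans (cong -_ (×-homo-+ 1# (ℕ.suc m) (ℕ.suc n))) (sym (⁻¹-∙-comm _ _)))

    fromℤ-*-pos : ∀ m j → fromℤ (ℤ.+ m ℤ.* j) ≡ fromℤ (ℤ.+ m) * fromℤ j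
    fromℤ-*-pos m (ℤ.+ n)    = trans (cong fromℤ (sym (ℤ.pos-* m n))) (×1-homo-* m n)
    fromℤ-*-pos m -[1+ n ] = begin
      fromℤ (ℤ.+ m ℤ.* (ℤ.- (ℤ.+ ℕ.suc n)))  ≡⟨ cong fromℤ (ℤ.neg-distribʳ-* (ℤ.+ m) (ℤ.+ ℕ.suc n)) ⟨
      fromℤ (ℤ.- (ℤ.+ m ℤ.* (ℤ.+ ℕ.suc n)))  ≡⟨ fromℤ-neg (ℤ.+ m ℤ.* (ℤ.+ ℕ.suc n)) ⟩
      - fromℤ (ℤ.+ m ℤ.* (ℤ.+ ℕ.suc n))  ≡⟨ cong -_ (fromℤ-*-pos m (ℤ.+ ℕ.suc n)) ⟩
      - (fromℤ (ℤ.+ m) * fromℤ (ℤ.+ ℕ.suc n)) ≡⟨ -‿distribʳ-* _ _ ⟩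
      fromℤ (ℤ.+ m) * fromℤ -[1+ n ]  ∎

    fromℤ-* : ∀ i j → fromℤ (i ℤ.* j) ≡ fromℤ i * fromℤ j
    fromℤ-* (ℤ.+ m)    j = fromℤ-*-pos m j
    fromℤ-* -[1+ m ] j = begin
      fromℤ (ℤ.- (ℤ.+ ℕ.suc m) ℤ.* j)  ≡⟨ cong fromℤ (ℤ.neg-distribˡ-* (ℤ.+ ℕ.suc m) j) ⟨
      fromℤ (ℤ.- (ℤ.+ ℕ.suc m ℤ.* j))  ≡⟨ fromℤ-neg (ℤ.+ ℕ.suc m ℤ.* j) ⟩
      - fromℤ (ℤ.+ ℕ.suc m ℤ.* j)  ≡⟨ cong -_ (fromℤ-*-pos (ℕ.suc m) j) ⟩
      - (fromℤ (ℤ.+ ℕ.suc m) * fromℤ j)  ≡⟨ -‿distribˡ-* _ _ ⟩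
      fromℤ -[1+ m ] * fromℤ j  ∎

    fromℤ-1 : fromℤ (ℤ.+ 1) ≡ 1#
    fromℤ-1 = +-identityʳ 1#

  open ℤHomomorphism public

  -- The interpretation of solver coefficients agrees with fromℤ, except that it
  -- sends 1 to 1# on the nose (fromℤ (ℤ.+ 1) is 1# + 0#).
  ⟦_⟧ℤ : ℤ → Carrier
  ⟦ ℤ.+ 1 ⟧ℤ = 1#
  ⟦ i ⟧ℤ   = fromℤ i

  ⟦⟧ℤ≡fromℤ : ∀ i → ⟦ i ⟧ℤ ≡ fromℤ i
  ⟦⟧ℤ≡fromℤ (ℤ.+ 0)                 = refl
  ⟦⟧ℤ≡fromℤ (ℤ.+ 1)                 = sym fromℤ-1
  ⟦⟧ℤ≡fromℤ (ℤ.+ (ℕ.suc (ℕ.suc n))) = refl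
  ⟦⟧ℤ≡fromℤ -[1+ n ]              = refl

  private
    ℤ⟶K : ℤ.+-*-rawRing -Raw-AlmostCommutative⟶ fromCommutativeRing commutativeRing
    ℤ⟶K = record
      { ⟦_⟧    = ⟦_⟧ℤ
      ; +-homo = λ i j → trans (⟦⟧ℤ≡fromℤ (i ℤ.+ j)) (trans (fromℤ-+ i j) (sym (cong₂ _+_ (⟦⟧ℤ≡fromℤ i) (⟦⟧ℤ≡fromℤ j))))
      ; *-homo = λ i j → trans (⟦⟧ℤ≡fromℤ (i ℤ.* j)) (trans (fromℤ-* i j) (sym (cong₂ _*_ (⟦⟧ℤ≡fromℤ i) (⟦⟧ℤ≡fromℤ j))))
      ; -‿homo = λ i → trans (⟦⟧ℤ≡fromℤ (ℤ.- i)) (trans (fromℤ-neg i) (sym (cong -_ (⟦⟧ℤ≡fromℤ i))))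
      ; 0-homo = refl
      ; 1-homo = refl
      }

    ⟦⟧ℤ-weaklyDecidable : ∀ i j → Maybe (⟦ i ⟧ℤ ≡ ⟦ j ⟧ℤ)
    ⟦⟧ℤ-weaklyDecidable i j with i ℤ.≟ j
    ... | yes i≡j = just (cong ⟦_⟧ℤ i≡j)
    ... | no  _   = nothing

  open import Algebra.Solver.Ring ℤ.+-*-rawRing (fromCommutativeRing commutativeRing)
    ℤ⟶K ⟦⟧ℤ-weaklyDecidable public
    using (solve; _:=_; _:+_; _:*_; :-_; _:-_; con)

  -- Order arithmetic.

  ≤-refl : ∀ {x} → x ≤ x
  ≤-refl = inj₂ refl

  ≤-reflexive : ∀ {x y} → x ≡ y → x ≤ y
  ≤-reflexive = inj₂

  <⇒≤ : ∀ {x y} → x < y → x ≤ y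
  <⇒≤ = inj₁

  ≤-<-trans : ∀ {x y z} → x ≤ y → y < z → x < z
  ≤-<-trans (inj₁ x<y)  y<z = <-trans x<y y<z
  ≤-<-trans (inj₂ refl) y<z = y<z

  <-≤-trans : ∀ {x y z} → x < y → y ≤ z → x < z
  <-≤-trans x<y (inj₁ y<z)  = <-trans x<y y<z
  <-≤-trans x<y (inj₂ refl) = x<y

  ≤-trans : ∀ {x y z} → x ≤ y → y ≤ z → x ≤ z
  ≤-trans (inj₁ x<y)  y≤z = inj₁ (<-≤-trans x<y y≤z)
  ≤-trans (inj₂ refl) y≤z = y≤z

  <⇒≢ : ∀ {x y} → x < y → x ≢ y
  <⇒≢ x<y x≡y = <-irrefl x≡y x<y

  <⇒≱ : ∀ {x y} → x < y → ¬ (y ≤ x)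
  <⇒≱ x<y y≤x = <-irrefl refl (<-≤-trans x<y y≤x)

  ≤⇒≯ : ∀ {x y} → x ≤ y → ¬ (y < x)
  ≤⇒≯ x≤y y<x = <⇒≱ y<x x≤y

  ≤-antisym : ∀ {x y} → x ≤ y → y ≤ x → x ≡ y
  ≤-antisym (inj₂ x≡y) _   = x≡y
  ≤-antisym (inj₁ x<y) y≤x = contradiction y≤x (<⇒≱ x<y)

  ≮⇒≥ : ∀ {x y} → ¬ (x < y) → y ≤ x
  ≮⇒≥ {x} {y} x≮y with compare x y
  ... | tri< x<y _ _ = contradiction x<y x≮y
  ... | tri≈ _ x≡y _ = inj₂ (sym x≡y)
  ... | tri> _ _ y<x = inj₁ y<x

  ≰⇒> : ∀ {x y} → ¬ (x ≤ y) → y < x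
  ≰⇒> {x} {y} x≰y with compare x y
  ... | tri< x<y _ _ = contradiction (inj₁ x<y) x≰y
  ... | tri≈ _ x≡y _ = contradiction (inj₂ x≡y) x≰y
  ... | tri> _ _ y<x = y<x

  ≤∧≢⇒< : ∀ {x y} → x ≤ y → x ≢ y → x < y
  ≤∧≢⇒< (inj₁ x<y) _   = x<y
  ≤∧≢⇒< (inj₂ x≡y) x≢y = contradiction x≡y x≢y

  infix 4 _≤?_
  _≤?_ : ∀ x y → Dec (x ≤ y)
  x ≤? y with compare x y
  ... | tri< x<y _ _ = yes (inj₁ x<y)
  ... | tri≈ _ x≡y _ = yes (inj₂ x≡y)
  ... | tri> _ _ y<x = no (<⇒≱ y<x)

  <-respects : ∀ {x x′ y y′} → x ≡ x′ → y ≡ y′ → x < y → x′ < y′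
  <-respects refl refl x<y = x<y

  ≤-respects : ∀ {x x′ y y′} → x ≡ x′ → y ≡ y′ → x ≤ y → x′ ≤ y′
  ≤-respects refl refl x≤y = x≤y

  +-monoʳ-< : ∀ {x y} z → x < y → z + x < z + y
  +-monoʳ-< z = <-respects (+-comm _ z) (+-comm _ z) ∘ +-monoˡ-< z

  +-monoˡ-≤ : ∀ {x y} z → x ≤ y → x + z ≤ y + z
  +-monoˡ-≤ z (inj₁ x<y)  = inj₁ (+-monoˡ-< z x<y)
  +-monoˡ-≤ z (inj₂ refl) = ≤-refl

  +-monoʳ-≤ : ∀ {x y} z → x ≤ y → z + x ≤ z + y
  +-monoʳ-≤ z = ≤-respects (+-comm _ z) (+-comm _ z) ∘ +-monoˡ-≤ z

  +-mono-≤ : ∀ {x y u v} → x ≤ y → u ≤ v → x + u ≤ y + v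
  +-mono-≤ {y = y} {u} x≤y u≤v = ≤-trans (+-monoˡ-≤ u x≤y) (+-monoʳ-≤ y u≤v)

  +-mono-<-≤ : ∀ {x y u v} → x < y → u ≤ v → x + u < y + v
  +-mono-<-≤ {y = y} {u} x<y u≤v = <-≤-trans (+-monoˡ-< u x<y) (+-monoʳ-≤ y u≤v)

  +-mono-< : ∀ {x y u v} → x < y → u < v → x + u < y + v
  +-mono-< x<y = +-mono-<-≤ x<y ∘ <⇒≤

  <⇒0<- : ∀ {x y} → x < y → 0# < y - x
  <⇒0<- {x} = <-respects (-‿inverseʳ x) refl ∘ +-monoˡ-< (- x)

  0<-⇒< : ∀ {x y} → 0# < y - x → x < y
  0<-⇒< {x} {y} = <-respects (+-identityˡ x) (solve 2 (λ x y → y :- x :+ x := y) refl x y) ∘ +-monoˡ-< x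

  ≤⇒0≤- : ∀ {x y} → x ≤ y → 0# ≤ y - x
  ≤⇒0≤- {x} = ≤-respects (-‿inverseʳ x) refl ∘ +-monoˡ-≤ (- x)

  0≤-⇒≤ : ∀ {x y} → 0# ≤ y - x → x ≤ y
  0≤-⇒≤ {x} {y} = ≤-respects (+-identityˡ x) (solve 2 (λ x y → y :- x :+ x := y) refl x y) ∘ +-monoˡ-≤ x

  neg-pos : ∀ {x} → x < 0# → 0# < - x
  neg-pos {x} x<0 = <-respects refl (+-identityˡ (- x)) (<⇒0<- x<0)

  pos-neg : ∀ {x} → 0# < x → - x < 0#
  pos-neg {x} 0<x = 0<-⇒< (<-respects refl (solve 1 (λ x → x := con (ℤ.+ 0) :- :- x) refl x) 0<x)

  neg-mono-≤ : ∀ {x y} → x ≤ y → - y ≤ - x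
  neg-mono-≤ {x} {y} x≤y = 0≤-⇒≤ (≤-respects refl (solve 2 (λ x y → y :- x := :- x :- :- y) refl x y) (≤⇒0≤- x≤y))

  neg-cancel-≤ : ∀ {x y} → - y ≤ - x → x ≤ y
  neg-cancel-≤ {x} {y} -y≤-x = 0≤-⇒≤ (≤-respects refl (solve 2 (λ x y → :- x :- :- y := y :- x) refl x y) (≤⇒0≤- -y≤-x))

  *-nonneg : ∀ {x y} → 0# ≤ x → 0# ≤ y → 0# ≤ x * y
  *-nonneg (inj₁ 0<x)  (inj₁ 0<y)  = inj₁ (*-pos 0<x 0<y)
  *-nonneg (inj₁ _)    (inj₂ refl) = inj₂ (sym (zeroʳ _))
  *-nonneg (inj₂ refl) _           = inj₂ (sym (zeroˡ _))

  *-neg-neg : ∀ {x y} → x < 0# → y < 0# → 0# < x * y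
  *-neg-neg {x} {y} x<0 y<0 =
    <-respects refl (solve 2 (λ x y → :- x :* :- y := x :* y) refl x y) (*-pos (neg-pos x<0) (neg-pos y<0))

  *-monoˡ-≤ : ∀ {x y z} → 0# ≤ z → x ≤ y → z * x ≤ z * y
  *-monoˡ-≤ {x} {y} {z} 0≤z x≤y =
    0≤-⇒≤ (≤-respects refl (solve 3 (λ x y z → z :* (y :- x) := z :* y :- z :* x) refl x y z) (*-nonneg 0≤z (≤⇒0≤- x≤y)))

  *-monoˡ-< : ∀ {x y z} → 0# < z → x < y → z * x < z * y
  *-monoˡ-< {x} {y} {z} 0<z x<y =
    0<-⇒< (<-respects refl (solve 3 (λ x y z → z :* (y :- x) := z :* y :- z :* x) refl x y z) (*-pos 0<z (<⇒0<- x<y)))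

  0≤square : ∀ x → 0# ≤ x * x
  0≤square x with compare x 0#
  ... | tri< x<0 _ _ = inj₁ (*-neg-neg x<0 x<0)
  ... | tri≈ _ refl _ = inj₂ (sym (zeroˡ _))
  ... | tri> _ _ 0<x = inj₁ (*-pos 0<x 0<x)

  0<square : ∀ {x} → x ≢ 0# → 0# < x * x
  0<square {x} x≢0 with compare x 0#
  ... | tri< x<0 _ _ = *-neg-neg x<0 x<0
  ... | tri≈ _ x≡0 _ = contradiction x≡0 x≢0
  ... | tri> _ _ 0<x = *-pos 0<x 0<x

  0<1 : 0# < 1#
  0<1 = <-respects refl (*-identityˡ 1#) (0<square (0≢1 ∘ sym))

  *-cancelˡ-< : ∀ {x y z} → 0# < z → z * x < z * y → x < y
  *-cancelˡ-< 0<z zx<zy = ≰⇒> λ y≤x → <⇒≱ zx<zy (*-monoˡ-≤ (<⇒≤ 0<z) y≤x)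

  *-cancelˡ-≤ : ∀ {x y z} → 0# < z → z * x ≤ z * y → x ≤ y
  *-cancelˡ-≤ 0<z zx≤zy = ≮⇒≥ λ y<x → ≤⇒≯ zx≤zy (*-monoˡ-< 0<z y<x)

  *-zero-or : ∀ {x y} → x * y ≡ 0# → x ≢ 0# → y ≡ 0#
  *-zero-or {x} {y} xy≡0 x≢0 with inverse x x≢0
  ... | z , xz≡1 = begin
    y  ≡⟨ *-identityˡ y ⟨
    1# * y  ≡⟨ cong (_* y) xz≡1 ⟨
    x * z * y  ≡⟨ solve 3 (λ x y z → x :* z :* y := z :* (x :* y)) refl x y z ⟩
    z * (x * y)  ≡⟨ cong (z *_) xy≡0 ⟩
    z * 0#  ≡⟨ zeroʳ z ⟩
    0#  ∎
    where open ≡-Reasoning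

  -- Junk value: 0# ⁻¹ = 0#.
  infix 8 _⁻¹
  _⁻¹ : Carrier → Carrier
  x ⁻¹ with x ≟ 0#
  ... | yes _   = 0#
  ... | no  x≢0 = proj₁ (inverse x x≢0)

  ⁻¹-inverseʳ : ∀ {x} → x ≢ 0# → x * x ⁻¹ ≡ 1#
  ⁻¹-inverseʳ {x} x≢0 with x ≟ 0#
  ... | yes x≡0 = contradiction x≡0 x≢0
  ... | no  x≢0 = proj₂ (inverse x x≢0)

  0⁻¹≡0 : 0# ⁻¹ ≡ 0#
  0⁻¹≡0 with 0# ≟ 0#
  ... | yes _   = refl
  ... | no  0≢0 = contradiction refl 0≢0

  ⁻¹-pos : ∀ {x} → 0# < x → 0# < x ⁻¹
  ⁻¹-pos {x} 0<x = *-cancelˡ-< 0<x (<-respects (sym (zeroʳ x)) (sym (⁻¹-inverseʳ (<⇒≢ 0<x ∘ sym))) 0<1)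

  fromℤ-pos : ∀ n → 0# < fromℤ (ℤ.+ ℕ.suc n)
  fromℤ-pos ℕ.zero    = <-respects refl (sym fromℤ-1) 0<1
  fromℤ-pos (ℕ.suc n) = <-respects (+-identityˡ 0#) refl (+-mono-< 0<1 (fromℤ-pos n))

  fromℤ-nonneg : ∀ n → 0# ≤ fromℤ (ℤ.+ n)
  fromℤ-nonneg ℕ.zero    = ≤-refl
  fromℤ-nonneg (ℕ.suc n) = <⇒≤ (fromℤ-pos n)

  fromℤ-neg[1+] : ∀ n → fromℤ -[1+ n ] < 0#
  fromℤ-neg[1+] n = pos-neg (fromℤ-pos n)

  fromℤ-nonneg⁻¹ : ∀ i → 0# ≤ fromℤ i → ∃[ n ] i ≡ ℤ.+ n
  fromℤ-nonneg⁻¹ (ℤ.+ n)    _   = n , refl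
  fromℤ-nonneg⁻¹ -[1+ n ] 0≤i = contradiction 0≤i (<⇒≱ (fromℤ-neg[1+] n))

  -- An ordered field has characteristic 0: by `fromℤ-pos` no nonzero integer goes to 0.
  fromℤ-injective : ∀ {i j} → fromℤ i ≡ fromℤ j → i ≡ j
  fromℤ-injective {i} {j} i≡j = ℤ.i-j≡0⇒i≡j i j (kernel (i ℤ.- j) (begin
    fromℤ (i ℤ.- j)  ≡⟨ fromℤ-+ i (ℤ.- j) ⟩
    fromℤ i + fromℤ (ℤ.- j)  ≡⟨ cong₂ _+_ i≡j (fromℤ-neg j) ⟩
    fromℤ j - fromℤ j  ≡⟨ -‿inverseʳ _ ⟩
    0#  ∎))
    where
    open ≡-Reasoning
    kernel : ∀ i → fromℤ i ≡ 0# → i ≡ ℤ.+ 0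
    kernel (ℤ.+ 0)         _ = refl
    kernel (ℤ.+ ℕ.suc n) eq = contradiction (sym eq) (<⇒≢ (fromℤ-pos n))
    kernel -[1+ n ]    eq = contradiction eq (<⇒≢ (fromℤ-neg[1+] n))

-- Linear algebra over the field.

module LinearAlgebraOverField {ℓ} (K : OrderedField ℓ) where
  open OrderedField K
  open OrderedFieldProperties K
  open CommutativeRing commutativeRing using (semiring)
  open LinearAlgebra commutativeRing public
  open import Algebra.Properties.Semiring.Sum semiring public
    using (sum-cong-≗; ∑-distrib-+; ∑-comm; *-distribˡ-sum; *-distribʳ-sum)
  open Geometry K using (Point; origin; Cube; embed)
  open ≡-Reasoning

  sum-zero : ∀ {n} {f : Fin n → Carrier} → (∀ i → f i ≡ 0#) → sum f ≡ 0#
  sum-zero {ℕ.zero}  f≡0 = refl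
  sum-zero {ℕ.suc n} f≡0 = trans (cong₂ _+_ (f≡0 zero) (sum-zero (f≡0 ∘ suc))) (+-identityˡ 0#)

  sum-single : ∀ {n} (f : Fin n → Carrier) k → (∀ i → i ≢ k → f i ≡ 0#) → sum f ≡ f k
  sum-single f zero    f≡0 =
    trans (cong (f zero +_) (sum-zero λ i → f≡0 (suc i) λ ())) (+-identityʳ _)
  sum-single f (suc k) f≡0 =
    trans (cong₂ _+_ (f≡0 zero λ ()) (sum-single (f ∘ suc) k λ i i≢k → f≡0 (suc i) (i≢k ∘ Fin.suc-injective)))
          (+-identityˡ _)

  sum-mono-≤ : ∀ {n} {f g : Fin n → Carrier} → (∀ i → f i ≤ g i) → sum f ≤ sum g
  sum-mono-≤ {ℕ.zero}  f≤g = ≤-refl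
  sum-mono-≤ {ℕ.suc n} f≤g = +-mono-≤ (f≤g zero) (sum-mono-≤ (f≤g ∘ suc))

  sum-nonneg : ∀ {n} {f : Fin n → Carrier} → (∀ i → 0# ≤ f i) → 0# ≤ sum f
  sum-nonneg {ℕ.zero}  0≤f = ≤-refl
  sum-nonneg {ℕ.suc n} 0≤f = ≤-respects (+-identityˡ 0#) refl (+-mono-≤ (0≤f zero) (sum-nonneg (0≤f ∘ suc)))

  sum-nonneg-≡0 : ∀ {n} {f : Fin n → Carrier} → (∀ i → 0# ≤ f i) → sum f ≡ 0# → ∀ i → f i ≡ 0#
  sum-nonneg-≡0 {f = f} 0≤f Σ≡0 zero = ≤-antisym
    (≤-respects (+-identityʳ _) Σ≡0 (+-monoʳ-≤ (f zero) (sum-nonneg (0≤f ∘ suc)))) (0≤f zero)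
  sum-nonneg-≡0 {f = f} 0≤f Σ≡0 (suc i) = sum-nonneg-≡0 (0≤f ∘ suc)
    (≤-antisym (≤-respects (+-identityˡ _) Σ≡0 (+-monoˡ-≤ (sum (f ∘ suc)) (0≤f zero)))
               (sum-nonneg (0≤f ∘ suc))) i

  sum-mono-≡ : ∀ {n} {f g : Fin n → Carrier} → (∀ i → f i ≤ g i) → sum f ≡ sum g → f ≗ g
  sum-mono-≡ {f = f} {g} f≤g Σf≡Σg i = begin
    f i  ≡⟨ solve 2 (λ x y → x := y :- (y :- x)) refl (f i) (g i) ⟩
    g i - (g i - f i)  ≡⟨ cong (λ z → g i - z) (sum-nonneg-≡0 (≤⇒0≤- ∘ f≤g) Σ≡0 i) ⟩
    g i - 0#  ≡⟨ solve 1 (λ x → x :- con (ℤ.+ 0) := x) refl (g i) ⟩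
    g i  ∎
    where
    Σ≡0 : sum (λ i → g i - f i) ≡ 0#
    Σ≡0 = begin
      sum (λ i → g i - f i)  ≡⟨ solve 2 (λ x y → x := x :+ y :- y) refl _ (sum f) ⟩
      sum (λ i → g i - f i) + sum f - sum f
        ≡⟨ cong (_- sum f) (trans (sym (∑-distrib-+ (λ i → g i - f i) f)) (sum-cong-≗ λ i → solve 2 (λ x y → y :- x :+ x := y) refl (f i) (g i))) ⟩
      sum g - sum f  ≡⟨ cong (λ z → sum g - z) Σf≡Σg ⟩
      sum g - sum g  ≡⟨ -‿inverseʳ _ ⟩
      0#  ∎

  δ : ∀ {n} → Fin n → Fin n → Carrier
  δ i j = if ⌊ i Fin.≟ j ⌋ then 1# else 0#

  δ-refl : ∀ {n} (i : Fin n) → δ i i ≡ 1#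
  δ-refl i with i Fin.≟ i
  ... | yes _  = refl
  ... | no i≢i = contradiction refl i≢i

  δ-≢ : ∀ {n} {i j : Fin n} → i ≢ j → δ i j ≡ 0#
  δ-≢ {i = i} {j} i≢j with i Fin.≟ j
  ... | yes i≡j = contradiction i≡j i≢j
  ... | no  _   = refl

  δ-nonneg : ∀ {n} (i j : Fin n) → 0# ≤ δ i j
  δ-nonneg i j with i Fin.≟ j
  ... | yes _ = <⇒≤ 0<1
  ... | no  _ = ≤-refl

  δ-comm : ∀ {n} (i j : Fin n) → δ i j ≡ δ j i
  δ-comm i j with i Fin.≟ j
  ... | yes refl = sym (δ-refl i)
  ... | no  i≢j  = sym (δ-≢ (i≢j ∘ sym))

  sum-δ : ∀ {n} (f : Fin n → Carrier) k → sum (λ i → δ i k * f i) ≡ f k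
  sum-δ f k = trans
    (sum-single _ k λ i i≢k → trans (cong (_* f i) (δ-≢ i≢k)) (zeroˡ _))
    (trans (cong (_* f k) (δ-refl k)) (*-identityˡ _))

  sum-δ-1 : ∀ {n} (k : Fin n) → sum (λ i → δ i k) ≡ 1#
  sum-δ-1 k = trans (sum-cong-≗ λ i → sym (*-identityʳ (δ i k))) (sum-δ (λ _ → 1#) k)

  private variable
    d m n : ℕ

  point-ext : {x y : Point d} → (∀ j → lookup x j ≡ lookup y j) → x ≡ y
  point-ext {x = x} {y} eq = begin
    x  ≡⟨ Vec.tabulate∘lookup x ⟨
    tabulate (lookup x)  ≡⟨ Vec.tabulate-cong eq ⟩
    tabulate (lookup y)  ≡⟨ Vec.tabulate∘lookup y ⟩
    y  ∎

  lookup-origin : ∀ (j : Fin d) → lookup origin j ≡ 0#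
  lookup-origin j = Vec.lookup-replicate j 0#

  infix 4 _≟ᴾ_
  _≟ᴾ_ : (x y : Point d) → Dec (x ≡ y)
  _≟ᴾ_ = Vec.≡-dec _≟_

  std : Fin d → Point d
  std j = tabulate (δ j)

  infixl 6 _⊕_∙_
  _⊕_∙_ : Point d → Carrier → Point d → Point d
  x ⊕ t ∙ y = tabulate λ j → lookup x j + t * lookup y j

  lookup-⊕∙ : ∀ (x : Point d) t y j → lookup (x ⊕ t ∙ y) j ≡ lookup x j + t * lookup y j
  lookup-⊕∙ x t y = Vec.lookup∘tabulate _

  lookup-lincomb : ∀ (w : Fin n → Carrier) (v : Fin n → Point d) j →
                   lookup (lincomb w v) j ≡ sum λ i → w i * lookup (v i) j
  lookup-lincomb w v = Vec.lookup∘tabulate _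

  lincomb-cong : ∀ {w w′ : Fin n → Carrier} {v v′ : Fin n → Point d} → w ≗ w′ → v ≗ v′ → lincomb w v ≡ lincomb w′ v′
  lincomb-cong w≗w′ v≗v′ = Vec.tabulate-cong λ j → sum-cong-≗ λ i → cong₂ _*_ (w≗w′ i) (cong (λ x → lookup x j) (v≗v′ i))

  lincomb-zero : ∀ {w : Fin n → Carrier} (v : Fin n → Point d) → (∀ i → w i ≡ 0#) → lincomb w v ≡ origin
  lincomb-zero {w = w} v w≡0 = point-ext λ j → trans (lookup-lincomb w v j)
    (trans (sum-zero λ i → trans (cong (_* lookup (v i) j) (w≡0 i)) (zeroˡ _)) (sym (lookup-origin j)))

  lincomb-δ : ∀ (v : Fin n → Point d) k → lincomb (λ i → δ i k) v ≡ v k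
  lincomb-δ v k = point-ext λ j → trans (lookup-lincomb _ v j) (sum-δ (λ i → lookup (v i) j) k)

  -- Associativity of the matrix product: a row times a matrix times a column.
  sum-*-sum : ∀ (c : Fin m → Carrier) (C : Fin m → Fin n → Carrier) (f : Fin n → Carrier) →
              sum (λ k → c k * sum (λ i → C k i * f i)) ≡ sum (λ i → sum (λ k → c k * C k i) * f i)
  sum-*-sum c C f = begin
    sum (λ k → c k * sum (λ i → C k i * f i))  ≡⟨ sum-cong-≗ (λ k → *-distribˡ-sum (c k) (λ i → C k i * f i)) ⟩
    sum (λ k → sum (λ i → c k * (C k i * f i)))  ≡⟨ ∑-comm (λ k i → c k * (C k i * f i)) ⟩
    sum (λ i → sum (λ k → c k * (C k i * f i)))  ≡⟨ sum-cong-≗ (λ i → trans (sum-cong-≗ λ k → sym (*-assoc (c k) (C k i) (f i))) (sym (*-distribʳ-sum (f i) λ k → c k * C k i))) ⟩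
    sum (λ i → sum (λ k → c k * C k i) * f i)  ∎

  lincomb-lincomb : ∀ (c : Fin m → Carrier) (C : Fin m → Fin n → Carrier) (v : Fin n → Point d) →
                    lincomb c (λ k → lincomb (C k) v) ≡ lincomb (λ i → sum λ k → c k * C k i) v
  lincomb-lincomb c C v = Vec.tabulate-cong λ j → trans
    (sum-cong-≗ λ k → cong (c k *_) (lookup-lincomb (C k) v j)) (sum-*-sum c C (λ i → lookup (v i) j))

  dot-comm : ∀ (x y : Point d) → dot x y ≡ dot y x
  dot-comm x y = sum-cong-≗ λ j → *-comm (lookup x j) (lookup y j)

  dot-lincombʳ : ∀ u (w : Fin n → Carrier) (v : Fin n → Point d) →
                dot u (lincomb w v) ≡ sum λ i → w i * dot u (v i)
  dot-lincombʳ u w v = begin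
    dot u (lincomb w v)
      ≡⟨ sum-cong-≗ (λ j → cong (lookup u j *_) (trans (lookup-lincomb w v j) (sum-cong-≗ λ i → *-comm (w i) (lookup (v i) j)))) ⟩
    sum (λ j → lookup u j * sum (λ i → lookup (v i) j * w i))
      ≡⟨ sum-*-sum (lookup u) (λ j i → lookup (v i) j) w ⟩
    sum (λ i → dot u (v i) * w i)
      ≡⟨ sum-cong-≗ (λ i → *-comm (dot u (v i)) (w i)) ⟩
    sum (λ i → w i * dot u (v i)) ∎

  dot-lincombˡ : ∀ (w : Fin n → Carrier) (v : Fin n → Point d) x →
                 dot (lincomb w v) x ≡ sum λ i → w i * dot (v i) x
  dot-lincombˡ w v x = trans (dot-comm (lincomb w v) x) (trans (dot-lincombʳ x w v) (sum-cong-≗ λ i → cong (w i *_) (dot-comm x (v i))))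

  dot-⊕∙ʳ : ∀ u (x : Point d) t y → dot u (x ⊕ t ∙ y) ≡ dot u x + t * dot u y
  dot-⊕∙ʳ u x t y = begin
    dot u (x ⊕ t ∙ y)
      ≡⟨ sum-cong-≗ (λ j → trans (cong (lookup u j *_) (lookup-⊕∙ x t y j))
           (solve 4 (λ u x t y → u :* (x :+ t :* y) := u :* x :+ t :* (u :* y)) refl (lookup u j) (lookup x j) t (lookup y j))) ⟩
    sum (λ j → lookup u j * lookup x j + t * (lookup u j * lookup y j))
      ≡⟨ ∑-distrib-+ (λ j → lookup u j * lookup x j) (λ j → t * (lookup u j * lookup y j)) ⟩
    dot u x + sum (λ j → t * (lookup u j * lookup y j))
      ≡⟨ cong (dot u x +_) (*-distribˡ-sum t (λ j → lookup u j * lookup y j)) ⟨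
    dot u x + t * dot u y ∎

  dot-⊕∙ˡ : ∀ (x : Point d) t y u → dot (x ⊕ t ∙ y) u ≡ dot x u + t * dot y u
  dot-⊕∙ˡ x t y u = trans (dot-comm (x ⊕ t ∙ y) u) (trans (dot-⊕∙ʳ u x t y) (cong₂ (λ p q → p + t * q) (dot-comm u x) (dot-comm u y)))

  dot-originˡ : ∀ (x : Point d) → dot origin x ≡ 0#
  dot-originˡ x = sum-zero λ j → trans (cong (_* lookup x j) (lookup-origin j)) (zeroˡ _)

  dot-originʳ : ∀ (x : Point d) → dot x origin ≡ 0#
  dot-originʳ x = trans (dot-comm x origin) (dot-originˡ x)

  dot-std : ∀ (x : Point d) j → dot x (std j) ≡ lookup x j
  dot-std x j = begin
    dot x (std j)  ≡⟨ dot-comm x (std j) ⟩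
    dot (std j) x  ≡⟨ sum-cong-≗ (λ i → cong (_* lookup x i) (trans (Vec.lookup∘tabulate (δ j) i) (δ-comm j i))) ⟩
    sum (λ i → δ i j * lookup x i)  ≡⟨ sum-δ (lookup x) j ⟩
    lookup x j  ∎

  dot-self-nonneg : ∀ (x : Point d) → 0# ≤ dot x x
  dot-self-nonneg x = sum-nonneg λ j → 0≤square (lookup x j)

  dot-self-≡0 : ∀ (x : Point d) → dot x x ≡ 0# → x ≡ origin
  dot-self-≡0 x x·x≡0 = point-ext λ j → trans (square≡0 (sum-nonneg-≡0 (λ j → 0≤square (lookup x j)) x·x≡0 j)) (sym (lookup-origin j))
    where
    square≡0 : ∀ {y} → y * y ≡ 0# → y ≡ 0#
    square≡0 {y} y²≡0 with y ≟ 0#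
    ... | yes y≡0 = y≡0
    ... | no  y≢0 = *-zero-or y²≡0 y≢0

  dot-self-pos : ∀ {x : Point d} → x ≢ origin → 0# < dot x x
  dot-self-pos {x = x} x≢0 = ≤∧≢⇒< (dot-self-nonneg x) (x≢0 ∘ dot-self-≡0 x ∘ sym)

  dot-ext : ∀ {x y : Point d} → (∀ z → dot x z ≡ dot y z) → x ≡ y
  dot-ext {x = x} {y} eq = point-ext λ j → trans (sym (dot-std x j)) (trans (eq (std j)) (dot-std y j))

  InSpan : (Fin n → Point d) → Point d → Set ℓ
  InSpan v x = ∃[ c ] lincomb c v ≡ x

  InSpan-∋ : ∀ (v : Fin n → Point d) k → InSpan v (v k)
  InSpan-∋ v k = (λ i → δ i k) , lincomb-δ v k

  InSpan-lincomb : ∀ (v : Fin n → Point d) {u : Fin m → Point d} → (∀ k → InSpan v (u k)) →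
                   ∀ c → InSpan v (lincomb c u)
  InSpan-lincomb v u∈ c = _ , trans (sym (lincomb-lincomb c (proj₁ ∘ u∈) v)) (lincomb-cong (λ _ → refl) (proj₂ ∘ u∈))

  InSpan-⊕∙ : ∀ (v : Fin n → Point d) {x y} t → InSpan v x → InSpan v y → InSpan v (x ⊕ t ∙ y)
  InSpan-⊕∙ v t (c , refl) (c′ , refl) = (λ i → c i + t * c′ i) , point-ext λ j → begin
    lookup (lincomb (λ i → c i + t * c′ i) v) j
      ≡⟨ lookup-lincomb _ v j ⟩
    sum (λ i → (c i + t * c′ i) * lookup (v i) j)
      ≡⟨ sum-cong-≗ (λ i → solve 4 (λ c t c′ y → (c :+ t :* c′) :* y := c :* y :+ t :* (c′ :* y)) refl (c i) t (c′ i) (lookup (v i) j)) ⟩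
    sum (λ i → c i * lookup (v i) j + t * (c′ i * lookup (v i) j))
      ≡⟨ trans (∑-distrib-+ (λ i → c i * lookup (v i) j) (λ i → t * (c′ i * lookup (v i) j))) (cong (sum (λ i → c i * lookup (v i) j) +_) (sym (*-distribˡ-sum t (λ i → c′ i * lookup (v i) j)))) ⟩
    sum (λ i → c i * lookup (v i) j) + t * sum (λ i → c′ i * lookup (v i) j)
      ≡⟨ cong₂ (λ p q → p + t * q) (lookup-lincomb c v j) (lookup-lincomb c′ v j) ⟨
    lookup (lincomb c v) j + t * lookup (lincomb c′ v) j
      ≡⟨ lookup-⊕∙ (lincomb c v) t (lincomb c′ v) j ⟨
    lookup (lincomb c v ⊕ t ∙ lincomb c′ v) j ∎

  LinearlyIndependent : (Fin n → Point d) → Set ℓ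
  LinearlyIndependent v = ∀ c → lincomb c v ≡ origin → ∀ i → c i ≡ 0#

  -- Gaussian elimination of the first coordinate against a vector v i in which it
  -- does not vanish.
  orthogonal-or-spanning : ∀ (v : Fin m → Point d) →
    (∃[ u ] u ≢ origin × (∀ i → dot u (v i) ≡ 0#)) ⊎ (d ℕ.≤ m × (∀ x → InSpan v x))
  orthogonal-or-spanning {d = ℕ.zero} v = inj₂ (ℕ.z≤n , λ { [] → (λ _ → 0#) , refl })
  orthogonal-or-spanning {m = m} {d = ℕ.suc d} v with Fin.any? (λ i → ¬? (lookup (v i) zero ≟ 0#))
  ... | no none = inj₁ (1# ∷ origin , (λ eq → 0≢1 (sym (cong (λ x → lookup x zero) eq))) , λ i →
    trans (cong₂ _+_ (*-identityˡ _) (sum-zero λ j → trans (cong (_* lookup (v i) (suc j)) (lookup-origin j)) (zeroˡ _)))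
          (trans (+-identityʳ _) (head≡0 i)))
    where
    head≡0 : ∀ i → lookup (v i) zero ≡ 0#
    head≡0 i with lookup (v i) zero ≟ 0#
    ... | yes eq  = eq
    ... | no  neq = contradiction (i , neq) none
  orthogonal-or-spanning {m = ℕ.suc m} {d = ℕ.suc d} v | yes (i , h≢0) =
    case orthogonal-or-spanning w of λ where
      (inj₁ (u , u≢0 , u⊥w)) → inj₁ (extend u , (λ eq → u≢0 (cong Vec.tail eq)) , extend-⊥ u u⊥w)
      (inj₂ (d≤m , spans))   → inj₂ (ℕ.s≤s d≤m , spans-v spans)
    where
    hd : Fin (ℕ.suc m) → Carrier
    hd k = lookup (v k) zero
    tl : Fin (ℕ.suc m) → Point d
    tl k = tabulate λ j → lookup (v k) (suc j)
    ratio : Fin (ℕ.suc m) → Carrier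
    ratio k = hd k * hd i ⁻¹
    eliminate : Fin (ℕ.suc m) → Point d
    eliminate k = tl k ⊕ - ratio k ∙ tl i
    w : Fin m → Point d
    w k = eliminate (punchIn i k)

    dot-cons : ∀ t (u : Point d) k → dot (t ∷ u) (v k) ≡ t * hd k + dot u (tl k)
    dot-cons t u k = cong (t * hd k +_) (sum-cong-≗ λ j → cong (lookup u j *_) (sym (Vec.lookup∘tabulate (λ j → lookup (v k) (suc j)) j)))

    extend : Point d → Point (ℕ.suc d)
    -- Orthogonality to `v i` forces this first coordinate. For the other vectors, orthogonality
    -- then reduces to that of `u` to their eliminated tails.
    extend u = - (dot u (tl i) * hd i ⁻¹) ∷ u

    extend-⊥ : ∀ u → (∀ k → dot u (w k) ≡ 0#) → ∀ k → dot (extend u) (v k) ≡ 0#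
    extend-⊥ u u⊥w k with i Fin.≟ k
    ... | yes refl = begin
      dot (extend u) (v i)  ≡⟨ dot-cons _ u i ⟩
      - (dot u (tl i) * hd i ⁻¹) * hd i + dot u (tl i)
        ≡⟨ solve 3 (λ D h⁻¹ h → :- (D :* h⁻¹) :* h :+ D := D :* (con (ℤ.+ 1) :- h :* h⁻¹)) refl (dot u (tl i)) (hd i ⁻¹) (hd i) ⟩
      dot u (tl i) * (1# - hd i * hd i ⁻¹)  ≡⟨ cong (λ z → dot u (tl i) * (1# - z)) (⁻¹-inverseʳ h≢0) ⟩
      dot u (tl i) * (1# - 1#)  ≡⟨ solve 1 (λ D → D :* (con (ℤ.+ 1) :- con (ℤ.+ 1)) := con (ℤ.+ 0)) refl (dot u (tl i)) ⟩
      0#  ∎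
    ... | no i≢k = begin
      dot (extend u) (v k)  ≡⟨ dot-cons _ u k ⟩
      - (dot u (tl i) * hd i ⁻¹) * hd k + dot u (tl k)
        ≡⟨ solve 4 (λ D h⁻¹ h E → :- (D :* h⁻¹) :* h :+ E := E :+ :- (h :* h⁻¹) :* D) refl (dot u (tl i)) (hd i ⁻¹) (hd k) (dot u (tl k)) ⟩
      dot u (tl k) + - ratio k * dot u (tl i)  ≡⟨ dot-⊕∙ʳ u (tl k) (- ratio k) (tl i) ⟨
      dot u (eliminate k)  ≡⟨ cong (dot u ∘ eliminate) (Fin.punchIn-punchOut i≢k) ⟨
      dot u (w (punchOut i≢k))  ≡⟨ u⊥w _ ⟩
      0#  ∎

    spans-v : (∀ x → InSpan w x) → ∀ x → InSpan v x
    spans-v spans x = subst (InSpan v) (point-ext eq) (InSpan-⊕∙ v s 0∷y∈ (InSpan-∋ v i))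
      where
      -- Subtracting `s` times `v i` from `x` clears the first coordinate and leaves `0# ∷ y`, where
      -- the eliminated vectors span.
      s = lookup x zero * hd i ⁻¹
      y : Point d
      y = (tabulate λ j → lookup x (suc j)) ⊕ - s ∙ tl i
      0∷w∈ : ∀ k → InSpan v (0# ∷ w k)
      0∷w∈ k = subst (InSpan v) (point-ext λ where
        zero → begin
          hd k′ + - (hd k′ * hd i ⁻¹) * hd i  ≡⟨ solve 3 (λ k h⁻¹ h → k :+ :- (k :* h⁻¹) :* h := k :* (con (ℤ.+ 1) :- h :* h⁻¹)) refl (hd k′) (hd i ⁻¹) (hd i) ⟩
          hd k′ * (1# - hd i * hd i ⁻¹)  ≡⟨ cong (λ z → hd k′ * (1# - z)) (⁻¹-inverseʳ h≢0) ⟩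
          hd k′ * (1# - 1#)  ≡⟨ solve 1 (λ D → D :* (con (ℤ.+ 1) :- con (ℤ.+ 1)) := con (ℤ.+ 0)) refl (hd k′) ⟩
          0#  ∎
        (suc j) → begin
          lookup (v k′ ⊕ - ratio k′ ∙ v i) (suc j)  ≡⟨ lookup-⊕∙ (v k′) (- ratio k′) (v i) (suc j) ⟩
          lookup (v k′) (suc j) + - ratio k′ * lookup (v i) (suc j)
            ≡⟨ cong₂ (λ p q → p + - ratio k′ * q) (Vec.lookup∘tabulate (λ j → lookup (v k′) (suc j)) j) (Vec.lookup∘tabulate (λ j → lookup (v i) (suc j)) j) ⟨
          lookup (tl k′) j + - ratio k′ * lookup (tl i) j  ≡⟨ lookup-⊕∙ (tl k′) (- ratio k′) (tl i) j ⟨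
          lookup (w k) j  ∎)
        (InSpan-⊕∙ v (- ratio k′) (InSpan-∋ v k′) (InSpan-∋ v i))
        where k′ = punchIn i k
      0∷y∈ : InSpan v (0# ∷ y)
      0∷y∈ with spans y
      ... | c , cw≡y = subst (InSpan v)
        (cong₂ _∷_ (sum-zero λ k → zeroʳ (c k)) cw≡y) (InSpan-lincomb v 0∷w∈ c)
      eq : ∀ j → lookup ((0# ∷ y) ⊕ s ∙ v i) j ≡ lookup x j
      eq zero = begin
        0# + lookup x zero * hd i ⁻¹ * hd i  ≡⟨ solve 3 (λ x h⁻¹ h → con (ℤ.+ 0) :+ x :* h⁻¹ :* h := x :* (h :* h⁻¹)) refl (lookup x zero) (hd i ⁻¹) (hd i) ⟩
        lookup x zero * (hd i * hd i ⁻¹)  ≡⟨ cong (lookup x zero *_) (⁻¹-inverseʳ h≢0) ⟩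
        lookup x zero * 1#  ≡⟨ *-identityʳ _ ⟩
        lookup x zero  ∎
      eq (suc j) = begin
        lookup ((0# ∷ y) ⊕ s ∙ v i) (suc j)  ≡⟨ lookup-⊕∙ (0# ∷ y) s (v i) (suc j) ⟩
        lookup y j + s * lookup (v i) (suc j)
          ≡⟨ cong (_+ s * lookup (v i) (suc j)) (trans (lookup-⊕∙ (tabulate λ j → lookup x (suc j)) (- s) (tl i) j)
               (cong₂ (λ p q → p + - s * q) (Vec.lookup∘tabulate (λ j → lookup x (suc j)) j) (Vec.lookup∘tabulate (λ j → lookup (v i) (suc j)) j))) ⟩
        lookup x (suc j) + - s * lookup (v i) (suc j) + s * lookup (v i) (suc j)
          ≡⟨ solve 3 (λ x s y → x :+ :- s :* y :+ s :* y := x) refl (lookup x (suc j)) s (lookup (v i) (suc j)) ⟩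
        lookup x (suc j) ∎

  -- The dichotomy is applied to the transposed matrix of coefficients: `m` vectors in dimension
  -- `n`. A nonzero vector orthogonal to all of them would be the coefficient vector of a relation
  -- among the `q k`.
  independent-in-span⇒≤ : ∀ {q : Fin n → Point d} {v : Fin m → Point d} →
    LinearlyIndependent q → (∀ k → InSpan v (q k)) → n ℕ.≤ m
  independent-in-span⇒≤ {n = n} {m = m} {q = q} {v} indep q∈ with orthogonal-or-spanning (λ i → tabulate λ k → proj₁ (q∈ k) i)
  ... | inj₂ (n≤m , _)        = n≤m
  ... | inj₁ (u , u≢0 , u⊥C) = contradiction (point-ext λ k → trans (indep (lookup u) dependent k) (sym (lookup-origin k))) u≢0
    where
    dependent : lincomb (lookup u) q ≡ origin
    dependent = begin
      lincomb (lookup u) q  ≡⟨ lincomb-cong (λ _ → refl) (sym ∘ proj₂ ∘ q∈) ⟩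
      lincomb (lookup u) (λ k → lincomb (proj₁ (q∈ k)) v)  ≡⟨ lincomb-lincomb (lookup u) (proj₁ ∘ q∈) v ⟩
      lincomb (λ i → sum λ k → lookup u k * proj₁ (q∈ k) i) v
        ≡⟨ lincomb-zero v (λ i → trans (sum-cong-≗ λ k → cong (lookup u k *_) (sym (Vec.lookup∘tabulate (λ k → proj₁ (q∈ k) i) k))) (u⊥C i)) ⟩
      origin  ∎

  lincomb-std : ∀ (x : Point d) → lincomb (lookup x) std ≡ x
  lincomb-std x = dot-ext λ z → trans (dot-lincombˡ (lookup x) std z)
    (sum-cong-≗ λ j → cong (lookup x j *_) (trans (dot-comm (std j) z) (dot-std z j)))

  independent⇒≤ : ∀ {q : Fin n → Point d} → LinearlyIndependent q → n ℕ.≤ d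
  independent⇒≤ {q = q} indep = independent-in-span⇒≤ {q = q} {std} indep λ k → lookup (q k) , lincomb-std (q k)

  infixr 5 _∷ᶠ_
  _∷ᶠ_ : ∀ {a} {A : Set a} → A → (Fin n → A) → Fin (ℕ.suc n) → A
  (x ∷ᶠ f) zero    = x
  (x ∷ᶠ f) (suc i) = f i

  -- Applying `u` to a relation isolates the coefficient of `x`.
  independent-∷ : ∀ (q : Fin n → Point d) x u → LinearlyIndependent q →
    (∀ i → dot u (q i) ≡ 0#) → dot u x ≢ 0# → LinearlyIndependent (x ∷ᶠ q)
  independent-∷ q x u indep u⊥q ux≢0 c eq = λ where
      zero    → c₀≡0
      (suc i) → indep (c ∘ suc) (trans (Vec.tabulate-cong drop-head) eq) i
    where
    c₀≡0 : c zero ≡ 0#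
    c₀≡0 = *-zero-or (begin
      dot u x * c zero  ≡⟨ solve 2 (λ x y → x :* y := y :* x :+ con (ℤ.+ 0)) refl _ _ ⟩
      c zero * dot u x + 0#
        ≡⟨ cong (c zero * dot u x +_) (sum-zero λ j → trans (cong (c (suc j) *_) (u⊥q j)) (zeroʳ _)) ⟨
      sum (λ j → c j * dot u ((x ∷ᶠ q) j))  ≡⟨ dot-lincombʳ u c (x ∷ᶠ q) ⟨
      dot u (lincomb c (x ∷ᶠ q))  ≡⟨ cong (dot u) eq ⟩
      dot u origin  ≡⟨ dot-originʳ u ⟩
      0#  ∎) ux≢0
    drop-head : ∀ j → sum (λ i → c (suc i) * lookup (q i) j) ≡ c zero * lookup x j + sum (λ i → c (suc i) * lookup (q i) j)
    drop-head j = sym (trans (cong (_+ sum (λ i → c (suc i) * lookup (q i) j)) (trans (cong (_* lookup x j) c₀≡0) (zeroˡ _))) (+-identityˡ _))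

  independent-cong : ∀ (q q′ : Fin n → Point d) → q ≗ q′ → LinearlyIndependent q → LinearlyIndependent q′
  independent-cong q q′ q≗q′ indep c eq = indep c (trans (lincomb-cong (λ _ → refl) q≗q′) eq)

  -- Greedy choice: as long as fewer than `d` vectors are chosen, some `u` ≢ `origin` is orthogonal
  -- to them, and a `v i` not orthogonal to `u` extends the family.
  basis-extraction : ∀ (v : Fin m → Point d) → (∀ u → (∀ i → dot u (v i) ≡ 0#) → u ≡ origin) →
    ∃[ τ ] LinearlyIndependent {n = d} (v ∘ τ)
  basis-extraction {m = m} {d = d} v spans = extract d ℕ.≤-refl
    where
    extract : ∀ k → k ℕ.≤ d → ∃[ τ ] LinearlyIndependent {n = k} (v ∘ τ)
    extract ℕ.zero    _   = (λ ()) , λ _ _ ()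
    extract (ℕ.suc k) k<d with extract k (ℕ.<⇒≤ k<d)
    ... | τ , indep with orthogonal-or-spanning (v ∘ τ)
    ...   | inj₂ (d≤k , _) = contradiction d≤k (ℕ.<⇒≱ k<d)
    ...   | inj₁ (u , u≢0 , u⊥) with Fin.¬∀⟶∃¬ m (λ i → dot u (v i) ≡ 0#) (λ i → dot u (v i) ≟ 0#) (u≢0 ∘ spans u)
    ...     | i , ui≢0 = i ∷ᶠ τ , independent-cong (v i ∷ᶠ v ∘ τ) (v ∘ (i ∷ᶠ τ)) (λ { zero → refl ; (suc _) → refl }) (independent-∷ (v ∘ τ) (v i) u indep u⊥ ui≢0)

  -- Maxima, perturbations and the equality case of weighted averages.

  argmax : ∀ {p} {P : Fin n → Set p} → (∀ i → Dec (P i)) → (f : Fin n → Carrier) → ∃ P →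
           ∃[ j ] P j × (∀ i → P i → f i ≤ f j)
  argmax {n = ℕ.suc n} {P = P} P? f ∃P with P? zero | Fin.any? (P? ∘ suc)
  ... | no ¬p₀ | no ¬ps = ⊥-elim (case ∃P of λ { (zero , p₀) → ¬p₀ p₀ ; (suc i , pᵢ) → ¬ps (i , pᵢ) })
  ... | yes p₀ | no ¬ps = zero , p₀ , λ { zero _ → ≤-refl ; (suc i) pᵢ → contradiction (i , pᵢ) ¬ps }
  ... | no ¬p₀ | yes ps with argmax (P? ∘ suc) (f ∘ suc) ps
  ...   | j , pⱼ , max = suc j , pⱼ , λ { zero p₀ → contradiction p₀ ¬p₀ ; (suc i) pᵢ → max i pᵢ }
  argmax {n = ℕ.suc n} P? f ∃P | yes p₀ | yes ps with argmax (P? ∘ suc) (f ∘ suc) ps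
  ...   | j , pⱼ , max with f zero ≤? f (suc j)
  ...     | yes f₀≤fⱼ = suc j , pⱼ , λ { zero _ → f₀≤fⱼ ; (suc i) pᵢ → max i pᵢ }
  ...     | no  f₀≰fⱼ = zero , p₀ , λ { zero _ → ≤-refl ; (suc i) pᵢ → ≤-trans (max i pᵢ) (<⇒≤ (≰⇒> f₀≰fⱼ)) }

  -- The bound covers all η up to ε, so that the bounds for the single indices combine by taking the
  -- smaller one.
  small-perturbation : ∀ (p q : Fin n → Carrier) →
    ∃[ ε ] 0# < ε × (∀ η → 0# < η → η ≤ ε → ∀ i → 0# < p i → 0# < p i + η * q i)
  small-perturbation {n = ℕ.zero} p q = 1# , 0<1 , λ _ _ _ ()
  small-perturbation {n = ℕ.suc n} p q with small-perturbation (p ∘ suc) (q ∘ suc) | single (p zero) (q zero)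
    where
    single : ∀ p q → ∃[ ε ] 0# < ε × (∀ η → 0# < η → η ≤ ε → 0# < p → 0# < p + η * q)
    single p q with q <? 0# | 0# <? p
    ... | _ | no p≤0 = 1# , 0<1 , λ _ _ _ 0<p → contradiction 0<p p≤0
    ... | no q≥0 | yes _ = 1# , 0<1 , λ η 0<η _ 0<p →
      <-respects (+-identityˡ 0#) refl (+-mono-<-≤ 0<p (*-nonneg (<⇒≤ 0<η) (≮⇒≥ q≥0)))
    -- With r = 1 - q, the condition η r ≤ p says that p + η q ≥ η, which is positive.
    ... | yes q<0 | yes 0<p = p * r ⁻¹ , *-pos 0<p (⁻¹-pos 0<r) , λ η 0<η η≤ε _ →
      <-≤-trans 0<η (0≤-⇒≤ (≤-respects refl
        (solve 3 (λ p η q → p :- (con (ℤ.+ 1) :- q) :* η := p :+ η :* q :- η) refl p η q)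
        (≤⇒0≤- (≤-respects refl (begin
          r * (p * r ⁻¹)  ≡⟨ solve 3 (λ r p s → r :* (p :* s) := p :* (r :* s)) refl r p (r ⁻¹) ⟩
          p * (r * r ⁻¹)  ≡⟨ cong (p *_) (⁻¹-inverseʳ (<⇒≢ 0<r ∘ sym)) ⟩
          p * 1#  ≡⟨ *-identityʳ p ⟩
          p  ∎) (*-monoˡ-≤ (<⇒≤ 0<r) η≤ε)))))
      where
      r = 1# - q
      0<r : 0# < r
      0<r = <-respects (+-identityˡ 0#) refl (+-mono-< 0<1 (neg-pos q<0))
  ... | ε₁ , 0<ε₁ , small₁ | ε₂ , 0<ε₂ , small₂ with ε₁ ≤? ε₂
  ...   | yes ε₁≤ε₂ = ε₁ , 0<ε₁ , λ η 0<η η≤ε → λ where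
            zero    → small₂ η 0<η (≤-trans η≤ε ε₁≤ε₂)
            (suc i) → small₁ η 0<η η≤ε i
  ...   | no  ε₁≰ε₂ = ε₂ , 0<ε₂ , λ η 0<η η≤ε → λ where
            zero    → small₂ η 0<η η≤ε
            (suc i) → small₁ η 0<η (≤-trans η≤ε (<⇒≤ (≰⇒> ε₁≰ε₂))) i

  common-lower-bound : ∀ {x y} → 0# < x → 0# < y → ∃[ z ] 0# < z × z ≤ x × z ≤ y
  common-lower-bound {x} {y} 0<x 0<y with x ≤? y
  ... | yes x≤y = x , 0<x , ≤-refl , x≤y
  ... | no  x≰y = y , 0<y , <⇒≤ (≰⇒> x≰y) , ≤-refl

  -- The form in which openness is used: from the centre of a cube one can move a positive distance
  -- in any direction. The two sides of each coordinate are perturbations of ε.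
  cube-ray : ∀ (x u : Point d) {ε} → 0# < ε → ∃[ t ] 0# < t × Cube x ε (x ⊕ t ∙ u)
  cube-ray x u {ε} 0<ε
    with small-perturbation (λ _ → ε) (lookup u) | small-perturbation (λ _ → ε) (λ j → - lookup u j)
  ... | ε₁ , 0<ε₁ , small₁ | ε₂ , 0<ε₂ , small₂ with common-lower-bound 0<ε₁ 0<ε₂
  ...   | t , 0<t , t≤ε₁ , t≤ε₂ = t , 0<t , λ j →
    0<-⇒< (<-respects refl (begin
      ε + t * lookup u j  ≡⟨ solve 4 (λ ε t u x → ε :+ t :* u := x :+ t :* u :- x :- :- ε) refl ε t (lookup u j) (lookup x j) ⟩
      lookup x j + t * lookup u j - lookup x j - (- ε)  ≡⟨ cong (λ y → y - lookup x j - (- ε)) (lookup-⊕∙ x t u j) ⟨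
      lookup (x ⊕ t ∙ u) j - lookup x j - (- ε)  ∎) (small₁ t 0<t t≤ε₁ j 0<ε)) ,
    0<-⇒< (<-respects refl (begin
      ε + t * (- lookup u j)  ≡⟨ solve 4 (λ ε t u x → ε :+ t :* (:- u) := ε :- (x :+ t :* u :- x)) refl ε t (lookup u j) (lookup x j) ⟩
      ε - (lookup x j + t * lookup u j - lookup x j)  ≡⟨ cong (λ y → ε - (y - lookup x j)) (lookup-⊕∙ x t u j) ⟨
      ε - (lookup (x ⊕ t ∙ u) j - lookup x j)  ∎) (small₂ t 0<t t≤ε₂ j 0<ε))

  -- The vectors are treated one after the other. If the current functional vanishes at a vector u,
  -- a small multiple of u is added: its value at u becomes positive since u · u > 0, and no nonzero
  -- value changes sign. Starting from `h₀`, the signs of `h₀` survive, so the result refines the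
  -- preorder given by `h₀`.
  generic-functional : ∀ (h₀ : Point d) (v : Fin n → Point d) →
    ∃[ h ] (∀ i → v i ≢ origin → dot h (v i) ≢ 0#) × (∀ i → 0# < dot h₀ (v i) → 0# < dot h (v i))
  generic-functional {d = d} {n = n} h₀ v with go id
    where
    SameSign : Point d → Point d → Set ℓ
    SameSign h h′ = ∀ i → dot h (v i) ≢ 0# → 0# < dot h (v i) * dot h′ (v i)
    positive-factorʳ : ∀ {x y} → 0# < x * y → y ≢ 0#
    positive-factorʳ {x} 0<xy refl = <-irrefl (sym (zeroʳ x)) 0<xy
    go : ∀ {m} (f : Fin m → Fin n) → ∃[ h ] (∀ i → v (f i) ≢ origin → dot h (v (f i)) ≢ 0#) × SameSign h₀ h
    go {ℕ.zero}  f = h₀ , (λ ()) , λ i → 0<square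
    go {ℕ.suc m} f with go (f ∘ suc)
    ... | h , nonzero , same with dot h (v (f zero)) ≟ 0#
    ...   | no  hv≢0 = h , (λ { zero _ → hv≢0 ; (suc i) → nonzero i }) , same
    -- Multiplying by the old value makes all values to be preserved positive, whatever their sign.
    ...   | yes hv≡0 with small-perturbation (λ i → dot h (v i) * dot h (v i)) (λ i → dot h (v i) * dot (v (f zero)) (v i))
    ...     | ε , 0<ε , small = h′ , nonzero′ , same″
      where
      u = v (f zero)
      h′ = h ⊕ ε ∙ u
      same′ : SameSign h h′
      same′ i hv≢0 = <-respects refl (begin
        dot h (v i) * dot h (v i) + ε * (dot h (v i) * dot u (v i))
          ≡⟨ solve 3 (λ x ε y → x :* x :+ ε :* (x :* y) := x :* (x :+ ε :* y)) refl (dot h (v i)) ε (dot u (v i)) ⟩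
        dot h (v i) * (dot h (v i) + ε * dot u (v i))
          ≡⟨ cong (dot h (v i) *_) (dot-⊕∙ˡ h ε u (v i)) ⟨
        dot h (v i) * dot h′ (v i) ∎) (small ε 0<ε ≤-refl i (0<square hv≢0))
      nonzero′ : ∀ i → v (f i) ≢ origin → dot h′ (v (f i)) ≢ 0#
      nonzero′ zero u≢0 = <⇒≢ (<-respects refl (begin
        ε * dot u u  ≡⟨ +-identityˡ _ ⟨
        0# + ε * dot u u  ≡⟨ cong (_+ ε * dot u u) hv≡0 ⟨
        dot h u + ε * dot u u  ≡⟨ dot-⊕∙ˡ h ε u u ⟨
        dot h′ u  ∎) (*-pos 0<ε (dot-self-pos u≢0))) ∘ sym
      nonzero′ (suc i) v≢0 = positive-factorʳ (same′ (f (suc i)) (nonzero i v≢0))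
      same″ : SameSign h₀ h′
      same″ i h₀v≢0 = *-cancelˡ-< (0<square hv≢0) (<-respects (sym (zeroʳ _))
        (solve 3 (λ x y z → (x :* y) :* (y :* z) := (y :* y) :* (x :* z)) refl (dot h₀ (v i)) (dot h (v i)) (dot h′ (v i)))
        (*-pos (same i h₀v≢0) (same′ i hv≢0)))
        where
        hv≢0 : dot h (v i) ≢ 0#
        hv≢0 = positive-factorʳ (same i h₀v≢0)
  ... | h , nonzero , same = h , nonzero , λ i 0<h₀v →
    *-cancelˡ-< 0<h₀v (<-respects (sym (zeroʳ _)) refl (same i (<⇒≢ 0<h₀v ∘ sym)))

  -- The simplex ratio test: t = s j / r j for a j maximizing r j / s j.
  ratio-test : ∀ {r s : Fin n → Carrier} → (∀ i → 0# ≤ s i) → (∀ i → s i ≡ 0# → r i ≤ 0#) → ∃[ i ] 0# < r i →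
    ∃[ t ] 0# < t × (∀ i → t * r i ≤ s i) × ∃[ j ] 0# < r j × t * r j ≡ s j
  ratio-test {n = n} {r} {s} 0≤s s≡0⇒r≤0 (i , 0<rᵢ) with argmax {P = λ _ → ⊤} (λ _ → yes tt) (λ i → r i * s i ⁻¹) (i , tt)
  ... | j , _ , max = t , *-pos 0<sⱼ (⁻¹-pos 0<rⱼ) , bound , j , 0<rⱼ , (begin
      s j * r j ⁻¹ * r j  ≡⟨ solve 3 (λ s r′ r → s :* r′ :* r := s :* (r :* r′)) refl (s j) (r j ⁻¹) (r j) ⟩
      s j * (r j * r j ⁻¹)  ≡⟨ cong (s j *_) (⁻¹-inverseʳ (<⇒≢ 0<rⱼ ∘ sym)) ⟩
      s j * 1#  ≡⟨ *-identityʳ _ ⟩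
      s j  ∎)
    where
    t = s j * r j ⁻¹
    0<s : ∀ {i} → s i ≢ 0# → 0# < s i
    0<s s≢0 = ≤∧≢⇒< (0≤s _) (s≢0 ∘ sym)
    0<ratio : 0# < r j * s j ⁻¹
    0<ratio = <-≤-trans (*-pos 0<rᵢ (⁻¹-pos (0<s λ sᵢ≡0 → ≤⇒≯ (s≡0⇒r≤0 i sᵢ≡0) 0<rᵢ))) (max i tt)
    -- If `s j` were 0, the default value of `0# ⁻¹` would make the maximal ratio 0, but it is
    -- positive.
    sⱼ≢0 : s j ≢ 0#
    sⱼ≢0 eq = <-irrefl (sym (trans (cong (r j *_) (trans (cong _⁻¹ eq) 0⁻¹≡0)) (zeroʳ _))) 0<ratio
    0<sⱼ = 0<s sⱼ≢0
    r/s*s : ∀ {i} → s i ≢ 0# → s i * (r i * s i ⁻¹) ≡ r i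
    r/s*s {i} s≢0 = begin
      s i * (r i * s i ⁻¹)  ≡⟨ solve 3 (λ s r s′ → s :* (r :* s′) := r :* (s :* s′)) refl (s i) (r i) (s i ⁻¹) ⟩
      r i * (s i * s i ⁻¹)  ≡⟨ cong (r i *_) (⁻¹-inverseʳ s≢0) ⟩
      r i * 1#  ≡⟨ *-identityʳ _ ⟩
      r i  ∎
    0<rⱼ : 0# < r j
    0<rⱼ = <-respects refl (r/s*s sⱼ≢0) (*-pos 0<sⱼ 0<ratio)
    bound : ∀ i → t * r i ≤ s i
    bound i with s i ≟ 0#
    ... | yes sᵢ≡0 = 0≤-⇒≤ (≤-respects refl (trans (solve 2 (λ t r → t :* :- r := con (ℤ.+ 0) :- t :* r) refl t (r i)) (cong (λ z → z - t * r i) (sym sᵢ≡0)))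
      (*-nonneg (<⇒≤ (*-pos 0<sⱼ (⁻¹-pos 0<rⱼ))) (≤-respects refl (+-identityˡ _) (≤⇒0≤- (s≡0⇒r≤0 i sᵢ≡0)))))
    ... | no  sᵢ≢0 = *-cancelˡ-≤ 0<rⱼ (≤-respects
      (begin
        (s i * s j) * (r i * s i ⁻¹)  ≡⟨ solve 4 (λ s t r s′ → (s :* t) :* (r :* s′) := t :* (s :* (r :* s′))) refl (s i) (s j) (r i) (s i ⁻¹) ⟩
        s j * (s i * (r i * s i ⁻¹))  ≡⟨ cong (s j *_) (r/s*s sᵢ≢0) ⟩
        s j * r i  ≡⟨ cong (_* r i) (trans (sym (*-identityˡ _)) (trans (cong (_* s j) (sym (⁻¹-inverseʳ (<⇒≢ 0<rⱼ ∘ sym)))) (solve 3 (λ r r′ s → r :* r′ :* s := r :* (s :* r′)) refl (r j) (r j ⁻¹) (s j)))) ⟩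
        r j * t * r i  ≡⟨ *-assoc _ _ _ ⟩
        r j * (t * r i)  ∎)
      (begin
        (s i * s j) * (r j * s j ⁻¹)  ≡⟨ *-assoc _ _ _ ⟩
        s i * (s j * (r j * s j ⁻¹))  ≡⟨ cong (s i *_) (r/s*s sⱼ≢0) ⟩
        s i * r j  ≡⟨ *-comm _ _ ⟩
        r j * s i  ∎)
      (*-monoˡ-≤ (*-nonneg (0≤s i) (0≤s j)) (max i tt)))

  weighted-term : ∀ {w g c} → 0# ≤ w → w ≡ 0# ⊎ g ≤ c → w * g ≤ w * c
  weighted-term _   (inj₁ refl) = ≤-reflexive (trans (zeroˡ _) (sym (zeroˡ _)))
  weighted-term 0≤w (inj₂ g≤c)  = *-monoˡ-≤ 0≤w g≤c

  weighted-≤ : ∀ {w g : Fin n → Carrier} {c} → (∀ i → 0# ≤ w i) → sum w ≡ 1# →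
    (∀ i → w i ≡ 0# ⊎ g i ≤ c) → sum (λ i → w i * g i) ≤ c
  weighted-≤ {w = w} {g} {c} 0≤w Σw≡1 g≤c = ≤-respects refl
    (trans (sym (*-distribʳ-sum c w)) (trans (cong (_* c) Σw≡1) (*-identityˡ c)))
    (sum-mono-≤ λ i → weighted-term (0≤w i) (g≤c i))

  -- An average that reaches the upper bound of its terms reaches it in every term of positive
  -- weight. This is how a functional maximal at a convex combination is seen to be maximal at the
  -- points that contribute.
  weighted-≡ : ∀ {w g : Fin n → Carrier} {c} → (∀ i → 0# ≤ w i) → sum w ≡ 1# →
    (∀ i → w i ≡ 0# ⊎ g i ≤ c) → sum (λ i → w i * g i) ≡ c → ∀ i → w i ≡ 0# ⊎ g i ≡ c
  weighted-≡ {w = w} {g} {c} 0≤w Σw≡1 g≤c Σwg≡c i with w i ≟ 0#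
  ... | yes w≡0 = inj₁ w≡0
  ... | no  w≢0 = inj₂ (begin
    g i  ≡⟨ solve 2 (λ g c → g := g :- c :+ c) refl (g i) c ⟩
    g i - c + c  ≡⟨ cong (_+ c) (*-zero-or (trans (solve 3 (λ w g c → w :* (g :- c) := w :* g :- w :* c) refl (w i) (g i) c)
                               (trans (cong (λ z → z - w i * c) (termwise i)) (-‿inverseʳ _))) w≢0) ⟩
    0# + c  ≡⟨ +-identityˡ c ⟩
    c  ∎)
    where
    termwise : ∀ i → w i * g i ≡ w i * c
    termwise = sum-mono-≡ (λ i → weighted-term (0≤w i) (g≤c i)) (trans Σwg≡c (sym
      (trans (sym (*-distribʳ-sum c w)) (trans (cong (_* c) Σw≡1) (*-identityˡ c)))))

  spanning⇒orthogonal≡0 : ∀ {v : Fin n → Point d} → (∀ x → InSpan v x) → ∀ u → (∀ i → dot u (v i) ≡ 0#) → u ≡ origin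
  spanning⇒orthogonal≡0 {v = v} spans u u⊥v = dot-self-≡0 u (begin
    dot u u  ≡⟨ cong (dot u) (proj₂ (spans u)) ⟨
    dot u (lincomb (proj₁ (spans u)) v)  ≡⟨ dot-lincombʳ u _ v ⟩
    sum (λ i → proj₁ (spans u) i * dot u (v i))
      ≡⟨ sum-zero (λ i → trans (cong (proj₁ (spans u) i *_) (u⊥v i)) (zeroʳ _)) ⟩
    0#  ∎)

  lincomb-difference : ∀ {f g : Fin n → Carrier} (v : Fin n → Point d) → lincomb f v ≡ lincomb g v →
    lincomb (λ i → f i - g i) v ≡ origin
  lincomb-difference {f = f} {g} v eq = dot-ext λ z → begin
    dot (lincomb (λ i → f i - g i) v) z  ≡⟨ dot-lincombˡ _ v z ⟩
    sum (λ i → (f i - g i) * dot (v i) z)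
      ≡⟨ sum-cong-≗ (λ i → solve 3 (λ f g y → (f :- g) :* y := f :* y :+ :- con (ℤ.+ 1) :* (g :* y)) refl (f i) (g i) (dot (v i) z)) ⟩
    sum (λ i → f i * dot (v i) z + - 1# * (g i * dot (v i) z))
      ≡⟨ trans (∑-distrib-+ (λ i → f i * dot (v i) z) (λ i → - 1# * (g i * dot (v i) z)))
               (cong (sum (λ i → f i * dot (v i) z) +_) (sym (*-distribˡ-sum (- 1#) (λ i → g i * dot (v i) z)))) ⟩
    sum (λ i → f i * dot (v i) z) + - 1# * sum (λ i → g i * dot (v i) z)
      ≡⟨ cong₂ (λ p q → p + - 1# * q) (trans (sym (dot-lincombˡ f v z)) (cong (λ x → dot x z) eq)) (sym (dot-lincombˡ g v z)) ⟩
    dot (lincomb g v) z + - 1# * dot (lincomb g v) z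
      ≡⟨ solve 1 (λ x → x :+ :- con (ℤ.+ 1) :* x := con (ℤ.+ 0)) refl _ ⟩
    0#  ≡⟨ dot-originˡ z ⟨
    dot origin z  ∎

  dot-⊖ʳ : ∀ (u x y : Point d) → dot u (x ⊕ - 1# ∙ y) ≡ dot u x - dot u y
  dot-⊖ʳ u x y = trans (dot-⊕∙ʳ u x (- 1#) y) (solve 2 (λ p q → p :+ :- con (ℤ.+ 1) :* q := p :- q) refl _ _)

  dot-⊖ˡ : ∀ (x y u : Point d) → dot (x ⊕ - 1# ∙ y) u ≡ dot x u - dot y u
  dot-⊖ˡ x y u = trans (dot-⊕∙ˡ x (- 1#) y u) (solve 2 (λ p q → p :+ :- con (ℤ.+ 1) :* q := p :- q) refl _ _)

  x-y≡0⇒x≡y : ∀ {x y} → x - y ≡ 0# → x ≡ y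
  x-y≡0⇒x≡y {x} {y} eq = trans (solve 2 (λ x y → x := x :- y :+ y) refl x y) (trans (cong (_+ y) eq) (+-identityˡ y))

  ⊖≡origin⇒≡ : ∀ {x y : Point d} → x ⊕ - 1# ∙ y ≡ origin → x ≡ y
  ⊖≡origin⇒≡ {x = x} {y} eq = dot-ext λ z → x-y≡0⇒x≡y (trans (sym (dot-⊖ˡ x y z)) (trans (cong (λ w → dot w z) eq) (dot-originˡ z)))

  infix 8 ⊝_
  ⊝_ : Point d → Point d
  ⊝ x = origin ⊕ - 1# ∙ x

  dot-⊝ˡ : ∀ (x y : Point d) → dot (⊝ x) y ≡ - dot x y
  dot-⊝ˡ x y = trans (dot-⊖ˡ origin x y) (trans (cong (λ z → z - dot x y) (dot-originˡ y)) (+-identityˡ _))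

  dot-⊝ʳ : ∀ (x y : Point d) → dot x (⊝ y) ≡ - dot x y
  dot-⊝ʳ x y = trans (dot-comm x (⊝ y)) (trans (dot-⊝ˡ y x) (cong -_ (dot-comm y x)))

  -- Lattice vectors in the space over the field.

  fromℤ-sum : ∀ (f : Fin n → ℤ) → fromℤ (ℤ-LA.sum f) ≡ sum (fromℤ ∘ f)
  fromℤ-sum {ℕ.zero}  f = refl
  fromℤ-sum {ℕ.suc n} f = trans (fromℤ-+ (f zero) _) (cong (fromℤ (f zero) +_) (fromℤ-sum (f ∘ suc)))

  lookup-embed : ∀ (z : Vec ℤ d) j → lookup (embed z) j ≡ fromℤ (lookup z j)
  lookup-embed z j = Vec.lookup-map j fromℤ z

  embed-dot : ∀ (x y : Vec ℤ d) → dot (embed x) (embed y) ≡ fromℤ (ℤ-LA.dot x y)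
  embed-dot x y = sym (trans (fromℤ-sum λ j → lookup x j ℤ.* lookup y j) (sum-cong-≗ λ j →
    trans (fromℤ-* (lookup x j) (lookup y j)) (sym (cong₂ _*_ (lookup-embed x j) (lookup-embed y j)))))

  embed-lincomb : ∀ (c : Fin n → ℤ) (v : Fin n → Vec ℤ d) → embed (ℤ-LA.lincomb c v) ≡ lincomb (fromℤ ∘ c) (embed ∘ v)
  embed-lincomb c v = point-ext λ j → begin
    lookup (embed (ℤ-LA.lincomb c v)) j  ≡⟨ lookup-embed (ℤ-LA.lincomb c v) j ⟩
    fromℤ (lookup (ℤ-LA.lincomb c v) j)  ≡⟨ cong fromℤ (Vec.lookup∘tabulate _ j) ⟩
    fromℤ (ℤ-LA.sum λ i → c i ℤ.* lookup (v i) j)  ≡⟨ fromℤ-sum (λ i → c i ℤ.* lookup (v i) j) ⟩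
    sum (λ i → fromℤ (c i ℤ.* lookup (v i) j))
      ≡⟨ sum-cong-≗ (λ i → trans (fromℤ-* (c i) (lookup (v i) j)) (cong (fromℤ (c i) *_) (sym (lookup-embed (v i) j)))) ⟩
    sum (λ i → fromℤ (c i) * lookup (embed (v i)) j)  ≡⟨ lookup-lincomb (fromℤ ∘ c) (embed ∘ v) j ⟨
    lookup (lincomb (fromℤ ∘ c) (embed ∘ v)) j  ∎

  embed-injective : ∀ {x y : Vec ℤ d} → embed x ≡ embed y → x ≡ y
  embed-injective {x = []}    {[]}    eq = refl
  embed-injective {x = _ ∷ _} {_ ∷ _} eq = cong₂ _∷_ (fromℤ-injective (cong Vec.head eq)) (embed-injective (cong Vec.tail eq))

  embed-origin : embed (Vec.replicate d ℤ.0ℤ) ≡ origin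
  embed-origin {d = d} = Vec.map-replicate fromℤ ℤ.0ℤ d

  stdℤ : Fin d → Vec ℤ d
  stdℤ j = tabulate λ i → if ⌊ j Fin.≟ i ⌋ then ℤ.1ℤ else ℤ.0ℤ

  fromℤ-δ : ∀ (j i : Fin n) → fromℤ (if ⌊ j Fin.≟ i ⌋ then ℤ.1ℤ else ℤ.0ℤ) ≡ δ j i
  fromℤ-δ j i with j Fin.≟ i
  ... | yes _ = fromℤ-1
  ... | no  _ = refl

  embed-stdℤ : ∀ (j : Fin d) → embed (stdℤ j) ≡ std j
  embed-stdℤ j = point-ext λ i → begin
    lookup (embed (stdℤ j)) i  ≡⟨ lookup-embed (stdℤ j) i ⟩
    fromℤ (lookup (stdℤ j) i)  ≡⟨ cong fromℤ (Vec.lookup∘tabulate _ i) ⟩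
    fromℤ (if ⌊ j Fin.≟ i ⌋ then ℤ.1ℤ else ℤ.0ℤ)  ≡⟨ fromℤ-δ j i ⟩
    δ j i  ≡⟨ Vec.lookup∘tabulate (δ j) i ⟨
    lookup (std j) i  ∎

  -- Cubes and continuity of linear functionals.

  finite-lower-bound : ∀ {f : Fin n → Carrier} → (∀ i → 0# < f i) → ∃[ ε ] 0# < ε × (∀ i → ε ≤ f i)
  finite-lower-bound {n = ℕ.zero}  0<f = 1# , 0<1 , λ ()
  finite-lower-bound {n = ℕ.suc n} 0<f =
    let (ε , 0<ε , ε≤f)     = finite-lower-bound (0<f ∘ suc)
        (η , 0<η , η≤f₀ , η≤ε) = common-lower-bound (0<f zero) 0<ε
    in η , 0<η , λ { zero → η≤f₀ ; (suc i) → ≤-trans η≤ε (ε≤f i) }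

  cube-mono : ∀ {x y : Point d} {ε η} → ε ≤ η → Cube x ε y → Cube x η y
  cube-mono ε≤η close j = ≤-<-trans (neg-mono-≤ ε≤η) (proj₁ (close j)) , <-≤-trans (proj₂ (close j)) ε≤η

  -- The modulus uses |a| ≤ 1 + a².
  dot-continuous : ∀ (a x : Point d) {g} → 0# < g → ∃[ ε ] 0# < ε × (∀ y → Cube x ε y → dot a x - g < dot a y)
  dot-continuous {d = d} a x {g} 0<g = ε , *-pos 0<g (⁻¹-pos 0<N) , λ y close →
    ≤-<-trans (≤-reflexive (begin
      dot a x - g  ≡⟨ cong (λ z → dot a x - z) (trans (sym (*-identityʳ g)) (cong (g *_) (sym (⁻¹-inverseʳ (<⇒≢ 0<N ∘ sym))))) ⟩
      dot a x - g * (N * N ⁻¹)  ≡⟨ solve 4 (λ a g n n′ → a :- g :* (n :* n′) := a :- g :* n′ :* n) refl (dot a x) g N (N ⁻¹) ⟩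
      dot a x - ε * N  ∎))
    (<-≤-trans
      (0<-⇒< (<-respects refl (solve 3 (λ a e s → e := a :- e :* s :- (a :- e :* (con (ℤ.+ 1) :+ s))) refl (dot a x) ε (sum A)) (*-pos 0<g (⁻¹-pos 0<N))))
      (0≤-⇒≤ (≤-respects refl (begin
        sum (λ j → lookup a j * (lookup y j - lookup x j) + ε * A j)
          ≡⟨ sum-cong-≗ (λ j → solve 4 (λ a y x e → a :* (y :- x) :+ e := a :* y :+ (:- con (ℤ.+ 1) :* (a :* x) :+ e)) refl (lookup a j) (lookup y j) (lookup x j) (ε * A j)) ⟩
        sum (λ j → lookup a j * lookup y j + (- 1# * (lookup a j * lookup x j) + ε * A j))
          ≡⟨ ∑-distrib-+ (λ j → lookup a j * lookup y j) (λ j → - 1# * (lookup a j * lookup x j) + ε * A j) ⟩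
        dot a y + sum (λ j → - 1# * (lookup a j * lookup x j) + ε * A j)
          ≡⟨ cong (dot a y +_) (∑-distrib-+ (λ j → - 1# * (lookup a j * lookup x j)) (λ j → ε * A j)) ⟩
        dot a y + (sum (λ j → - 1# * (lookup a j * lookup x j)) + sum (λ j → ε * A j))
          ≡⟨ cong (dot a y +_) (cong₂ _+_ (*-distribˡ-sum (- 1#) (λ j → lookup a j * lookup x j)) (*-distribˡ-sum ε A)) ⟨
        dot a y + (- 1# * dot a x + ε * sum A)
          ≡⟨ solve 3 (λ y x e → y :+ (:- con (ℤ.+ 1) :* x :+ e) := y :- (x :- e)) refl (dot a y) (dot a x) (ε * sum A) ⟩
        dot a y - (dot a x - ε * sum A)  ∎)
        (sum-nonneg λ j → term (lookup a j) (lookup y j - lookup x j) (close j)))))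
    where
    A : Fin d → Carrier
    A j = 1# + lookup a j * lookup a j
    N : Carrier
    N = 1# + sum A
    0≤A : ∀ j → 0# ≤ A j
    0≤A j = ≤-respects (+-identityˡ 0#) refl (+-mono-≤ (<⇒≤ 0<1) (0≤square (lookup a j)))
    0<N : 0# < N
    0<N = <-respects (+-identityˡ 0#) refl (+-mono-<-≤ 0<1 (sum-nonneg 0≤A))
    ε : Carrier
    ε = g * N ⁻¹
    -- 4 (ε (1 + a²) + a r) = (ε + r) (a + 1)² + (ε − r) (a − 1)² + 2 ε (1 + a²).
    term : ∀ a r → (- ε) < r × r < ε → 0# ≤ a * r + ε * (1# + a * a)
    term a r (-ε<r , r<ε) = *-cancelˡ-≤ (fromℤ-pos 3) (≤-respects (sym (zeroʳ _))
      (solve 3 (λ a r ε → (r :- :- ε) :* ((a :+ con (ℤ.+ 1)) :* (a :+ con (ℤ.+ 1)))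
                   :+ (ε :- r) :* ((a :- con (ℤ.+ 1)) :* (a :- con (ℤ.+ 1)))
                   :+ con (ℤ.+ 2) :* (ε :* (con (ℤ.+ 1) :+ a :* a))
                   := con (ℤ.+ 4) :* (a :* r :+ ε :* (con (ℤ.+ 1) :+ a :* a))) refl a r ε)
      (≤-respects (trans (+-identityʳ _) (+-identityˡ 0#)) refl (+-mono-≤ (+-mono-≤
        (*-nonneg (<⇒≤ (<⇒0<- -ε<r)) (0≤square (a + 1#)))
        (*-nonneg (<⇒≤ (<⇒0<- r<ε)) (0≤square (a - 1#))))
        (*-nonneg (fromℤ-nonneg 2) (*-nonneg (<⇒≤ (*-pos 0<g (⁻¹-pos 0<N))) (≤-respects (+-identityˡ 0#) refl (+-mono-≤ (<⇒≤ 0<1) (0≤square a))))))))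

  total : (Fin n → ℕ) → ℕ
  total {n = ℕ.zero}  c = 0
  total {n = ℕ.suc n} c = c zero ℕ.+ total (c ∘ suc)

  fromℤ-total : ∀ (c : Fin n → ℕ) → fromℤ (ℤ.+ total c) ≡ sum (λ i → fromℤ (ℤ.+ c i))
  fromℤ-total {n = ℕ.zero}  c = refl
  fromℤ-total {n = ℕ.suc n} c = trans (fromℤ-+ (ℤ.+ c zero) (ℤ.+ total (c ∘ suc))) (cong (fromℤ (ℤ.+ c zero) +_) (fromℤ-total (c ∘ suc)))

-- Subsets of a finite set.

module Subsets where
  private variable
    n : ℕ

  infix 4 _∋_ _∋?_
  _∋_ : Subset n → Fin n → Set
  S ∋ i = lookup S i ≡ true

  _∋?_ : ∀ (S : Subset n) i → Dec (S ∋ i)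
  S ∋? i = lookup S i Bool.≟ true

  subset-ext : ∀ {S T : Subset n} → (∀ i → S ∋ i → T ∋ i) → (∀ i → T ∋ i → S ∋ i) → S ≡ T
  subset-ext {S = []}        {[]}        S⊆T T⊆S = refl
  subset-ext {S = false ∷ S} {false ∷ T} S⊆T T⊆S = cong (false ∷_) (subset-ext (S⊆T ∘ suc) (T⊆S ∘ suc))
  subset-ext {S = true ∷ S}  {true ∷ T}  S⊆T T⊆S = cong (true ∷_) (subset-ext (S⊆T ∘ suc) (T⊆S ∘ suc))
  subset-ext {S = true ∷ S}  {false ∷ T} S⊆T T⊆S = case S⊆T zero refl of λ ()
  subset-ext {S = false ∷ S} {true ∷ T}  S⊆T T⊆S = case T⊆S zero refl of λ ()

  comprehension : ∀ {p} {P : Fin n → Set p} → (∀ i → Dec (P i)) → Subset n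
  comprehension P? = tabulate λ i → ⌊ P? i ⌋

  module _ {p} {P : Fin n → Set p} (P? : ∀ i → Dec (P i)) where
    ∋-comprehension⁺ : ∀ {i} → P i → comprehension P? ∋ i
    ∋-comprehension⁺ {i} pᵢ = trans (Vec.lookup∘tabulate (λ i → ⌊ P? i ⌋) i) (true-if (P? i) pᵢ)
      where
      true-if : ∀ {A : Set p} (A? : Dec A) → A → ⌊ A? ⌋ ≡ true
      true-if (yes _) _ = refl
      true-if (no ¬a) a = contradiction a ¬a

    ∋-comprehension⁻ : ∀ {i} → comprehension P? ∋ i → P i
    ∋-comprehension⁻ {i} S∋i with P? i | trans (sym (Vec.lookup∘tabulate (λ i → ⌊ P? i ⌋) i)) S∋i
    ... | yes pᵢ | _ = pᵢ

  ∣∣-split : ∀ (F P N : Subset n) →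
    (∀ i → F ∋ i → (P ∋ i × ¬ N ∋ i) ⊎ (N ∋ i × ¬ P ∋ i)) →
    (∀ i → ¬ F ∋ i → ¬ P ∋ i × ¬ N ∋ i) → ∣ P ∣ ℕ.+ ∣ N ∣ ≡ ∣ F ∣
  ∣∣-split [] [] [] _ _ = refl
  ∣∣-split (true ∷ F) (true ∷ P) (false ∷ N) inside outside = cong ℕ.suc (∣∣-split F P N (inside ∘ suc) (outside ∘ suc))
  ∣∣-split (true ∷ F) (false ∷ P) (true ∷ N) inside outside =
    trans (ℕ.+-suc ∣ P ∣ ∣ N ∣) (cong ℕ.suc (∣∣-split F P N (inside ∘ suc) (outside ∘ suc)))
  ∣∣-split (false ∷ F) (false ∷ P) (false ∷ N) inside outside = ∣∣-split F P N (inside ∘ suc) (outside ∘ suc)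
  ∣∣-split (true ∷ F) (true ∷ P) (true ∷ N) inside outside with inside zero refl
  ... | inj₁ (_ , ¬n) = contradiction refl ¬n
  ... | inj₂ (_ , ¬p) = contradiction refl ¬p
  ∣∣-split (true ∷ F) (false ∷ P) (false ∷ N) inside outside with inside zero refl
  ... | inj₁ (() , _)
  ... | inj₂ (() , _)
  ∣∣-split (false ∷ F) (true ∷ P) (_ ∷ N) inside outside = contradiction refl (proj₁ (outside zero λ ()))
  ∣∣-split (false ∷ F) (false ∷ P) (true ∷ N) inside outside = contradiction refl (proj₂ (outside zero λ ()))

  element : ∀ (S : Subset n) → Fin ∣ S ∣ → Fin n
  element (true ∷ S)  zero    = zero
  element (true ∷ S)  (suc i) = suc (element S i)
  element (false ∷ S) i       = suc (element S i)

  ∋-element : ∀ (S : Subset n) i → S ∋ element S i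
  ∋-element (true ∷ S)  zero    = refl
  ∋-element (true ∷ S)  (suc i) = ∋-element S i
  ∋-element (false ∷ S) i       = ∋-element S i

  element-injective : ∀ (S : Subset n) {i j} → element S i ≡ element S j → i ≡ j
  element-injective (true ∷ S)  {zero}  {zero}  _  = refl
  element-injective (true ∷ S)  {suc i} {suc j} eq = cong suc (element-injective S (Fin.suc-injective eq))
  element-injective (false ∷ S)                 eq = element-injective S (Fin.suc-injective eq)

  element-surjective : ∀ (S : Subset n) {k} → S ∋ k → ∃[ i ] element S i ≡ k
  element-surjective (true ∷ S)  {zero}  S∋k = zero , refl
  element-surjective (true ∷ S)  {suc k} S∋k with element-surjective S S∋k
  ... | i , refl = suc i , refl
  element-surjective (false ∷ S) {suc k} S∋k with element-surjective S S∋k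
  ... | i , refl = i , refl

  ∣∣-unique : ∀ {m} (S : Subset n) (σ : Fin m → Fin n) → (∀ {i j} → σ i ≡ σ j → i ≡ j) →
    (∀ i → S ∋ σ i) → (∀ k → S ∋ k → ∃[ i ] σ i ≡ k) → ∣ S ∣ ≡ m
  ∣∣-unique S σ σ-injective S∋σ σ-surjective = ℕ.≤-antisym
    (Fin.injective⇒≤ {f = λ i → proj₁ (preimage i)} λ {i} {j} eq →
      element-injective S (trans (sym (proj₂ (preimage i))) (trans (cong σ eq) (proj₂ (preimage j)))))
    (Fin.injective⇒≤ {f = λ i → proj₁ (element-surjective S (S∋σ i))} λ {i} {j} eq →
      σ-injective (trans (sym (proj₂ (element-surjective S (S∋σ i)))) (trans (cong (element S) eq) (proj₂ (element-surjective S (S∋σ j))))))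
    where
    preimage : ∀ i → ∃[ j ] σ j ≡ element S i
    preimage i = σ-surjective (element S i) (∋-element S i)

  subsets : ∀ n → List (Subset n)
  subsets ℕ.zero    = [] ∷ []
  subsets (ℕ.suc n) = List.map (false ∷_) (subsets n) ++ List.map (true ∷_) (subsets n)

  ∈-subsets : ∀ (S : Subset n) → S ∈ subsets n
  ∈-subsets []          = here refl
  ∈-subsets (false ∷ S) = ∈-++⁺ˡ (∈-map⁺ (false ∷_) (∈-subsets S))
  ∈-subsets (true ∷ S)  = ∈-++⁺ʳ (List.map (false ∷_) (subsets _)) (∈-map⁺ (true ∷_) (∈-subsets S))

  subsets-unique : ∀ n → Unique (subsets n)
  subsets-unique ℕ.zero    = [] ∷ []
  subsets-unique (ℕ.suc n) = Unique.++⁺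
    (Unique.map⁺ (cong Vec.tail) (subsets-unique n)) (Unique.map⁺ (cong Vec.tail) (subsets-unique n))
    λ (∈₁ , ∈₂) → case (∈-map⁻ (false ∷_) ∈₁ , ∈-map⁻ (true ∷_) ∈₂) of λ { ((_ , _ , refl) , (_ , _ , ())) }

-- Counting, and sums of binomial coefficients.

module Counting where
  open Subsets
  open import Data.Nat.Base using (_+_; _*_; _≤_; suc; zero; z≤n; s≤s)
  open import Data.Nat.Combinatorics using (_C_; nCk+nC[k+1]≡[n+1]C[k+1])
  open ≡-Reasoning

  private variable
    a b p q : Level
    A : Set a
    B : Set b
    n : ℕ

  sumList : (A → ℕ) → List A → ℕ
  sumList f xs = List.foldr (λ x s → f x + s) 0 xs

  +-interchange : ∀ a b c d → (a + b) + (c + d) ≡ (a + c) + (b + d)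
  +-interchange = CommutativeSemigroup.interchange ℕ.+-commutativeSemigroup

  sumList-+ : ∀ (f g : A → ℕ) xs → sumList (λ x → f x + g x) xs ≡ sumList f xs + sumList g xs
  sumList-+ f g []       = refl
  sumList-+ f g (x ∷ xs) = trans (cong (f x + g x +_) (sumList-+ f g xs)) (+-interchange (f x) (g x) _ _)

  sumList-* : ∀ c (f : A → ℕ) xs → sumList (λ x → c * f x) xs ≡ c * sumList f xs
  sumList-* c f []       = sym (ℕ.*-zeroʳ c)
  sumList-* c f (x ∷ xs) = trans (cong (c * f x +_) (sumList-* c f xs)) (sym (ℕ.*-distribˡ-+ c (f x) _))

  sumList-cong : ∀ {f g : A → ℕ} xs → (∀ x → x ∈ xs → f x ≡ g x) → sumList f xs ≡ sumList g xs
  sumList-cong []       eq = refl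
  sumList-cong (x ∷ xs) eq = cong₂ _+_ (eq x (here refl)) (sumList-cong xs λ y → eq y ∘ there)

  count : {P : A → Set p} → (∀ x → Dec (P x)) → List A → ℕ
  count P? xs = length (filter P? xs)

  indicator : {P : Set p} → Dec P → ℕ
  indicator P? = if ⌊ P? ⌋ then 1 else 0

  module _ {P : A → Set p} (P? : ∀ x → Dec (P x)) where
    count-∷ : ∀ x xs → count P? (x ∷ xs) ≡ indicator (P? x) + count P? xs
    count-∷ x xs with P? x
    ... | yes _ = refl
    ... | no  _ = refl

    count-++ : ∀ xs ys → count P? (xs ++ ys) ≡ count P? xs + count P? ys
    count-++ xs ys = trans (cong length (List.filter-++ P? xs ys)) (List.length-++ (filter P? xs))

    count-none : ∀ xs → (∀ x → x ∈ xs → ¬ P x) → count P? xs ≡ 0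
    count-none []       _    = refl
    count-none (x ∷ xs) none with P? x
    ... | yes pₓ = contradiction pₓ (none x (here refl))
    ... | no  _  = count-none xs λ y → none y ∘ there

    count-one : ∀ {xs} → Unique xs → ∀ {x} → x ∈ xs → P x → (∀ {y} → y ∈ xs → P y → y ≡ x) → count P? xs ≡ 1
    count-one {y ∷ ys} (y∉ys ∷ u) x∈ pₓ only with P? y
    ... | yes p_y with refl ← only (here refl) p_y =
      cong suc (count-none ys λ z z∈ys p_z → All.lookup y∉ys z∈ys (sym (only (there z∈ys) p_z)))
    count-one {y ∷ ys} (y∉ys ∷ u) (here refl) pₓ only | no ¬p_y = contradiction pₓ ¬p_y
    count-one {y ∷ ys} (y∉ys ∷ u) (there x∈)  pₓ only | no _    = count-one u x∈ pₓ (only ∘ there)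

    count-map : ∀ (f : B → A) xs → count P? (List.map f xs) ≡ count (P? ∘ f) xs
    count-map f []       = refl
    count-map f (x ∷ xs) with P? (f x)
    ... | yes _ = cong suc (count-map f xs)
    ... | no  _ = count-map f xs

  indicator-cong : {P : Set p} {Q : Set q} (P? : Dec P) (Q? : Dec Q) → (P → Q) → (Q → P) → indicator P? ≡ indicator Q?
  indicator-cong (yes _) (yes _) _  _   = refl
  indicator-cong (no _)  (no _)  _  _   = refl
  indicator-cong (yes p) (no ¬q) to _   = contradiction (to p) ¬q
  indicator-cong (no ¬p) (yes q) _ from = contradiction (from q) ¬p

  count-cong : {P : A → Set p} {Q : A → Set q} (P? : ∀ x → Dec (P x)) (Q? : ∀ x → Dec (Q x)) → ∀ xs →
    (∀ x → P x → Q x) → (∀ x → Q x → P x) → count P? xs ≡ count Q? xs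
  count-cong P? Q? []       to from = refl
  count-cong P? Q? (x ∷ xs) to from = begin
    count P? (x ∷ xs)  ≡⟨ count-∷ P? x xs ⟩
    indicator (P? x) + count P? xs  ≡⟨ cong₂ _+_ (indicator-cong (P? x) (Q? x) (to x) (from x)) (count-cong P? Q? xs to from) ⟩
    indicator (Q? x) + count Q? xs  ≡⟨ count-∷ Q? x xs ⟨
    count Q? (x ∷ xs)  ∎

  count-⊎ : {P : A → Set p} {Q : A → Set q} (P? : ∀ x → Dec (P x)) (Q? : ∀ x → Dec (Q x)) (P⊎Q? : ∀ x → Dec (P x ⊎ Q x)) →
    (∀ x → P x → ¬ Q x) → ∀ xs → count P⊎Q? xs ≡ count P? xs + count Q? xs
  count-⊎ P? Q? P⊎Q? disjoint [] = refl
  count-⊎ P? Q? P⊎Q? disjoint (x ∷ xs) = begin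
    count P⊎Q? (x ∷ xs)  ≡⟨ count-∷ P⊎Q? x xs ⟩
    indicator (P⊎Q? x) + count P⊎Q? xs  ≡⟨ cong₂ _+_ (head (P? x) (Q? x) (P⊎Q? x) (disjoint x)) (count-⊎ P? Q? P⊎Q? disjoint xs) ⟩
    (indicator (P? x) + indicator (Q? x)) + (count P? xs + count Q? xs)  ≡⟨ +-interchange (indicator (P? x)) _ _ _ ⟩
    (indicator (P? x) + count P? xs) + (indicator (Q? x) + count Q? xs)  ≡⟨ cong₂ _+_ (count-∷ P? x xs) (count-∷ Q? x xs) ⟨
    count P? (x ∷ xs) + count Q? (x ∷ xs)  ∎
    where
    head : ∀ {p q} {P : Set p} {Q : Set q} (P? : Dec P) (Q? : Dec Q) (P⊎Q? : Dec (P ⊎ Q)) → (P → ¬ Q) →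
           indicator P⊎Q? ≡ indicator P? + indicator Q?
    head (yes p) (yes q) _       disj = contradiction q (disj p)
    head (yes p) (no _)  (yes _) _    = refl
    head (yes p) (no _)  (no ¬r) _    = contradiction (inj₁ p) ¬r
    head (no _)  (yes q) (yes _) _    = refl
    head (no _)  (yes q) (no ¬r) _    = contradiction (inj₂ q) ¬r
    head (no ¬p) (no ¬q) (yes r) _    = case r of λ { (inj₁ p) → contradiction p ¬p ; (inj₂ q) → contradiction q ¬q }
    head (no ¬p) (no ¬q) (no _)  _    = refl

  -- The hypotheses make `R` the graph of a map from the elements satisfying `P` to `ys`, and the
  -- sum runs over its fibres.
  double-count : ∀ {P : A → Set p} {R : A → B → Set q} (P? : ∀ x → Dec (P x)) (R? : ∀ x y → Dec (R x y))
    {ys : List B} → Unique ys →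
    (∀ x → P x → ∃[ y ] y ∈ ys × R x y) → (∀ x {y} → y ∈ ys → R x y → P x) →
    (∀ x {y y′} → y ∈ ys → y′ ∈ ys → R x y → R x y′ → y ≡ y′) →
    ∀ xs → count P? xs ≡ sumList (λ y → count (λ x → R? x y) xs) ys
  double-count P? R? {ys} unique total sound functional [] = sym (zeros ys)
    where
    zeros : ∀ ys → sumList (λ y → count (λ x → R? x y) []) ys ≡ 0
    zeros []       = refl
    zeros (_ ∷ ys) = zeros ys
  double-count P? R? {ys} unique total sound functional (x ∷ xs) = begin
    count P? (x ∷ xs)  ≡⟨ count-∷ P? x xs ⟩
    indicator (P? x) + count P? xs  ≡⟨ cong₂ _+_ (row (P? x)) (double-count P? R? unique total sound functional xs) ⟩
    count (R? x) ys + sumList (λ y → count (λ x → R? x y) xs) ys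
      ≡⟨ cong (_+ _) (count≡sum (R? x) ys) ⟩
    sumList (λ y → indicator (R? x y)) ys + sumList (λ y → count (λ x → R? x y) xs) ys
      ≡⟨ sumList-+ (λ y → indicator (R? x y)) (λ y → count (λ x → R? x y) xs) ys ⟨
    sumList (λ y → indicator (R? x y) + count (λ x → R? x y) xs) ys
      ≡⟨ sumList-cong ys (λ y _ → sym (count-∷ (λ x → R? x y) x xs)) ⟩
    sumList (λ y → count (λ x → R? x y) (x ∷ xs)) ys  ∎
    where
    count≡sum : ∀ {P : _ → Set q} (P? : ∀ y → Dec (P y)) ys → count P? ys ≡ sumList (λ y → indicator (P? y)) ys
    count≡sum P? []       = refl
    count≡sum P? (y ∷ ys) = trans (count-∷ P? y ys) (cong (indicator (P? y) +_) (count≡sum P? ys))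
    row : (Pₓ? : Dec _) → indicator Pₓ? ≡ count (R? x) ys
    row (yes pₓ) with total x pₓ
    ... | y , y∈ys , r = sym (count-one (R? x) unique y∈ys r λ y′∈ys r′ → functional x y′∈ys y∈ys r′ r)
    row (no ¬pₓ) = sym (count-none (R? x) ys λ y y∈ys r → ¬pₓ (sound x y∈ys r))

  cardinality-unique : ∀ {a ℓ} {S : Setoid a ℓ} {m n} → HasCardinality S m → HasCardinality S n → m ≡ n
  cardinality-unique {S = S} f g = ℕ.≤-antisym (bound f g) (bound g f)
    where
    bound : ∀ {m n} → HasCardinality S m → HasCardinality S n → m ≤ n
    bound f g = Fin.injective⇒≤ {f = λ i → g.from (f.to i)} λ {i} {j} eq →
      trans (sym (f.strictlyInverseʳ i)) (trans (f.from-cong (S.trans (S.sym (g.strictlyInverseˡ (f.to i)))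
        (S.trans (g.to-cong eq) (g.strictlyInverseˡ (f.to j))))) (f.strictlyInverseʳ j))
      where
      module f = Inverse f
      module g = Inverse g
      module S = Setoid S

  -- The round trip through `f` is required for every proof of membership, since the proof
  -- `∈-lookup` that `to` supplies need not be the one given by `g∈`.
  enumeration⇒cardinality : ∀ {a ℓ} (S : Setoid a ℓ) {A : Set b} {xs : List A} → Unique xs →
    let open Setoid S renaming (Carrier to |S|) in
    (f : ∀ x → x ∈ xs → |S|) (g : |S| → A) (g∈ : ∀ s → g s ∈ xs) →
    (∀ {s t} → s ≈ t → g s ≡ g t) → (∀ x x∈ → g (f x x∈) ≡ x) →
    (∀ s x∈ → f (g s) x∈ ≈ s) → HasCardinality S (length xs)
  enumeration⇒cardinality S {xs = xs} unique f g g∈ g-cong gf fg = record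
    { to        = to
    ; from      = from
    ; to-cong   = λ { refl → S.refl }
    ; from-cong = from-cong
    ; inverse   = (λ {s} eq → S.trans (S.reflexive (cong to eq)) (to-from s)) , λ {i} eq → trans (from-cong eq) (from-to i)
    }
    where
    module S = Setoid S
    to : Fin (length xs) → S.Carrier
    to i = f (List.lookup xs i) (∈-lookup i)
    from : S.Carrier → Fin (length xs)
    from s = index (g∈ s)
    index-unique : ∀ {xs : List _} → Unique xs → ∀ {x y} (x∈ : x ∈ xs) (y∈ : y ∈ xs) → x ≡ y → index x∈ ≡ index y∈
    index-unique _        (here _)     (here _)     _    = refl
    index-unique (∉ ∷ _)  (here refl)  (there y∈)   refl = contradiction refl (All.lookup ∉ y∈)
    index-unique (∉ ∷ _)  (there x∈)   (here refl)  refl = contradiction refl (All.lookup ∉ x∈)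
    index-unique (_ ∷ u)  (there x∈)   (there y∈)   eq   = cong suc (index-unique u x∈ y∈ eq)
    from-cong : ∀ {s t} → s S.≈ t → from s ≡ from t
    from-cong s≈t = index-unique unique (g∈ _) (g∈ _) (g-cong s≈t)
    lookup-from : ∀ s → List.lookup xs (from s) ≡ g s
    lookup-from s = sym (lookup-index (g∈ s))
    f-cong : ∀ {x y} → x ≡ y → ∀ s → y ≡ g s → (x∈ : x ∈ xs) → f x x∈ S.≈ s
    f-cong refl s refl x∈ = fg s x∈
    to-from : ∀ s → to (from s) S.≈ s
    to-from s = f-cong (lookup-from s) s refl _
    index-∈-lookup : ∀ (xs : List _) i → index (∈-lookup {xs = xs} i) ≡ i
    index-∈-lookup (x ∷ xs) zero    = refl
    index-∈-lookup (x ∷ xs) (suc i) = cong suc (index-∈-lookup xs i)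
    from-to : ∀ i → from (to i) ≡ i
    from-to i = trans (index-unique unique (g∈ (to i)) (∈-lookup i) (gf _ (∈-lookup i))) (index-∈-lookup xs i)

  -- The admissible bits of S at an element, for F ─ Q ⊆ S ⊆ F.
  Between : Bool → Bool → Bool → Set
  Between false _     s = s ≡ false
  Between true  false s = s ≡ true
  Between true  true  s = ⊤

  between? : ∀ f q s → Dec (Between f q s)
  between? false _     s = s Bool.≟ false
  between? true  false s = s Bool.≟ true
  between? true  true  s = yes tt

  between⁺ : ∀ f q s → (s ≡ true → f ≡ true) → (f ≡ true → s ≡ true ⊎ q ≡ true) → Between f q s
  between⁺ false _     false _   _  = refl
  between⁺ false _     true  s⇒f _  = sym (s⇒f refl)
  between⁺ true  false _     _   f⇒ = Sum.[ id , (λ ()) ]′ (f⇒ refl)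
  between⁺ true  true  _     _   _  = tt

  between⇒⊆ : ∀ f q s → Between f q s → s ≡ true → f ≡ true
  between⇒⊆ true  _ _ _   _   = refl
  between⇒⊆ false _ _ s≡0 s≡1 = trans (sym s≡0) s≡1

  IntervalOfCorank : ∀ (F Q : Subset n) → ℕ → Subset n → Set
  IntervalOfCorank F Q j S = (∀ i → Between (lookup F i) (lookup Q i) (lookup S i)) × ∣ S ∣ + j ≡ ∣ F ∣

  intervalOfCorank? : ∀ (F Q : Subset n) j S → Dec (IntervalOfCorank F Q j S)
  intervalOfCorank? F Q j S = Fin.all? (λ i → between? (lookup F i) (lookup Q i) (lookup S i)) ×-dec (∣ S ∣ + j ℕ.≟ ∣ F ∣)

  between⇒∣∣≤ : ∀ (F Q S : Subset n) → (∀ i → Between (lookup F i) (lookup Q i) (lookup S i)) → ∣ S ∣ ≤ ∣ F ∣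
  between⇒∣∣≤ [] [] [] _ = z≤n
  between⇒∣∣≤ (true ∷ F)  (_ ∷ Q) (true ∷ S)  b = s≤s (between⇒∣∣≤ F Q S (b ∘ suc))
  between⇒∣∣≤ (true ∷ F)  (_ ∷ Q) (false ∷ S) b = ℕ.m≤n⇒m≤1+n (between⇒∣∣≤ F Q S (b ∘ suc))
  between⇒∣∣≤ (false ∷ F) (_ ∷ Q) (false ∷ S) b = between⇒∣∣≤ F Q S (b ∘ suc)
  between⇒∣∣≤ (false ∷ F) (_ ∷ Q) (true ∷ S)  b = case b zero of λ ()

  -- Such a set arises from `F` by removing `j` elements of `Q`. The induction over the elements is
  -- Pascal's rule at an element of `Q`; at all others the bit is forced.
  count-interval : ∀ (F Q : Subset n) → (∀ i → Q ∋ i → F ∋ i) → ∀ j →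
    count (intervalOfCorank? F Q j) (subsets n) ≡ ∣ Q ∣ C j
  count-interval [] [] _ zero    = refl
  count-interval [] [] _ (suc j) = refl
  count-interval {suc n} (f ∷ F) (q ∷ Q) Q⊆F j = trans
    (trans (count-++ R? (List.map (false ∷_) (subsets n)) _)
           (cong₂ _+_ (count-map R? (false ∷_) (subsets n)) (count-map R? (true ∷_) (subsets n))))
    (bits f q j (Q⊆F zero))
    where
    R? = intervalOfCorank? (f ∷ F) (q ∷ Q) j
    ih : ∀ j → count (intervalOfCorank? F Q j) (subsets n) ≡ ∣ Q ∣ C j
    ih = count-interval F Q (Q⊆F ∘ suc)
    extend : ∀ {f q s} {S : Subset n} → Between f q s → (∀ i → Between (lookup F i) (lookup Q i) (lookup S i)) →
             ∀ i → Between (lookup (f ∷ F) i) (lookup (q ∷ Q) i) (lookup (s ∷ S) i)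
    extend b bs zero    = b
    extend b bs (suc i) = bs i
    bits : ∀ f q j → (q ≡ true → f ≡ true) →
      count (intervalOfCorank? (f ∷ F) (q ∷ Q) j ∘ (false ∷_)) (subsets n) + count (intervalOfCorank? (f ∷ F) (q ∷ Q) j ∘ (true ∷_)) (subsets n)
      ≡ ∣ q ∷ Q ∣ C j
    bits false true  j q⇒f = case q⇒f refl of λ ()
    bits false false j q⇒f = trans (cong₂ _+_
      (trans (count-cong _ (intervalOfCorank? F Q j) (subsets n) (λ S (b , eq) → b ∘ suc , eq) (λ S (b , eq) → extend {f = false} {q = false} refl b , eq)) (ih j))
      (count-none _ (subsets n) λ S _ (b , _) → case b zero of λ ()))
      (ℕ.+-identityʳ _)
    bits true false j q⇒f = cong₂ _+_
      (count-none _ (subsets n) λ S _ (b , _) → case b zero of λ ())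
      (trans (count-cong _ (intervalOfCorank? F Q j) (subsets n) (λ S (b , eq) → b ∘ suc , ℕ.suc-injective eq) (λ S (b , eq) → extend {f = true} {q = false} refl b , cong suc eq)) (ih j))
    -- At corank 0 nothing may be removed, so the branch without this element is empty.
    bits true true zero q⇒f = cong₂ _+_
      (count-none _ (subsets n) λ S _ (b , eq) →
        ℕ.<-irrefl (trans (sym (ℕ.+-identityʳ ∣ S ∣)) eq) (s≤s (between⇒∣∣≤ F Q S (b ∘ suc))))
      (trans (count-cong _ (intervalOfCorank? F Q 0) (subsets n) (λ S (b , eq) → b ∘ suc , ℕ.suc-injective eq) (λ S (b , eq) → extend {f = true} {q = true} tt b , cong suc eq)) (ih 0))
    bits true true (suc j) q⇒f = trans (cong₂ _+_
      (trans (count-cong _ (intervalOfCorank? F Q j) (subsets n) (λ S (b , eq) → b ∘ suc , ℕ.suc-injective (trans (sym (ℕ.+-suc ∣ S ∣ j)) eq)) (λ S (b , eq) → extend {f = true} {q = true} tt b , trans (ℕ.+-suc ∣ S ∣ j) (cong suc eq))) (ih j))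
      (trans (count-cong _ (intervalOfCorank? F Q (suc j)) (subsets n) (λ S (b , eq) → b ∘ suc , ℕ.suc-injective eq) (λ S (b , eq) → extend {f = true} {q = true} tt b , cong suc eq)) (ih (suc j))))
      (nCk+nC[k+1]≡[n+1]C[k+1] ∣ Q ∣ j)

  -- The coefficients are natural numbers; a relation with signs is stated as an equation of two
  -- combinations, its negative terms moved across.
  combination : ∀ {m} → Vec ℕ m → (ℕ → ℕ) → ℕ
  combination []       g = 0
  combination (c ∷ cs) g = c * g 0 + combination cs (g ∘ suc)

  combination-cong : ∀ {m} (cs : Vec ℕ m) {g h : ℕ → ℕ} → g ≗ h → combination cs g ≡ combination cs h
  combination-cong []       eq = refl
  combination-cong (c ∷ cs) eq = cong₂ _+_ (cong (c *_) (eq 0)) (combination-cong cs (eq ∘ suc))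

  sumList-combination : ∀ {m} (cs : Vec ℕ m) (g : A → ℕ → ℕ) xs →
    sumList (λ x → combination cs (g x)) xs ≡ combination cs (λ j → sumList (λ x → g x j) xs)
  sumList-combination []       g xs = zeros xs
    where
    zeros : ∀ xs → sumList (λ _ → 0) xs ≡ 0
    zeros []       = refl
    zeros (_ ∷ xs) = zeros xs
  sumList-combination (c ∷ cs) g xs = trans (sumList-+ (λ x → c * g x 0) (λ x → combination cs (g x ∘ suc)) xs)
    (cong₂ _+_ (sumList-* c (λ x → g x 0) xs) (sumList-combination cs (λ x → g x ∘ suc) xs))

  -- The two expressions of M as a sum, over p x and over q x = d − p x, are averaged.
  linear-relation : ∀ {m d} (as bs : Vec ℕ m) (M : ℕ → ℕ) (p q : A → ℕ) xs →
    (∀ j → M j ≡ sumList (λ x → p x C j) xs) → (∀ j → M j ≡ sumList (λ x → q x C j) xs) →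
    (∀ x → x ∈ xs → p x + q x ≡ d) →
    (∀ k l → k + l ≡ d → combination as (k C_) + combination as (l C_) ≡ combination bs (k C_) + combination bs (l C_)) →
    combination as M ≡ combination bs M
  linear-relation as bs M p q xs M≡p M≡q p+q≡d pointwise =
    ℕ.*-cancelˡ-≡ (combination as M) (combination bs M) 2 (begin
      2 * combination as M  ≡⟨ doubled as ⟩
      sumList (λ x → combination as (p x C_) + combination as (q x C_)) xs
        ≡⟨ sumList-cong xs (λ x x∈ → pointwise (p x) (q x) (p+q≡d x x∈)) ⟩
      sumList (λ x → combination bs (p x C_) + combination bs (q x C_)) xs
        ≡⟨ doubled bs ⟨
      2 * combination bs M  ∎)
    where
    doubled : ∀ {m} (cs : Vec ℕ m) → 2 * combination cs M ≡ sumList (λ x → combination cs (p x C_) + combination cs (q x C_)) xs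
    doubled cs = begin
      combination cs M + (combination cs M + 0)  ≡⟨ cong (combination cs M +_) (ℕ.+-identityʳ _) ⟩
      combination cs M + combination cs M  ≡⟨ cong₂ _+_ (combination-cong cs M≡p) (combination-cong cs M≡q) ⟩
      combination cs (λ j → sumList (λ x → p x C j) xs) + combination cs (λ j → sumList (λ x → q x C j) xs)
        ≡⟨ cong₂ _+_ (sumList-combination cs (λ x → p x C_) xs) (sumList-combination cs (λ x → q x C_) xs) ⟨
      sumList (λ x → combination cs (p x C_)) xs + sumList (λ x → combination cs (q x C_)) xs
        ≡⟨ sumList-+ (λ x → combination cs (p x C_)) (λ x → combination cs (q x C_)) xs ⟨
      sumList (λ x → combination cs (p x C_) + combination cs (q x C_)) xs ∎

-- Finding the facets by their normals.

module FacetNormals {ℓ} (K : OrderedField ℓ) {d : ℕ} (P : Geometry.Region K d)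
                    (smooth : Geometry.IsSmoothPolytope K P) where
  open OrderedField K
  open OrderedFieldProperties K
  open LinearAlgebraOverField K
  open Geometry K hiding (fromℤ)
  open IsSmoothPolytope smooth
  open Subsets
  open ≡-Reasoning

  n : ℕ
  n = proj₁ isLatticePolytope

  -- Generators of `P`; they may repeat and need not be vertices.
  p : Fin n → Point d
  p i = embed (proj₁ (proj₂ isLatticePolytope) i)

  P⇒Conv : ∀ {x} → P x → Conv p x
  P⇒Conv = proj₁ (proj₂ (proj₂ isLatticePolytope))

  Conv⇒P : ∀ {x} → Conv p x → P x
  Conv⇒P = proj₂ (proj₂ (proj₂ isLatticePolytope))

  p∈P : ∀ i → P (p i)
  p∈P i = Conv⇒P ((λ j → δ j i) , (λ j → δ-nonneg j i) , sum-δ-1 i , lincomb-δ p i)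

  convex : ∀ {m} (q : Fin m → Point d) w → (∀ i → 0# ≤ w i) → sum w ≡ 1# → (∀ i → P (q i)) → P (lincomb w q)
  convex q w 0≤w Σw≡1 q∈P = Conv⇒P
    ( (λ j → sum λ i → w i * C i j)
    , (λ j → sum-nonneg λ i → *-nonneg (0≤w i) (proj₁ (proj₂ (conv i)) j))
    , (begin
        sum (λ j → sum λ i → w i * C i j)  ≡⟨ sum-cong-≗ (λ j → sym (*-identityʳ (sum λ i → w i * C i j))) ⟩
        sum (λ j → (sum λ i → w i * C i j) * 1#)  ≡⟨ sum-*-sum w C (λ _ → 1#) ⟨
        sum (λ i → w i * sum λ j → C i j * 1#)
          ≡⟨ sum-cong-≗ (λ i → trans (cong (w i *_) (trans (sum-cong-≗ λ j → *-identityʳ (C i j)) (proj₁ (proj₂ (proj₂ (conv i)))))) (*-identityʳ (w i))) ⟩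
        sum w  ≡⟨ Σw≡1 ⟩
        1#  ∎)
    , trans (sym (lincomb-lincomb w C p)) (lincomb-cong (λ _ → refl) λ i → proj₂ (proj₂ (proj₂ (conv i)))) )
    where
    conv : ∀ i → Conv p (q i)
    conv i = P⇒Conv (q∈P i)
    C : ∀ i j → Carrier
    C i = proj₁ (conv i)

  -- Membership in the polar dual. As the origin is interior, every supporting hyperplane of a
  -- proper nonempty face can be scaled to the right-hand side 1.
  IsValid : Point d → Set ℓ
  IsValid a = ∀ i → dot a (p i) ≤ 1#

  dot-≤ : ∀ h c {x} → (∀ i → dot h (p i) ≤ c) → P x → dot h x ≤ c
  dot-≤ h c h≤c x∈P with P⇒Conv x∈P
  ... | w , 0≤w , Σw≡1 , refl = ≤-respects (sym (dot-lincombʳ h w p)) refl (weighted-≤ 0≤w Σw≡1 (inj₂ ∘ h≤c))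

  tight-weights : ∀ a {w} → IsValid a → (∀ i → 0# ≤ w i) → sum w ≡ 1# → dot a (lincomb w p) ≡ 1# →
    ∀ i → w i ≡ 0# ⊎ dot a (p i) ≡ 1#
  tight-weights a {w} valid 0≤w Σw≡1 tight =
    weighted-≡ 0≤w Σw≡1 (inj₂ ∘ valid) (trans (sym (dot-lincombʳ a w p)) tight)

  -- By `tight-weights`, only tight generators contribute to a point of the face, so a bound needs
  -- checking at those alone.
  dot-≤-on-face : ∀ a h c {x} → IsValid a → (∀ i → dot a (p i) ≡ 1# → dot h (p i) ≤ c) →
    P x → dot a x ≡ 1# → dot h x ≤ c
  dot-≤-on-face a h c valid h≤c x∈P tight with P⇒Conv x∈P
  ... | w , 0≤w , Σw≡1 , refl = ≤-respects (sym (dot-lincombʳ h w p)) refl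
    (weighted-≤ 0≤w Σw≡1 λ i → case tight-weights a valid 0≤w Σw≡1 tight i of λ where
      (inj₁ w≡0)   → inj₁ w≡0
      (inj₂ tight) → inj₂ (h≤c i tight))

  dot-≥-on-face : ∀ a h c {x} → IsValid a → (∀ i → dot a (p i) ≡ 1# → c ≤ dot h (p i)) →
    P x → dot a x ≡ 1# → c ≤ dot h x
  dot-≥-on-face a h c {x} valid c≤h x∈P tight = neg-cancel-≤ (≤-respects (dot-⊝ˡ h x) refl
    (dot-≤-on-face a (⊝ h) (- c) valid (λ i tᵢ → ≤-respects (sym (dot-⊝ˡ h (p i))) refl (neg-mono-≤ (c≤h i tᵢ))) x∈P tight))

  dot-≡-on-face : ∀ a h c {x} → IsValid a → (∀ i → dot a (p i) ≡ 1# → dot h (p i) ≡ c) →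
    P x → dot a x ≡ 1# → dot h x ≡ c
  dot-≡-on-face a h c valid h≡c x∈P tight = ≤-antisym
    (dot-≤-on-face a h c valid (λ i → ≤-reflexive ∘ h≡c i) x∈P tight)
    (dot-≥-on-face a h c valid (λ i → ≤-reflexive ∘ sym ∘ h≡c i) x∈P tight)

  -- `P` contains a small positive multiple of `u`, where `u` is positive, as the origin is
  -- interior. Hence a pivot in any nonzero direction is eventually stopped.
  positive-somewhere : ∀ u → u ≢ origin → ∃[ i ] 0# < dot u (p i)
  positive-somewhere u u≢0 = decide (Fin.any? (λ i → 0# <? dot u (p i)))
    where
    ray = cube-ray origin u (proj₁ (proj₂ originInside))
    t : Carrier
    t = proj₁ ray
    0<t : 0# < t
    0<t = proj₁ (proj₂ ray)
    x∈P : P (origin ⊕ t ∙ u)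
    x∈P = proj₂ (proj₂ originInside) {origin ⊕ t ∙ u} (proj₂ (proj₂ ray))
    decide : Dec (∃[ i ] 0# < dot u (p i)) → ∃[ i ] 0# < dot u (p i)
    decide (yes found) = found
    decide (no none)   = contradiction (*-pos 0<t (dot-self-pos u≢0)) (≤⇒≯ (≤-respects
      (trans (dot-⊕∙ʳ u origin t u) (trans (cong (_+ t * dot u u) (dot-originʳ u)) (+-identityˡ _))) refl
      (dot-≤ u 0# (λ i → ≮⇒≥ λ 0<up → none (i , 0<up)) x∈P)))

  Pivot : (a u : Point d) → Set ℓ
  Pivot a u = ∃[ t ] 0# < t × IsValid (a ⊕ t ∙ u) × ∃[ j ] 0# < dot u (p j) × dot (a ⊕ t ∙ u) (p j) ≡ 1#

  -- The hyperplane moves in direction `u` until the first generator stops it. The slacks 1 - a · p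
  -- i and the rates u · p i enter the ratio test; the last hypothesis, that no tight generator
  -- blocks the move, makes the step positive.
  pivot : ∀ a u → IsValid a → ∃[ i ] 0# < dot u (p i) → (∀ i → dot a (p i) ≡ 1# → dot u (p i) ≤ 0#) →
    Pivot a u
  pivot a u valid positive tight⇒≤0 =
    let (t , 0<t , bound , j , 0<rⱼ , eqⱼ) =
          ratio-test {r = λ i → dot u (p i)} {s = λ i → 1# - dot a (p i)} (λ i → ≤⇒0≤- (valid i))
            (λ i s≡0 → tight⇒≤0 i (sym (x-y≡0⇒x≡y s≡0))) positive
    in t , 0<t ,
    (λ i → ≤-respects (sym (dot-⊕∙ˡ a t u (p i))) refl (0≤-⇒≤ (≤-respects refl
      (solve 2 (λ x y → con (ℤ.+ 1) :- x :- y := con (ℤ.+ 1) :- (x :+ y)) refl (dot a (p i)) (t * dot u (p i))) (≤⇒0≤- (bound i))))) ,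
    j , 0<rⱼ , trans (dot-⊕∙ˡ a t u (p j)) (trans (cong (dot a (p j) +_) eqⱼ)
      (solve 1 (λ x → x :+ (con (ℤ.+ 1) :- x) := con (ℤ.+ 1)) refl (dot a (p j))))

  -- A vertex of the polar dual. That the tight generators span is expressed by their trivial
  -- orthogonal complement.
  record IsFacetNormal (a : Point d) : Set ℓ where
    field
      valid : IsValid a
      spans : ∀ u → (∀ i → dot a (p i) ≡ 1# → dot u (p i) ≡ 0#) → u ≡ origin

  module _ {s} {S : Fin n → Set s} (S? : ∀ i → Dec (S i)) where
    -- Omitted generators become the origin, which affects neither spans nor orthogonality and keeps
    -- the index type.
    restricted : Fin n → Point d
    restricted i = if ⌊ S? i ⌋ then p i else origin

    dot-restricted : ∀ u i c → (S i → dot u (p i) ≡ c) → (¬ S i → 0# ≡ c) → dot u (restricted i) ≡ c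
    dot-restricted u i c inside outside with S? i
    ... | yes sᵢ = inside sᵢ
    ... | no ¬sᵢ = trans (dot-originʳ u) (outside ¬sᵢ)

    dot-restricted⁻ : ∀ u i → S i → dot u (restricted i) ≡ 0# → dot u (p i) ≡ 0#
    dot-restricted⁻ u i sᵢ eq with S? i
    ... | yes _  = eq
    ... | no ¬sᵢ = contradiction sᵢ ¬sᵢ

  tight? : ∀ a i → Dec (dot a (p i) ≡ 1#)
  tight? a i = dot a (p i) ≟ 1#

  FacetAbove : Point d → Set ℓ
  FacetAbove a = ∃[ a′ ] IsFacetNormal a′ × (∀ i → dot a (p i) ≡ 1# → dot a′ (p i) ≡ 1#)

  -- Rotate the hyperplane a around its tight points until these span: r bounds
  -- the number of rotations by the rank still missing.
  facet-above : ∀ a → IsValid a → FacetAbove a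
  facet-above a valid = rotate (ℕ.suc d) 0 refl a valid (λ ()) (λ _ _ ()) (λ ())
    where
    rotate : ∀ r m → m ℕ.+ r ≡ ℕ.suc d → ∀ a → IsValid a → (τ : Fin m → Fin n) → LinearlyIndependent (p ∘ τ) →
      (∀ i → dot a (p (τ i)) ≡ 1#) → FacetAbove a
    -- The count starts at d + 1, so it can only run out with d + 1 independent vectors in dimension
    -- d.
    rotate ℕ.zero m m≡ a valid τ indep tight =
      contradiction (independent⇒≤ {q = p ∘ τ} indep) (ℕ.<⇒≱ (ℕ.≤-reflexive (trans (sym m≡) (ℕ.+-identityʳ m))))
    rotate (ℕ.suc r) m m≡ a valid τ indep tight = step (orthogonal-or-spanning (restricted (tight? a)))
      where
      u⊥tight : ∀ u → (∀ i → dot u (restricted (tight? a) i) ≡ 0#) → ∀ i → dot a (p i) ≡ 1# → dot u (p i) ≡ 0#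
      u⊥tight u u⊥ i tᵢ = dot-restricted⁻ (tight? a) u i tᵢ (u⊥ i)
      keeps : ∀ t u → (∀ i → dot u (restricted (tight? a) i) ≡ 0#) → ∀ i → dot a (p i) ≡ 1# → dot (a ⊕ t ∙ u) (p i) ≡ 1#
      keeps t u u⊥ i tᵢ = begin
        dot (a ⊕ t ∙ u) (p i)  ≡⟨ dot-⊕∙ˡ a t u (p i) ⟩
        dot a (p i) + t * dot u (p i) ≡⟨ cong₂ (λ x y → x + t * y) tᵢ (u⊥tight u u⊥ i tᵢ) ⟩
        1# + t * 0#  ≡⟨ solve 1 (λ t → con (ℤ.+ 1) :+ t :* con (ℤ.+ 0) := con (ℤ.+ 1)) refl t ⟩
        1#  ∎
      step : (∃[ u ] u ≢ origin × (∀ i → dot u (restricted (tight? a) i) ≡ 0#)) ⊎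
             (d ℕ.≤ n × (∀ x → InSpan (restricted (tight? a)) x)) →
             FacetAbove a
      step (inj₂ (_ , spanning)) = a , record
        { valid = valid
        ; spans = λ u u⊥ → spanning⇒orthogonal≡0 {v = restricted (tight? a)} spanning u
                    λ i → dot-restricted (tight? a) u i 0# (u⊥ i) (λ _ → refl)
        } , λ _ → id
      step (inj₁ (u , u≢0 , u⊥)) = pivoted (pivot a u valid (positive-somewhere u u≢0) (λ i → ≤-reflexive ∘ u⊥tight u u⊥ i))
        where
        pivoted : Pivot a u →
                  FacetAbove a
        -- `u` vanishes at the old tight points and is positive at `p j`: the old ones remain tight,
        -- and `p j` is independent of them.
        pivoted (t , 0<t , valid′ , j , 0<upⱼ , tightⱼ) =
          map₂ (map₂ λ tight′ i → tight′ i ∘ keeps t u u⊥ i)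
            (rotate r (ℕ.suc m) (trans (sym (ℕ.+-suc m r)) m≡) (a ⊕ t ∙ u) valid′ (j ∷ᶠ τ)
              (independent-cong (p j ∷ᶠ p ∘ τ) (p ∘ (j ∷ᶠ τ)) (λ { zero → refl ; (suc _) → refl })
                (independent-∷ (p ∘ τ) (p j) u indep (λ i → u⊥tight u u⊥ (τ i) (tight i)) (<⇒≢ 0<upⱼ ∘ sym)))
              (λ { zero → tightⱼ ; (suc i) → keeps t u u⊥ (τ i) (tight i) }))

  -- The difference of the normals vanishes on a spanning set.
  facet-normal-unique : ∀ a a′ → IsFacetNormal a → (∀ i → dot a (p i) ≡ 1# → dot a′ (p i) ≡ 1#) → a ≡ a′
  facet-normal-unique a a′ normal tight = ⊖≡origin⇒≡ (IsFacetNormal.spans normal (a ⊕ - 1# ∙ a′) λ i tᵢ → begin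
    dot (a ⊕ - 1# ∙ a′) (p i)  ≡⟨ dot-⊖ˡ a a′ (p i) ⟩
    dot a (p i) - dot a′ (p i)  ≡⟨ cong₂ _-_ tᵢ (tight i tᵢ) ⟩
    1# - 1#  ≡⟨ -‿inverseʳ 1# ⟩
    0#  ∎)

  FacetNormalOn : Subset n → Set ℓ
  FacetNormalOn S = ∃[ a ] IsFacetNormal a × (∀ i → S ∋ i → dot a (p i) ≡ 1#) × (∀ i → dot a (p i) ≡ 1# → S ∋ i)

  -- The existential over all points is decidable because the generators in `S` either fail to span,
  -- which excludes a normal, or leave a single candidate, to be tested by finitely many
  -- comparisons.
  facetNormalOn? : ∀ S → Dec (FacetNormalOn S)
  facetNormalOn? S = Sum.[ orthogonal , (λ (_ , spanning) → Spanning.decide spanning) ]′ (orthogonal-or-spanning (restricted (S ∋?_)))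
    where
    orthogonal : (∃[ u ] u ≢ origin × (∀ i → dot u (restricted (S ∋?_) i) ≡ 0#)) → Dec (FacetNormalOn S)
    orthogonal (u , u≢0 , u⊥) = no λ (a , normal , _ , tight⇒S) →
      u≢0 (IsFacetNormal.spans normal u λ i tᵢ → dot-restricted⁻ (S ∋?_) u i (tight⇒S i tᵢ) (u⊥ i))
    module Spanning (spanning : ∀ x → InSpan (restricted (S ∋?_)) x) where
      c : Fin d → Fin n → Carrier
      c j = proj₁ (spanning (std j))
      χ : Fin n → Carrier
      χ i = if ⌊ S ∋? i ⌋ then 1# else 0#
      χ-inside : ∀ {i} → S ∋ i → χ i ≡ 1#
      χ-inside {i} S∋i with S ∋? i
      ... | yes _   = refl
      ... | no ¬S∋i = contradiction S∋i ¬S∋i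
      χ-outside : ∀ {i} → ¬ S ∋ i → χ i ≡ 0#
      χ-outside {i} ¬S∋i with S ∋? i
      ... | yes S∋i = contradiction S∋i ¬S∋i
      ... | no _    = refl
      -- The only candidate, as a is determined by its values on a spanning family.
      a : Point d
      a = tabulate λ j → sum λ i → c j i * χ i
      candidate : ((a′ , _) : FacetNormalOn S) → a′ ≡ a
      candidate (a′ , normal , S⇒tight , tight⇒S) = point-ext λ j → begin
        lookup a′ j  ≡⟨ dot-std a′ j ⟨
        dot a′ (std j)  ≡⟨ cong (dot a′) (proj₂ (spanning (std j))) ⟨
        dot a′ (lincomb (c j) (restricted (S ∋?_)))  ≡⟨ dot-lincombʳ a′ (c j) (restricted (S ∋?_)) ⟩
        sum (λ i → c j i * dot a′ (restricted (S ∋?_) i))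
          ≡⟨ sum-cong-≗ (λ i → cong (c j i *_) (dot-restricted (S ∋?_) a′ i (χ i)
               (λ S∋i → trans (S⇒tight i S∋i) (sym (χ-inside S∋i))) (λ ¬S∋i → sym (χ-outside ¬S∋i)))) ⟩
        sum (λ i → c j i * χ i)  ≡⟨ Vec.lookup∘tabulate (λ j → sum λ i → c j i * χ i) j ⟨
        lookup a j  ∎
      decide : Dec (FacetNormalOn S)
      decide = case Fin.all? (λ i → dot a (p i) ≤? 1#) ×-dec Fin.all? (λ i → (S ∋? i) →-dec tight? a i)
                  ×-dec Fin.all? (λ i → tight? a i →-dec (S ∋? i)) of λ where
       (yes (valid , S⇒tight , tight⇒S)) → yes (a , record
        { valid = valid
        ; spans = λ u u⊥ → spanning⇒orthogonal≡0 {v = restricted (S ∋?_)} spanning u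
                    λ i → dot-restricted (S ∋?_) u i 0# (u⊥ i ∘ S⇒tight i) (λ _ → refl)
        } , S⇒tight , tight⇒S)
       (no ¬a) → no λ found@(a′ , normal , rest) → ¬a (subst
        (λ a → (∀ i → dot a (p i) ≤ 1#) × (∀ i → S ∋ i → dot a (p i) ≡ 1#) × (∀ i → dot a (p i) ≡ 1# → S ∋ i))
        (candidate found) (IsFacetNormal.valid normal , rest))

  private
    normalsOn : List (Subset n) → List (Point d)
    normalsOn []       = []
    normalsOn (S ∷ Ss) with facetNormalOn? S
    ... | yes (a , _) = a ∷ normalsOn Ss
    ... | no _        = normalsOn Ss

    normalsOn-sound : ∀ Ss {a} → a ∈ normalsOn Ss → IsFacetNormal a
    normalsOn-sound (S ∷ Ss) a∈ with facetNormalOn? S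
    normalsOn-sound (S ∷ Ss) (here refl) | yes (_ , normal , _) = normal
    normalsOn-sound (S ∷ Ss) (there a∈)  | yes _ = normalsOn-sound Ss a∈
    normalsOn-sound (S ∷ Ss) a∈          | no _  = normalsOn-sound Ss a∈

    normalsOn-complete : ∀ {Ss S} → S ∈ Ss → ((a , _) : FacetNormalOn S) → a ∈ normalsOn Ss
    normalsOn-complete {S ∷ Ss} (here refl) found@(a , normal , S⇒tight , tight⇒S) with facetNormalOn? S
    ... | yes (a′ , _ , S⇒tight′ , _) = here (facet-normal-unique a a′ normal λ i → S⇒tight′ i ∘ tight⇒S i)
    ... | no ¬found                   = contradiction found ¬found
    normalsOn-complete {S ∷ Ss} (there S∈) found with facetNormalOn? S
    ... | yes _ = there (normalsOn-complete S∈ found)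
    ... | no _  = normalsOn-complete S∈ found

  abstract
    facetNormals : List (Point d)
    facetNormals = List.deduplicate _≟ᴾ_ (normalsOn (subsets n))

    L : ℕ
    L = length facetNormals

    normal : Fin L → Point d
    normal = List.lookup facetNormals

    isFacetNormal : ∀ l → IsFacetNormal (normal l)
    isFacetNormal l = normalsOn-sound (subsets n) (∈-deduplicate⁻ _≟ᴾ_ (normalsOn (subsets n)) (∈-lookup l))

    facet-index : ∀ {a} → IsFacetNormal a → ∃[ l ] normal l ≡ a
    facet-index {a} isNormal = index a∈ , sym (lookup-index a∈)
      where
      a∈ : a ∈ facetNormals
      a∈ = ∈-deduplicate⁺ _≟ᴾ_ (normalsOn-complete (∈-subsets (comprehension (tight? a)))
        (a , isNormal , (λ _ → ∋-comprehension⁻ (tight? a)) , λ _ → ∋-comprehension⁺ (tight? a)))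

    normal-injective : ∀ {l m} → normal l ≡ normal m → l ≡ m
    normal-injective {l} {m} = lookup-injective (deduplicate-! _≟ᴾ_ (normalsOn (subsets n))) l m
      where
      lookup-injective : ∀ {xs : List (Point d)} → Unique xs → ∀ i j → List.lookup xs i ≡ List.lookup xs j → i ≡ j
      lookup-injective {_ ∷ _}  (∉ ∷ _) zero    zero    _  = refl
      lookup-injective {_ ∷ xs} (∉ ∷ _) zero    (suc j) eq = contradiction eq (All.lookup ∉ (∈-lookup {xs = xs} j))
      lookup-injective {_ ∷ xs} (∉ ∷ _) (suc i) zero    eq = contradiction (sym eq) (All.lookup ∉ (∈-lookup {xs = xs} i))
      lookup-injective {_ ∷ _}  (_ ∷ u) (suc i) (suc j) eq = cong suc (lookup-injective u i j eq)

  valid-facet : ∀ l → IsValid (normal l)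
  valid-facet l = IsFacetNormal.valid (isFacetNormal l)

  -- The face cut out by `a` lies in a facet. This passes from generators to all points of the face,
  -- so that it can be applied to vertices and lattice points.
  facet-above-index : ∀ a → IsValid a → ∃[ l ] (∀ {x} → P x → dot a x ≡ 1# → dot (normal l) x ≡ 1#)
  facet-above-index a valid =
    let (a′ , isNormal , tight) = facet-above a valid
        (l , normal≡a′) = facet-index isNormal
    in l , λ {x} x∈P tightₓ → trans (cong (λ b → dot b x) normal≡a′)
             (dot-≡-on-face a a′ 1# valid tight x∈P tightₓ)

  someFacet : Fin L
  -- The zero functional is valid and tight nowhere; rotating it produces a facet from nothing.
  someFacet = proj₁ (facet-above-index origin λ i → ≤-respects (sym (dot-originˡ (p i))) refl (<⇒≤ 0<1))

-- Dual bases of the facets, and passage to a neighbouring facet.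

module FacetFrames {ℓ} (K : OrderedField ℓ) {d : ℕ} (P : Geometry.Region K d)
                   (smooth : Geometry.IsSmoothPolytope K P) (0<d : 0 ℕ.< d) where
  open OrderedField K
  open OrderedFieldProperties K
  open LinearAlgebraOverField K
  open Geometry K hiding (fromℤ)
  open IsSmoothPolytope smooth
  open FacetNormals K P smooth
  open ≡-Reasoning

  -- `e` lists the vertices of the facet and `e*` is the dual basis. It is kept integral, so that
  -- the coordinates of lattice points are integers.
  record FacetFrame (a : Point d) : Set ℓ where
    field
      e                : Fin d → Vec ℤ d
      e*               : Fin d → Vec ℤ d
      dual             : ∀ i j → dot (embed (e* i)) (embed (e j)) ≡ δ i j
      expand           : ∀ x → lincomb (λ i → dot (embed (e* i)) x) (embed ∘ e) ≡ x
      e∈P              : ∀ i → P (embed (e i))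
      e-tight          : ∀ i → dot a (embed (e i)) ≡ 1#
      coordinate-nonneg : ∀ i {x} → P x → dot a x ≡ 1# → 0# ≤ dot (embed (e* i)) x

  Face : Point d → Region d
  Face a x = P x × dot a x ≡ 1#

  -- The hyperplane a · x = 1 misses the origin: applying `a` to a linear relation shows that its
  -- coefficients sum to 0.
  affine⇒linear : ∀ a {m} (q : Fin m → Point d) → (∀ i → dot a (q i) ≡ 1#) → AffinelyIndependent q → LinearlyIndependent q
  affine⇒linear a q tight indep c eq = indep c (begin
    sum c  ≡⟨ sum-cong-≗ (λ i → trans (cong (c i *_) (tight i)) (*-identityʳ (c i))) ⟨
    sum (λ i → c i * dot a (q i))  ≡⟨ dot-lincombʳ a c q ⟨
    dot a (lincomb c q)  ≡⟨ cong (dot a) eq ⟩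
    dot a origin  ≡⟨ dot-originʳ a ⟩
    0#  ∎) eq

  module FaceVertices (a : Point d) (isNormal : IsFacetNormal a) where
    open IsFacetNormal isNormal

    -- The conclusion of linear programming for `h₀`: its maximum over the face is attained at a
    -- vertex.
    Maximizer : Point d → Set ℓ
    Maximizer h₀ = ∃[ l ] dot a (p l) ≡ 1# × IsVertex (Face a) (p l) ×
      (∀ j → dot a (p j) ≡ 1# → dot h₀ (p j) ≤ dot h₀ (p l))

    -- A functional that separates the points p i attains its maximum over the
    -- face at one point only.
    maximizer : ∀ h₀ → ∃[ i ] dot a (p i) ≡ 1# → Maximizer h₀
    maximizer h₀ someTight = maximal (generic-functional h₀ difference)
      where
      difference : Fin (n ℕ.* n) → Point d
      difference r = p (proj₁ (remQuot n r)) ⊕ - 1# ∙ p (proj₂ (remQuot {n} n r))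
      difference-combine : ∀ i j → difference (combine i j) ≡ p i ⊕ - 1# ∙ p j
      difference-combine i j = cong (λ (i , j) → p i ⊕ - 1# ∙ p j) (Fin.remQuot-combine {n} {n} i j)
      maximal : (∃[ h ] (∀ r → difference r ≢ origin → dot h (difference r) ≢ 0#) ×
                        (∀ r → 0# < dot h₀ (difference r) → 0# < dot h (difference r))) →
                Maximizer h₀
      maximal (h , separates , extends) = at-maximum (argmax (tight? a) (λ i → dot h (p i)) someTight)
        where
        at-maximum : (∃[ l ] dot a (p l) ≡ 1# × (∀ i → dot a (p i) ≡ 1# → dot h (p i) ≤ dot h (p l))) →
                     Maximizer h₀
        at-maximum (l , tightₗ , max) = l , tightₗ , (h , dot h (p l) , bound , only , collapse) , h₀-max
          where
          bound : ∀ x → Face a x → dot h x ≤ dot h (p l)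
          bound x (x∈P , tight) = dot-≤-on-face a h (dot h (p l)) valid max x∈P tight
          same-value : ∀ i → dot h (p i) ≡ dot h (p l) → p i ≡ p l
          same-value i eq = decide (p i ⊕ - 1# ∙ p l ≟ᴾ origin)
            where
            decide : Dec (p i ⊕ - 1# ∙ p l ≡ origin) → p i ≡ p l
            decide (yes eq₀)  = ⊖≡origin⇒≡ eq₀
            decide (no  neq) = contradiction
              (trans (cong (dot h) (difference-combine i l)) (trans (dot-⊖ʳ h (p i) (p l)) (trans (cong (λ z → z - dot h (p l)) eq) (-‿inverseʳ _))))
              (separates (combine i l) (neq ∘ trans (sym (difference-combine i l))))
          only : ∀ {x} → p l ≡ x → Face a x × dot h x ≡ dot h (p l)
          only refl = (p∈P l , tightₗ) , refl
          collapse : ∀ {x} → Face a x × dot h x ≡ dot h (p l) → p l ≡ x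
          collapse ((x∈P , tight) , eq) = collapse-conv (P⇒Conv x∈P) tight eq
            where
            collapse-conv : ∀ {x} → Conv p x → dot a x ≡ 1# → dot h x ≡ dot h (p l) → p l ≡ x
            collapse-conv (w , 0≤w , Σw≡1 , refl) tight eq = dot-ext λ z → begin
              dot (p l) z  ≡⟨ *-identityˡ _ ⟨
              1# * dot (p l) z  ≡⟨ cong (_* dot (p l) z) Σw≡1 ⟨
              sum w * dot (p l) z  ≡⟨ *-distribʳ-sum (dot (p l) z) w ⟩
              sum (λ i → w i * dot (p l) z)  ≡⟨ sum-cong-≗ (λ i → term z i (support i)) ⟩
              sum (λ i → w i * dot (p i) z)  ≡⟨ dot-lincombˡ w p z ⟨
              dot (lincomb w p) z  ∎
              where
              support : ∀ i → w i ≡ 0# ⊎ dot h (p i) ≡ dot h (p l)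
              support = weighted-≡ {g = λ i → dot h (p i)} 0≤w Σw≡1
                (λ i → Sum.map₂ (max i) (tight-weights a valid 0≤w Σw≡1 tight i))
                (trans (sym (dot-lincombʳ h w p)) eq)
              term : ∀ z i → w i ≡ 0# ⊎ dot h (p i) ≡ dot h (p l) → w i * dot (p l) z ≡ w i * dot (p i) z
              term z i (inj₁ w≡0) = trans (trans (cong (_* dot (p l) z) w≡0) (zeroˡ _)) (sym (trans (cong (_* dot (p i) z) w≡0) (zeroˡ _)))
              term z i (inj₂ eq)  = cong (λ x → w i * dot x z) (sym (same-value i eq))
          h₀-max : ∀ j → dot a (p j) ≡ 1# → dot h₀ (p j) ≤ dot h₀ (p l)
          -- `h` refines `h₀`: a strictly larger value of `h₀` at `p j` would be a strictly larger
          -- value of `h`.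
          h₀-max j tightⱼ = ≮⇒≥ λ h₀l<h₀j → ≤⇒≯ (max j tightⱼ) (0<-⇒< (<-respects refl
            (trans (cong (dot h) (difference-combine j l)) (dot-⊖ʳ h (p j) (p l)))
            (extends (combine j l) (<-respects refl
              (sym (trans (cong (dot h₀) (difference-combine j l)) (dot-⊖ʳ h₀ (p j) (p l)))) (<⇒0<- h₀l<h₀j)))))

    spanning-tight : ∃[ τ ] LinearlyIndependent {n = d} (restricted (tight? a) ∘ τ)
    spanning-tight = basis-extraction (restricted (tight? a))
      λ u u⊥ → spans u λ i tᵢ → dot-restricted⁻ (tight? a) u i tᵢ (u⊥ i)

    restricted∈Face : ∀ i → restricted (tight? a) i ≢ origin → Face a (restricted (tight? a) i)
    restricted∈Face i ≢0 with tight? a i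
    ... | yes tᵢ = p∈P i , tᵢ
    ... | no  _  = contradiction refl ≢0

    independent⇒≢origin : ∀ {m} (q : Fin m → Point d) → LinearlyIndependent q → ∀ i → q i ≢ origin
    independent⇒≢origin q indep i qᵢ≡0 = 0≢1 (sym (trans (sym (δ-refl i)) (indep (λ j → δ j i) (trans (lincomb-δ q i) qᵢ≡0) i)))

    -- Since d > 0, the independent family has a member. It is not the origin, so it is a tight
    -- generator.
    someTight : ∃[ i ] dot a (p i) ≡ 1#
    someTight = τ i , tight-of (restricted∈Face (τ i) (independent⇒≢origin (restricted (tight? a) ∘ proj₁ spanning-tight) (proj₂ spanning-tight) i))
      where
      τ = proj₁ spanning-tight
      i : Fin d
      i = fromℕ< 0<d
      tight-of : ∀ {i} → Face a (restricted (tight? a) i) → dot a (p i) ≡ 1#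
      tight-of {i} (_ , tight) with tight? a i
      ... | yes tᵢ = tᵢ
      ... | no  _  = contradiction (trans (sym (dot-originʳ a)) tight) 0≢1

    -- The tight generators contain d independent vectors, and on this hyperplane affine
    -- independence is linear, so d is also the upper bound.
    isFacet : IsFacet P (Face a)
    isFacet = (a , 1# , (λ x → dot-≤ a 1# valid) , id , id) , ℕ.pred d , 1+k≡d , dimension 1+k≡d
      where
      1+k≡d : ℕ.suc (ℕ.pred d) ≡ d
      1+k≡d = ℕ.suc-pred d {{ℕ.>-nonZero 0<d}}
      dimension : ∀ {k} → ℕ.suc k ≡ d → HasDim (Face a) k
      dimension 1+k≡d = record
        { attained = points 1+k≡d
        ; maximal  = λ q indep q∈ → subst (_ ℕ.≤_) (sym 1+k≡d) (independent⇒≤ {q = q} (affine⇒linear a q (proj₂ ∘ q∈) indep))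
        }
        where
        points : ∀ {m} → m ≡ d → Σ[ q ∈ (Fin m → Point d) ] AffinelyIndependent q × (∀ i → Face a (q i))
        points refl = restricted (tight? a) ∘ proj₁ spanning-tight , (λ c _ → proj₂ spanning-tight c) ,
          λ i → restricted∈Face _ (independent⇒≢origin (restricted (tight? a) ∘ proj₁ spanning-tight) (proj₂ spanning-tight) i)

  module Unimodular {m} (e : Fin m → Vec ℤ d) (basis : IsℤBasis e) where
    open IsℤBasis basis

    E : Fin m → Point d
    E = embed ∘ e

    b : Fin d → Fin m → ℤ
    b j = proj₁ (spanning (stdℤ j))

    -- `b` is the integral inverse of the matrix with columns `e`; its rows are the dual basis.
    e* : Fin m → Vec ℤ d
    e* i = tabulate λ j → b j i

    expand : ∀ x → lincomb (λ i → dot (embed (e* i)) x) E ≡ x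
    expand x = begin
      lincomb (λ i → dot (embed (e* i)) x) E
        ≡⟨ lincomb-cong {v = E} (λ i → sum-cong-≗ λ j → trans (*-comm (lookup (embed (e* i)) j) (lookup x j))
             (cong (lookup x j *_) (trans (lookup-embed (e* i) j) (cong fromℤ (Vec.lookup∘tabulate (λ j → b j i) j))))) (λ _ → refl) ⟩
      lincomb (λ i → sum λ j → lookup x j * fromℤ (b j i)) E
        ≡⟨ lincomb-lincomb (lookup x) (λ j i → fromℤ (b j i)) E ⟨
      lincomb (lookup x) (λ j → lincomb (λ i → fromℤ (b j i)) E)
        ≡⟨ lincomb-cong {w = lookup x} (λ _ → refl) (λ j → trans (sym (embed-lincomb (b j) e)) (trans (cong embed (proj₂ (spanning (stdℤ j)))) (embed-stdℤ j))) ⟩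
      lincomb (lookup x) std
        ≡⟨ lincomb-std x ⟩
      x ∎

    -- `independent` speaks about integer coefficients only. The coordinates of `E j` minus those of
    -- the trivial expansion are integers, so it applies to them.
    dual : ∀ i j → dot (embed (e* i)) (E j) ≡ δ i j
    dual i j = x-y≡0⇒x≡y (trans (sym (c-embed i)) (cong fromℤ (independent c (embed-injective (begin
      embed (ℤ-LA.lincomb c e)  ≡⟨ embed-lincomb c e ⟩
      lincomb (fromℤ ∘ c) E  ≡⟨ lincomb-cong {v = E} c-embed (λ _ → refl) ⟩
      lincomb (λ i → dot (embed (e* i)) (E j) - δ i j) E  ≡⟨ lincomb-difference E (trans (expand (E j)) (sym (lincomb-δ E j))) ⟩
      origin  ≡⟨ embed-origin ⟨
      embed (Vec.replicate d ℤ.0ℤ)  ∎)) i)))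
      where
      c : Fin m → ℤ
      c i = ℤ-LA.dot (e* i) (e j) ℤ.- (if ⌊ i Fin.≟ j ⌋ then ℤ.1ℤ else ℤ.0ℤ)
      c-embed : ∀ i → fromℤ (c i) ≡ dot (embed (e* i)) (E j) - δ i j
      c-embed i = trans (fromℤ-+ (ℤ-LA.dot (e* i) (e j)) _) (cong₂ _+_ (sym (embed-dot (e* i) (e j)))
        (trans (fromℤ-neg (if ⌊ i Fin.≟ j ⌋ then ℤ.1ℤ else ℤ.0ℤ)) (cong -_ (fromℤ-δ i j))))

    dual-lincomb : ∀ c i → dot (embed (e* i)) (lincomb c E) ≡ c i
    dual-lincomb c i = begin
      dot (embed (e* i)) (lincomb c E)  ≡⟨ dot-lincombʳ (embed (e* i)) c E ⟩
      sum (λ j → c j * dot (embed (e* i)) (E j))  ≡⟨ sum-cong-≗ (λ j → trans (cong (c j *_) (trans (dual i j) (δ-comm i j))) (*-comm (c j) (δ j i))) ⟩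
      sum (λ j → δ j i * c j)  ≡⟨ sum-δ c i ⟩
      c i  ∎

    -- The size of the basis is not part of the definition of smoothness. Over the field, `E` is
    -- independent by duality and spans by `expand`.
    size : m ≡ d
    size = ℕ.≤-antisym
      (independent⇒≤ {q = E} λ c eq i → trans (sym (dual-lincomb c i)) (trans (cong (dot (embed (e* i))) eq) (dot-originʳ (embed (e* i)))))
      (spanning-size (orthogonal-or-spanning E))
      where
      spanning-size : (∃[ u ] u ≢ origin × (∀ i → dot u (E i) ≡ 0#)) ⊎ (d ℕ.≤ m × (∀ x → InSpan E x)) → d ℕ.≤ m
      spanning-size (inj₁ (u , u≢0 , u⊥)) = contradiction (spanning⇒orthogonal≡0 {v = E} (λ x → _ , expand x) u u⊥) u≢0
      spanning-size (inj₂ (d≤m , _))      = d≤m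

  frame : ∀ a → IsFacetNormal a → FacetFrame a
  frame a isNormal = build (facetBases (Face a) isFacet)
    where
    open IsFacetNormal isNormal
    open FaceVertices a isNormal
    build : VerticesFormℤBasis (Face a) → FacetFrame a
    build (m , e , basis , vertices) = resized (Unimodular.size e basis) e basis vertices
      where
      resized : ∀ {m} → m ≡ d → (e : Fin m → Vec ℤ d) → IsℤBasis e →
        (∀ x → IsVertex (Face a) x ⇔ (∃[ i ] x ≡ embed (e i))) → FacetFrame a
      resized refl e basis vertices = record
        { e = e ; e* = e* ; dual = dual ; expand = expand
        ; e∈P = λ i → proj₁ (e∈Face i)
        ; e-tight = λ i → proj₂ (e∈Face i)
        ; coordinate-nonneg = λ i → dot-≥-on-face a (embed (e* i)) 0# valid (nonneg i)
        }
        where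
        open Unimodular e basis
        vertex∈Face : ∀ {x} → IsVertex (Face a) x → Face a x
        vertex∈Face (_ , _ , _ , ⊆ , _) = proj₁ (⊆ refl)
        e∈Face : ∀ i → Face a (E i)
        e∈Face i = vertex∈Face (Equivalence.from (vertices (E i)) (i , refl))
        -- The i-th coordinate attains its minimum over the face at a vertex, hence at some `E k`,
        -- where it is 0 or 1.
        nonneg : ∀ i j → dot a (p j) ≡ 1# → 0# ≤ dot (embed (e* i)) (p j)
        nonneg i j tightⱼ = at-vertex (maximizer (⊝ embed (e* i)) (j , tightⱼ))
          where
          at-vertex : Maximizer (⊝ embed (e* i)) → 0# ≤ dot (embed (e* i)) (p j)
          at-vertex (l , tightₗ , vertex , max) = ≤-trans
            (≤-respects refl (trans (sym (dual i (proj₁ found))) (cong (dot (embed (e* i))) (sym (proj₂ found)))) (δ-nonneg i (proj₁ found)))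
            (neg-cancel-≤ (≤-respects (dot-⊝ˡ (embed (e* i)) (p j)) (dot-⊝ˡ (embed (e* i)) (p l)) (max j tightⱼ)))
            where
            found : ∃[ k ] p l ≡ E k
            found = Equivalence.to (vertices (p l)) vertex

  abstract
    F : ∀ l → FacetFrame (normal l)
    F l = frame (normal l) (isFacetNormal l)

  module Frame (l : Fin L) where
    open FacetFrame (F l) public

    E : Fin d → Point d
    E i = embed (e i)

    coordinate : Fin d → Point d → Carrier
    coordinate i = dot (embed (e* i))

    dot-expand : ∀ u x → dot u x ≡ sum λ i → coordinate i x * dot u (E i)
    dot-expand u x = trans (cong (dot u) (sym (expand x))) (dot-lincombʳ u (λ i → coordinate i x) E)

    normal-coordinates : ∀ x → dot (normal l) x ≡ sum λ i → coordinate i x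
    normal-coordinates x = trans (dot-expand (normal l) x)
      (sum-cong-≗ λ i → trans (cong (coordinate i x *_) (e-tight i)) (*-identityʳ (coordinate i x)))

    -- The facet across the ridge opposite to `E i`: along the ridge the i-th coordinate is 0 and
    -- both normals agree.
    Neighbour : Fin d → Set ℓ
    Neighbour i = ∃[ l′ ] ∃[ t ] 0# < t × (∀ x → dot (normal l′) x ≡ dot (normal l) x - t * coordinate i x)

    -- The pivot runs in the direction opposite to `e* i`, which no tight generator blocks because
    -- coordinates are nonnegative on the facet. The vertices `E k` with k ≢ i stay tight, and the
    -- new tight generator has a negative i-th coordinate, so together they span.
    neighbour : ∀ i → Neighbour i
    neighbour i = pivoted (pivot (normal l) u (valid-facet l) (positive-somewhere u u≢0)
      λ j tⱼ → 0≤-⇒≤ (≤-respects refl (trans (solve 1 (λ x → x := con (ℤ.+ 0) :- :- x) refl (coordinate i (p j))) (cong (λ z → 0# - z) (sym (dot-⊝ˡ (embed (e* i)) (p j)))))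
                 (coordinate-nonneg i (p∈P j) tⱼ)))
      where
      u : Point d
      u = ⊝ embed (e* i)
      u≢0 : u ≢ origin
      u≢0 u≡0 = 0≢1 (begin
        0#  ≡⟨ solve 0 (con (ℤ.+ 0) := :- con (ℤ.+ 0)) refl ⟩
        - 0#  ≡⟨ cong -_ (trans (sym (dot-originˡ (E i))) (cong (λ z → dot z (E i)) (sym u≡0))) ⟩
        - dot u (E i)  ≡⟨ cong -_ (dot-⊝ˡ (embed (e* i)) (E i)) ⟩
        - - coordinate i (E i)  ≡⟨ cong (λ z → - - z) (trans (dual i i) (δ-refl i)) ⟩
        - - 1#  ≡⟨ solve 0 (:- :- con (ℤ.+ 1) := con (ℤ.+ 1)) refl ⟩
        1#  ∎)
      pivoted : Pivot (normal l) u →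
                Neighbour i
      pivoted (t , 0<t , valid′ , j , 0<up , tightⱼ) = found (facet-index isNormal)
        where
        a′ : Point d
        a′ = normal l ⊕ t ∙ u
        dot-a′ : ∀ x → dot a′ x ≡ dot (normal l) x - t * coordinate i x
        dot-a′ x = begin
          dot a′ x  ≡⟨ dot-⊕∙ˡ (normal l) t u x ⟩
          dot (normal l) x + t * dot u x  ≡⟨ cong (λ z → dot (normal l) x + t * z) (dot-⊝ˡ (embed (e* i)) x) ⟩
          dot (normal l) x + t * (- coordinate i x)  ≡⟨ solve 3 (λ a t c → a :+ t :* :- c := a :- t :* c) refl _ t _ ⟩
          dot (normal l) x - t * coordinate i x  ∎
        E-tight′ : ∀ {k} → k ≢ i → dot a′ (E k) ≡ 1#
        E-tight′ {k} k≢i = trans (dot-a′ (E k)) (trans (cong₂ (λ x y → x - t * y) (e-tight k) (trans (dual i k) (δ-≢ (k≢i ∘ sym))))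
          (solve 1 (λ t → con (ℤ.+ 1) :- t :* con (ℤ.+ 0) := con (ℤ.+ 1)) refl t))
        isNormal : IsFacetNormal a′
        isNormal = record { valid = valid′ ; spans = λ v v⊥ → dot-self-≡0 v (begin
            dot v v  ≡⟨ dot-expand v v ⟩
            sum (λ k → coordinate k v * dot v (E k))  ≡⟨ sum-zero (λ k → trans (cong (coordinate k v *_) (v⊥E v v⊥ k)) (zeroʳ _)) ⟩
            0#  ∎) }
          where
          v⊥others : ∀ v → (∀ j → dot a′ (p j) ≡ 1# → dot v (p j) ≡ 0#) → ∀ {k} → k ≢ i → dot v (E k) ≡ 0#
          v⊥others v v⊥ {k} k≢i = dot-≡-on-face a′ v 0# valid′ v⊥ (e∈P k) (E-tight′ k≢i)
          v⊥E : ∀ v → (∀ j → dot a′ (p j) ≡ 1# → dot v (p j) ≡ 0#) → ∀ k → dot v (E k) ≡ 0#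
          v⊥E v v⊥ k = decide (k Fin.≟ i)
            where
            decide : Dec (k ≡ i) → dot v (E k) ≡ 0#
            decide (no k≢i)   = v⊥others v v⊥ k≢i
            -- In the expansion of v · p j only the k-th term survives, and its factor
            -- `coordinate k (p j)` is nonzero.
            decide (yes refl) = *-zero-or (begin
              coordinate k (p j) * dot v (E k)
                ≡⟨ sum-single (λ k → coordinate k (p j) * dot v (E k)) k (λ k′ k′≢k → trans (cong (coordinate k′ (p j) *_) (v⊥others v v⊥ k′≢k)) (zeroʳ _)) ⟨
              sum (λ k → coordinate k (p j) * dot v (E k))  ≡⟨ dot-expand v (p j) ⟨
              dot v (p j)  ≡⟨ v⊥ j tightⱼ ⟩
              0#  ∎)
              λ c≡0 → <⇒≢ 0<up (sym (trans (dot-⊝ˡ (embed (e* k)) (p j)) (trans (cong -_ c≡0) (solve 0 (:- con (ℤ.+ 0) := con (ℤ.+ 0)) refl))))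
        found : ∃[ l′ ] normal l′ ≡ a′ → Neighbour i
        found (l′ , eq) = l′ , t , 0<t , λ x → trans (cong (λ a → dot a x) eq) (dot-a′ x)

  open Frame using (coordinate; E) public

  -- The second alternative exempts the coordinates in which the points `G` are involved: crossing
  -- the ridge there would leave `G`.
  MaximalFacet : ∀ {m} → (Fin m → Point d) → Point d → Set ℓ
  MaximalFacet G x = ∃[ l ] (∀ j → dot (normal l) (G j) ≡ 1#) × (∀ i → 0# ≤ coordinate l i x ⊎ ∃[ j ] coordinate l i (G j) ≢ 0#)

  -- A facet through the points G maximizing dot (normal l) x: a negative coordinate
  -- of x would let the neighbouring facet do better.
  abstract
    maximal-facet : ∀ {m} (G : Fin m → Point d) l₀ → (∀ j → dot (normal l₀) (G j) ≡ 1#) → ∀ x →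
      MaximalFacet G x
    maximal-facet G l₀ G-tight₀ x = at-maximum
      (argmax (λ l → Fin.all? λ j → dot (normal l) (G j) ≟ 1#) (λ l → dot (normal l) x) (l₀ , G-tight₀))
      where
      at-maximum : (∃[ l ] (∀ j → dot (normal l) (G j) ≡ 1#) × (∀ l′ → (∀ j → dot (normal l′) (G j) ≡ 1#) → dot (normal l′) x ≤ dot (normal l) x)) →
        MaximalFacet G x
      at-maximum (l , G-tight , max) = l , G-tight , λ i → decide i (0# ≤? coordinate l i x) (Fin.any? λ j → ¬? (coordinate l i (G j) ≟ 0#))
        where
        decide : ∀ i → Dec (0# ≤ coordinate l i x) → Dec (∃[ j ] coordinate l i (G j) ≢ 0#) →
          0# ≤ coordinate l i x ⊎ ∃[ j ] coordinate l i (G j) ≢ 0#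
        decide i (yes 0≤c) _           = inj₁ 0≤c
        decide i (no _)    (yes found) = inj₂ found
        decide i (no 0≰c)  (no none)   = contradiction (Frame.neighbour l i) improves
          where
          improves : ¬ Frame.Neighbour l i
          improves (l′ , t , 0<t , dot-l′) = ≤⇒≯ (max l′ G-tight′) (0<-⇒< (<-respects refl (begin
              t * (- coordinate l i x)  ≡⟨ solve 3 (λ t c a → t :* :- c := a :- t :* c :- a) refl t (coordinate l i x) (dot (normal l) x) ⟩
              dot (normal l) x - t * coordinate l i x - dot (normal l) x  ≡⟨ cong (λ z → z - dot (normal l) x) (dot-l′ x) ⟨
              dot (normal l′) x - dot (normal l) x  ∎)
            (*-pos 0<t (neg-pos (≰⇒> 0≰c)))))
            where
            coordinate≡0 : ∀ j → coordinate l i (G j) ≡ 0#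
            coordinate≡0 j = from-dec (coordinate l i (G j) ≟ 0#)
              where
              from-dec : Dec (coordinate l i (G j) ≡ 0#) → coordinate l i (G j) ≡ 0#
              from-dec (yes eq) = eq
              from-dec (no neq) = contradiction (j , neq) none
            G-tight′ : ∀ j → dot (normal l′) (G j) ≡ 1#
            G-tight′ j = trans (dot-l′ (G j)) (trans (cong₂ (λ a c → a - t * c) (G-tight j) (coordinate≡0 j))
              (solve 1 (λ t → con (ℤ.+ 1) :- t :* con (ℤ.+ 0) := con (ℤ.+ 1)) refl t))

  abstract
    -- With `G` empty no coordinate is exempt.
    enclosing-cone : ∀ x → ∃[ l ] (∀ i → 0# ≤ coordinate l i x)
    enclosing-cone x = map₂ (λ (_ , choice) i → Sum.[ id , (λ ()) ]′ (choice i)) (maximal-facet {0} (λ ()) someFacet (λ ()) x)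

-- Dilates by inequalities, and the lattice points on their boundary.

module BoundaryPoints {ℓ} (K : OrderedField ℓ) {d : ℕ} (P : Geometry.Region K d)
                      (smooth : Geometry.IsSmoothPolytope K P) (0<d : 0 ℕ.< d) where
  open OrderedField K
  open OrderedFieldProperties K
  open LinearAlgebraOverField K
  open Geometry K hiding (fromℤ)
  open IsSmoothPolytope smooth
  open FacetNormals K P smooth
  open FacetFrames K P smooth 0<d
  open ≡-Reasoning

  center∈Cube : ∀ (x : Point d) {ε} → 0# < ε → Cube x ε x
  center∈Cube x 0<ε i = <-respects refl (sym (-‿inverseʳ _)) (pos-neg 0<ε) , <-respects (sym (-‿inverseʳ _)) refl 0<ε

  origin∈P : P origin
  origin∈P = proj₂ (proj₂ originInside) {origin} (center∈Cube origin (proj₁ (proj₂ originInside)))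

  -- In its enclosing cone, `x` has nonnegative coordinates with sum at most 1; the missing weight
  -- goes to the origin, which belongs to `P`.
  halfspaces⇒P : ∀ {x} → (∀ l → dot (normal l) x ≤ 1#) → P x
  halfspaces⇒P {x} x≤1 = in-cone (enclosing-cone x)
    where
    in-cone : ∃[ l ] (∀ i → 0# ≤ coordinate l i x) → P x
    in-cone (l , 0≤c) = subst P eq (convex (origin ∷ᶠ E l) (rest ∷ᶠ c)
      (λ { zero → ≤⇒0≤- (≤-respects (Frame.normal-coordinates l x) refl (x≤1 l)) ; (suc i) → 0≤c i })
      (solve 1 (λ s → con (ℤ.+ 1) :- s :+ s := con (ℤ.+ 1)) refl (sum c))
      (λ { zero → origin∈P ; (suc i) → Frame.e∈P l i }))
      where
      c : Fin d → Carrier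
      c i = coordinate l i x
      rest : Carrier
      rest = 1# - sum c
      eq : lincomb (rest ∷ᶠ c) (origin ∷ᶠ E l) ≡ x
      eq = dot-ext λ z → begin
        dot (lincomb (rest ∷ᶠ c) (origin ∷ᶠ E l)) z  ≡⟨ dot-lincombˡ (rest ∷ᶠ c) (origin ∷ᶠ E l) z ⟩
        rest * dot origin z + sum (λ i → c i * dot (E l i) z)
          ≡⟨ cong₂ _+_ (trans (cong (rest *_) (dot-originˡ z)) (zeroʳ rest)) (sym (dot-lincombˡ c (E l) z)) ⟩
        0# + dot (lincomb c (E l)) z  ≡⟨ +-identityˡ _ ⟩
        dot (lincomb c (E l)) z  ≡⟨ cong (λ y → dot y z) (Frame.expand l x) ⟩
        dot x z  ∎

  P⇒halfspaces : ∀ {x} → P x → ∀ l → dot (normal l) x ≤ 1#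
  P⇒halfspaces x∈P l = dot-≤ (normal l) 1# (valid-facet l) x∈P

  lattice-coordinate : ∀ l i z → 0# ≤ coordinate l i (embed z) → ∃[ c ] coordinate l i (embed z) ≡ fromℤ (ℤ.+ c)
  lattice-coordinate l i z 0≤c = map₂ (λ eq → trans (embed-dot (Frame.e* l i) z) (cong fromℤ eq))
    (fromℤ-nonneg⁻¹ (ℤ-LA.dot (Frame.e* l i) z) (≤-respects refl (embed-dot (Frame.e* l i) z) 0≤c))

  lattice-height : ∀ {m} l z (0≤c : ∀ i → 0# ≤ coordinate l i (embed z)) → dot (normal l) (embed z) ≡ fromℤ (ℤ.+ m) →
    total (λ i → proj₁ (lattice-coordinate l i z (0≤c i))) ≡ m
  lattice-height {m} l z 0≤c height = ℤ.+-injective (fromℤ-injective (begin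
    fromℤ (ℤ.+ total c)  ≡⟨ fromℤ-total c ⟩
    sum (λ i → fromℤ (ℤ.+ c i))  ≡⟨ sum-cong-≗ (λ i → sym (proj₂ (lattice-coordinate l i z (0≤c i)))) ⟩
    sum (λ i → coordinate l i (embed z))  ≡⟨ Frame.normal-coordinates l (embed z) ⟨
    dot (normal l) (embed z)  ≡⟨ height ⟩
    fromℤ (ℤ.+ m)  ∎))
    where
    c : Fin d → ℕ
    c i = proj₁ (lattice-coordinate l i z (0≤c i))

  module _ (m : ℕ) where
    -- The dilation factor is m + 1, hence positive by construction.
    scale : Carrier
    scale = fromℤ (ℤ.+ ℕ.suc m)

    0<scale : 0# < scale
    0<scale = fromℤ-pos m

    dot-map-* : ∀ (a x : Point d) s → dot a (Vec.map (s *_) x) ≡ s * dot a x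
    dot-map-* a x s = trans
      (sum-cong-≗ λ j → trans (cong (lookup a j *_) (Vec.lookup-map j (s *_) x))
        (solve 3 (λ a s x → a :* (s :* x) := s :* (a :* x)) refl (lookup a j) s (lookup x j)))
      (sym (*-distribˡ-sum s λ j → lookup a j * lookup x j))

    dilate⇒halfspaces : ∀ {y} → dilate (ℕ.suc m) P y → ∀ l → dot (normal l) y ≤ scale
    dilate⇒halfspaces (x , x∈P , refl) l = ≤-respects (sym (dot-map-* (normal l) x scale)) (*-identityʳ scale)
      (*-monoˡ-≤ (<⇒≤ 0<scale) (P⇒halfspaces x∈P l))

    halfspaces⇒dilate : ∀ {y} → (∀ l → dot (normal l) y ≤ scale) → dilate (ℕ.suc m) P y
    halfspaces⇒dilate {y} y≤ = Vec.map (scale ⁻¹ *_) y ,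
      halfspaces⇒P (λ l → *-cancelˡ-≤ 0<scale (≤-respects
        (begin
          dot (normal l) y  ≡⟨ *-identityˡ _ ⟨
          1# * dot (normal l) y  ≡⟨ cong (_* dot (normal l) y) unit ⟨
          scale * scale ⁻¹ * dot (normal l) y  ≡⟨ *-assoc scale _ _ ⟩
          scale * (scale ⁻¹ * dot (normal l) y)  ≡⟨ cong (scale *_) (dot-map-* (normal l) y (scale ⁻¹)) ⟨
          scale * dot (normal l) (Vec.map (scale ⁻¹ *_) y)  ∎)
        (sym (*-identityʳ scale)) (y≤ l))) ,
      point-ext λ j → sym (begin
        lookup (Vec.map (scale *_) (Vec.map (scale ⁻¹ *_) y)) j  ≡⟨ Vec.lookup-map j (scale *_) (Vec.map (scale ⁻¹ *_) y) ⟩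
        scale * lookup (Vec.map (scale ⁻¹ *_) y) j  ≡⟨ cong (scale *_) (Vec.lookup-map j (scale ⁻¹ *_) y) ⟩
        scale * (scale ⁻¹ * lookup y j)  ≡⟨ *-assoc scale _ _ ⟨
        scale * scale ⁻¹ * lookup y j  ≡⟨ cong (_* lookup y j) unit ⟩
        1# * lookup y j  ≡⟨ *-identityˡ _ ⟩
        lookup y j  ∎)
      where
      unit : scale * scale ⁻¹ ≡ 1#
      unit = ⁻¹-inverseʳ (<⇒≢ 0<scale ∘ sym)

    OnBoundary : Point d → Set ℓ
    OnBoundary y = (∀ l → dot (normal l) y ≤ scale) × ∃[ l ] dot (normal l) y ≡ scale

    -- A violated inequality would stay violated in a cube around `y`, against the closure. If no
    -- inequality were tight, the finitely many slacks would leave a common cube inside the dilate.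
    -- Non-interiority is only a negation, so the tight facet comes from a finite search.
    Boundary⇒OnBoundary : ∀ {y} → Boundary (dilate (ℕ.suc m) P) y → OnBoundary y
    Boundary⇒OnBoundary {y} (closure , ¬interior) = y≤ , attained (Fin.any? λ l → dot (normal l) y ≟ scale)
      where
      y≤ : ∀ l → dot (normal l) y ≤ scale
      y≤ l = ≮⇒≥ λ s<ay → excluded (dot-continuous (normal l) y (<⇒0<- s<ay))
        where
        excluded : ¬ (∃[ ε ] 0# < ε × (∀ y′ → Cube y ε y′ → dot (normal l) y - (dot (normal l) y - scale) < dot (normal l) y′))
        excluded (ε , 0<ε , near) = nearby (closure ε 0<ε)
          where
          nearby : ¬ (∃[ y′ ] Cube y ε y′ × dilate (ℕ.suc m) P y′)
          nearby (y′ , close , y′∈) = ≤⇒≯ (dilate⇒halfspaces y′∈ l)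
            (<-respects (solve 2 (λ a s → a :- (a :- s) := s) refl (dot (normal l) y) scale) refl (near y′ close))
      attained : Dec (∃[ l ] dot (normal l) y ≡ scale) → ∃[ l ] dot (normal l) y ≡ scale
      attained (yes found) = found
      attained (no none)   = contradiction (interior (finite-lower-bound (λ l → proj₁ (proj₂ (radius l))))) ¬interior
        where
        radius : ∀ l → ∃[ ε ] 0# < ε × (∀ y′ → Cube y ε y′ → dot (⊝ normal l) y - (scale - dot (normal l) y) < dot (⊝ normal l) y′)
        radius l = dot-continuous (⊝ normal l) y (<⇒0<- (≤∧≢⇒< (y≤ l) λ eq → none (l , eq)))
        interior : ∃[ ε ] 0# < ε × (∀ l → ε ≤ proj₁ (radius l)) → Interior (dilate (ℕ.suc m) P) y
        interior (ε , 0<ε , ε≤) = ε , 0<ε , λ {y′} close → halfspaces⇒dilate λ l →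
          neg-cancel-≤ (≤-respects
            (trans (cong (λ z → z - (scale - dot (normal l) y)) (dot-⊝ˡ (normal l) y))
              (solve 2 (λ a s → :- a :- (s :- a) := :- s) refl (dot (normal l) y) scale))
            (dot-⊝ˡ (normal l) y′)
            (<⇒≤ (proj₂ (proj₂ (radius l)) y′ (cube-mono {x = y} {y = y′} (ε≤ l) close))))

    OnBoundary⇒Boundary : ∀ {y} → OnBoundary y → Boundary (dilate (ℕ.suc m) P) y
    OnBoundary⇒Boundary {y} (y≤ , l , tight) = (λ ε 0<ε → y , center∈Cube y 0<ε , halfspaces⇒dilate y≤) , exterior
      where
      exterior : ¬ Interior (dilate (ℕ.suc m) P) y
      -- Moving along `y` itself increases the tight functional, whose value `scale` at `y` is
      -- positive.
      exterior (ε , 0<ε , cube⊆) = outward (cube-ray y y 0<ε)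
        where
        outward : ¬ (∃[ t ] 0# < t × Cube y ε (y ⊕ t ∙ y))
        outward (t , 0<t , close) = ≤⇒≯ (dilate⇒halfspaces (cube⊆ {y ⊕ t ∙ y} close) l)
          (<-respects (+-identityʳ scale) (sym (trans (dot-⊕∙ʳ (normal l) y t y) (cong (λ z → z + t * z) tight)))
            (+-monoʳ-< scale (*-pos 0<t 0<scale)))

    LatticeCoordinates : Vec ℤ d → Set ℓ
    LatticeCoordinates z = ∃[ l ] Σ[ c ∈ (Fin d → ℕ) ] (∀ i → coordinate l i (embed z) ≡ fromℤ (ℤ.+ c i)) × total c ≡ ℕ.suc m

    -- A lattice point is a non-negative integer combination of the basis of any
    -- cone containing it, and the coefficients add up to its height.
    boundary-lattice-point : ∀ z → OnBoundary (embed z) →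
      LatticeCoordinates z
    boundary-lattice-point z (z≤ , l₀ , tight) = in-cone (enclosing-cone (embed z))
      where
      in-cone : ∃[ l ] (∀ i → 0# ≤ coordinate l i (embed z)) →
        LatticeCoordinates z
      -- The height over `l` is at most m + 1 as the point lies in the dilate. It is at least m + 1
      -- because `normal l₀` has this value and is at most 1 at each `E l i`.
      in-cone (l , 0≤c) = l , (λ i → proj₁ (lattice-coordinate l i z (0≤c i))) , (λ i → proj₂ (lattice-coordinate l i z (0≤c i))) ,
        lattice-height l z 0≤c (≤-antisym (z≤ l) (≤-respects tight (sym (Frame.normal-coordinates l (embed z)))
          (≤-respects (sym (Frame.dot-expand l (normal l₀) (embed z))) refl
            (sum-mono-≤ λ i → ≤-respects refl (*-identityʳ _) (*-monoˡ-≤ (0≤c i) (P⇒halfspaces (Frame.e∈P l i) l₀))))))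

-- Faces as sets of vertices, and the facet assigned to each.

module VertexSets {ℓ} (K : OrderedField ℓ) {d : ℕ} (P : Geometry.Region K d)
                  (smooth : Geometry.IsSmoothPolytope K P) (0<d : 0 ℕ.< d) {N : ℕ}
                  (vertices : HasCardinality (Geometry.latticePoints K (Geometry.Boundary K (Geometry.dilate K 1 P))) N) where
  open OrderedField K
  open OrderedFieldProperties K
  open LinearAlgebraOverField K
  open Geometry K hiding (fromℤ)
  open FacetNormals K P smooth
  open FacetFrames K P smooth 0<d
  open BoundaryPoints K P smooth 0<d
  open Subsets
  open Counting
  open import Data.Nat.Combinatorics using (_C_)
  open ≡-Reasoning

  private module vertices = Inverse vertices

  -- The enumeration that witnesses `b 1` also indexes the vertices, so that faces become subsets of
  -- `Fin N`.
  V : Fin N → Vec ℤ d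
  V i = proj₁ (vertices.to i)

  Vᴷ : Fin N → Point d
  Vᴷ i = embed (V i)

  V-boundary : ∀ i → OnBoundary 0 (Vᴷ i)
  V-boundary i = Boundary⇒OnBoundary 0 {Vᴷ i} (proj₂ (vertices.to i))

  V-injective : ∀ {i j} → V i ≡ V j → i ≡ j
  V-injective {i} {j} eq = trans (sym (vertices.strictlyInverseʳ i))
    (trans (vertices.from-cong {x = vertices.to i} {y = vertices.to j} eq) (vertices.strictlyInverseʳ j))

  vertex-index : ∀ z → OnBoundary 0 (embed z) → ∃[ i ] V i ≡ z
  vertex-index z z∈ = vertices.from (z , OnBoundary⇒Boundary 0 {embed z} z∈) , vertices.strictlyInverseˡ (z , OnBoundary⇒Boundary 0 {embed z} z∈)

  V≤1 : ∀ k l → dot (normal l) (Vᴷ k) ≤ 1#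
  V≤1 k l = ≤-respects refl fromℤ-1 (proj₁ (V-boundary k) l)

  V∈P : ∀ k → P (Vᴷ k)
  V∈P k = halfspaces⇒P (V≤1 k)

  e-boundary : ∀ l i → OnBoundary 0 (E l i)
  e-boundary l i = (λ l′ → ≤-respects refl (sym fromℤ-1) (P⇒halfspaces (Frame.e∈P l i) l′)) , l , trans (Frame.e-tight l i) (sym fromℤ-1)

  abstract
    σ : Fin L → Fin d → Fin N
    σ l i = proj₁ (vertex-index (Frame.e l i) (e-boundary l i))

    V-σ : ∀ l i → Vᴷ (σ l i) ≡ E l i
    V-σ l i = cong embed (proj₂ (vertex-index (Frame.e l i) (e-boundary l i)))

  coordinate-σ : ∀ l i j → coordinate l i (Vᴷ (σ l j)) ≡ δ i j
  coordinate-σ l i j = trans (cong (coordinate l i) (V-σ l j)) (Frame.dual l i j)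

  δ≢0⇒≡ : ∀ {n} {i j : Fin n} → δ i j ≢ 0# → i ≡ j
  δ≢0⇒≡ {i = i} {j} δ≢0 = decide (i Fin.≟ j)
    where
    decide : Dec (i ≡ j) → i ≡ j
    decide (yes i≡j) = i≡j
    decide (no  i≢j) = contradiction (δ-≢ i≢j) δ≢0

  σ-injective : ∀ l {i j} → σ l i ≡ σ l j → i ≡ j
  σ-injective l {i} {j} eq = δ≢0⇒≡ λ δ≡0 → 0≢1 (begin
    0#  ≡⟨ δ≡0 ⟨
    δ i j  ≡⟨ coordinate-σ l i j ⟨
    coordinate l i (Vᴷ (σ l j))  ≡⟨ cong (coordinate l i ∘ Vᴷ) eq ⟨
    coordinate l i (Vᴷ (σ l i))  ≡⟨ coordinate-σ l i i ⟩
    δ i i  ≡⟨ δ-refl i ⟩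
    1#  ∎)

  tight-vertex? : ∀ l k → Dec (dot (normal l) (Vᴷ k) ≡ 1#)
  tight-vertex? l k = dot (normal l) (Vᴷ k) ≟ 1#

  T : Fin L → Subset N
  T l = comprehension (tight-vertex? l)

  T∋⇒tight : ∀ {l k} → T l ∋ k → dot (normal l) (Vᴷ k) ≡ 1#
  T∋⇒tight {l} = ∋-comprehension⁻ (tight-vertex? l)

  tight⇒T∋ : ∀ {l k} → dot (normal l) (Vᴷ k) ≡ 1# → T l ∋ k
  tight⇒T∋ {l} = ∋-comprehension⁺ (tight-vertex? l)

  T∋σ : ∀ l i → T l ∋ σ l i
  T∋σ l i = tight⇒T∋ (trans (cong (dot (normal l)) (V-σ l i)) (Frame.e-tight l i))

  IsUnit : ∀ {n} → (Fin n → ℕ) → Set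
  IsUnit c = ∃[ i ] c i ≡ 1 × (∀ j → j ≢ i → c j ≡ 0)

  unit-composition : ∀ {n} (c : Fin n → ℕ) → total c ≡ 1 → IsUnit c
  unit-composition {ℕ.suc n} c Σ≡1 = split (c zero) refl
    where
    zeros : ∀ {n} (c : Fin n → ℕ) → total c ≡ 0 → ∀ i → c i ≡ 0
    zeros c Σ≡0 zero    = ℕ.m+n≡0⇒m≡0 (c zero) Σ≡0
    zeros c Σ≡0 (suc i) = zeros (c ∘ suc) (ℕ.m+n≡0⇒n≡0 (c zero) Σ≡0) i
    split : ∀ m → c zero ≡ m → IsUnit c
    split 0 eq = shift (unit-composition (c ∘ suc) (trans (cong (ℕ._+ total (c ∘ suc)) (sym eq)) Σ≡1))
      where
      shift : IsUnit (c ∘ suc) → IsUnit c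
      shift (i , c≡1 , others) = suc i , c≡1 , λ { zero _ → eq ; (suc j) j≢i → others j (j≢i ∘ cong suc) }
    split (ℕ.suc m) eq = zero , trans eq (cong ℕ.suc (ℕ.m+n≡0⇒m≡0 m rest≡0)) ,
      λ { zero 0≢0 → contradiction refl 0≢0 ; (suc j) _ → zeros (c ∘ suc) (ℕ.m+n≡0⇒n≡0 m rest≡0) j }
      where
      rest≡0 : m ℕ.+ total (c ∘ suc) ≡ 0
      rest≡0 = ℕ.suc-injective (trans (cong (ℕ._+ total (c ∘ suc)) (sym eq)) Σ≡1)

  abstract
    -- A lattice point on the facet has natural coordinates with sum 1, so it is one of the basis
    -- vectors.
    T∋⇒σ : ∀ l {k} → T l ∋ k → ∃[ i ] σ l i ≡ k
    T∋⇒σ l {k} T∋k = unit (unit-composition c (lattice-height l (V k) 0≤c (trans (T∋⇒tight T∋k) (sym fromℤ-1))))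
      where
      0≤c : ∀ i → 0# ≤ coordinate l i (Vᴷ k)
      0≤c i = Frame.coordinate-nonneg l i (V∈P k) (T∋⇒tight T∋k)
      c : Fin d → ℕ
      c i = proj₁ (lattice-coordinate l i (V k) (0≤c i))
      coordinate≡c : ∀ i → coordinate l i (Vᴷ k) ≡ fromℤ (ℤ.+ c i)
      coordinate≡c i = proj₂ (lattice-coordinate l i (V k) (0≤c i))
      unit : IsUnit c → ∃[ i ] σ l i ≡ k
      unit (i , cᵢ≡1 , others) = i , V-injective (embed-injective (begin
        Vᴷ (σ l i)  ≡⟨ V-σ l i ⟩
        E l i  ≡⟨ lincomb-δ (E l) i ⟨
        lincomb (λ j → δ j i) (E l)  ≡⟨ lincomb-cong {v = E l} (λ j → indicates j (j Fin.≟ i)) (λ _ → refl) ⟩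
        lincomb (λ j → coordinate l j (Vᴷ k)) (E l)  ≡⟨ Frame.expand l (Vᴷ k) ⟩
        Vᴷ k  ∎))
        where
        indicates : ∀ j → Dec (j ≡ i) → δ j i ≡ coordinate l j (Vᴷ k)
        indicates j (yes refl) = trans (δ-refl j) (sym (trans (coordinate≡c j) (trans (cong (fromℤ ∘ ℤ.+_) cᵢ≡1) fromℤ-1)))
        indicates j (no j≢i)   = trans (δ-≢ j≢i) (sym (trans (coordinate≡c j) (cong (fromℤ ∘ ℤ.+_) (others j j≢i))))

  ∣T∣≡d : ∀ l → ∣ T l ∣ ≡ d
  ∣T∣≡d l = ∣∣-unique (T l) (σ l) (σ-injective l) (T∋σ l) (λ _ → T∋⇒σ l)

  -- The boundary complex as an abstract simplicial complex, the empty face included. That each of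
  -- its members is cut out by a hyperplane is the content of `supporting`.
  IsFaceSet : Subset N → Set
  IsFaceSet S = ∃[ l ] (∀ k → S ∋ k → T l ∋ k)

  isFaceSet? : ∀ S → Dec (IsFaceSet S)
  isFaceSet? S = Fin.any? λ l → Fin.all? λ k → (S ∋? k) →-dec (T l ∋? k)

  IsFaceSetOfCorank : ℕ → Subset N → Set
  IsFaceSetOfCorank j S = IsFaceSet S × ∣ S ∣ ℕ.+ j ≡ d

  isFaceSetOfCorank? : ∀ j S → Dec (IsFaceSetOfCorank j S)
  isFaceSetOfCorank? j S = isFaceSet? S ×-dec (∣ S ∣ ℕ.+ j ℕ.≟ d)

  faceCount : ℕ → ℕ
  faceCount j = count (isFaceSetOfCorank? j) (subsets N)

  module Generic (g : Point d) (generic : ∀ l i → coordinate l i g ≢ 0#) where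
    Positive : Fin L → Fin N → Set ℓ
    Positive l k = ∃[ i ] σ l i ≡ k × 0# < coordinate l i g

    positive? : ∀ l k → Dec (Positive l k)
    positive? l k = Fin.any? λ i → (σ l i Fin.≟ k) ×-dec (0# <? coordinate l i g)

    pos : Fin L → Subset N
    pos l = comprehension (positive? l)

    pos⊆T : ∀ l k → pos l ∋ k → T l ∋ k
    pos⊆T l k pos∋k = at (∋-comprehension⁻ (positive? l) pos∋k)
      where
      at : Positive l k → T l ∋ k
      at (i , refl , _) = T∋σ l i

    -- `S` lies in the facet and contains all of its vertices where `g` has no positive coordinate:
    -- an interval of the face lattice with top `T l`.
    Claims : Fin L → Subset N → Set
    Claims l S = ∀ k → Between (lookup (T l) k) (lookup (pos l) k) (lookup S k)

    claims⁺ : ∀ l S → (∀ k → S ∋ k → T l ∋ k) → (∀ k → T l ∋ k → S ∋ k ⊎ pos l ∋ k) → Claims l S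
    claims⁺ l S S⊆T T⊆S⊎pos k = between⁺ (lookup (T l) k) (lookup (pos l) k) (lookup S k) (S⊆T k) (T⊆S⊎pos k)

    claims⇒⊆T : ∀ l S → Claims l S → ∀ k → S ∋ k → T l ∋ k
    claims⇒⊆T l S claims k = between⇒⊆ (lookup (T l) k) (lookup (pos l) k) (lookup S k) (claims k)

    claims⇒positive : ∀ l S → Claims l S → ∀ i → S ∋ σ l i ⊎ 0# < coordinate l i g
    claims⇒positive l S claims i = decide (lookup (pos l) (σ l i)) refl
      where
      decide : ∀ q → lookup (pos l) (σ l i) ≡ q → S ∋ σ l i ⊎ 0# < coordinate l i g
      decide false eq = inj₁ (subst₂ (λ f q → Between f q (lookup S (σ l i))) (T∋σ l i) eq (claims (σ l i)))
      decide true  eq = inj₂ (at (∋-comprehension⁻ (positive? l) eq))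
        where
        at : Positive l (σ l i) → 0# < coordinate l i g
        at (j , σj≡σi , 0<c) = subst (λ j → 0# < coordinate l j g) (σ-injective l σj≡σi) 0<c

    -- At the maximal facet through `S`, a nonnegative coordinate of `g` is positive by genericity,
    -- and an exempted coordinate belongs to a vertex in `S`.
    claimed : ∀ S → IsFaceSet S → ∃[ l ] Claims l S
    claimed S (l₀ , S⊆T) = from-maximal (maximal-facet (Vᴷ ∘ element S) l₀ (λ j → T∋⇒tight (S⊆T _ (∋-element S j))) g)
      where
      from-maximal : MaximalFacet (Vᴷ ∘ element S) g → ∃[ l ] Claims l S
      from-maximal (l , tight , choice) = l , claims⁺ l S S⊆T′ (λ k T∋k → at k (T∋⇒σ l T∋k))
        where
        S⊆T′ : ∀ k → S ∋ k → T l ∋ k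
        S⊆T′ k S∋k = at-element (element-surjective S S∋k)
          where
          at-element : ∃[ j ] element S j ≡ k → T l ∋ k
          at-element (j , refl) = tight⇒T∋ (tight j)
        at : ∀ k → ∃[ i ] σ l i ≡ k → S ∋ k ⊎ pos l ∋ k
        at k (i , refl) = choose (choice i)
          where
          choose : 0# ≤ coordinate l i g ⊎ ∃[ j ] coordinate l i (Vᴷ (element S j)) ≢ 0# → S ∋ σ l i ⊎ pos l ∋ σ l i
          choose (inj₁ 0≤c)       = inj₂ (∋-comprehension⁺ (positive? l) (i , refl , ≤∧≢⇒< 0≤c (generic l i ∘ sym)))
          choose (inj₂ (j , c≢0)) = inj₁ (located (T∋⇒σ l (S⊆T′ _ (∋-element S j))))
            where
            located : ∃[ i′ ] σ l i′ ≡ element S j → S ∋ σ l i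
            located (i′ , eq) = subst (S ∋_) (trans (sym eq) (cong (σ l) (sym (δ≢0⇒≡ (subst (_≢ 0#) (trans (cong (coordinate l i ∘ Vᴷ) (sym eq)) (coordinate-σ l i i′)) c≢0))))) (∋-element S j)

    -- Both normals attain their common maximum at g.
    claimed-once : ∀ S l l′ → Claims l S → Claims l′ S → l ≡ l′
    claimed-once S l l′ claims claims′ = normal-injective (dot-ext λ x → sym (begin
      dot (normal l′) x  ≡⟨ Frame.dot-expand l (normal l′) x ⟩
      sum (λ i → coordinate l i x * dot (normal l′) (E l i))
        ≡⟨ sum-cong-≗ (λ i → trans (cong (coordinate l i x *_) (tight′ i (claims⇒positive l S claims i))) (*-identityʳ _)) ⟩
      sum (λ i → coordinate l i x)  ≡⟨ Frame.normal-coordinates l x ⟨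
      dot (normal l) x  ∎))
      where
      E-tight : ∀ m m′ → Claims m′ S → ∀ i → S ∋ σ m i → dot (normal m′) (E m i) ≡ 1#
      E-tight m m′ claims′ i S∋σ = trans (cong (dot (normal m′)) (sym (V-σ m i))) (T∋⇒tight (claims⇒⊆T m′ S claims′ _ S∋σ))
      terms : ∀ m m′ → Claims m S → Claims m′ S → ∀ i → coordinate m i g * dot (normal m′) (E m i) ≤ coordinate m i g
      terms m m′ claims claims′ i = Sum.[ (λ S∋σ → ≤-reflexive (trans (cong (coordinate m i g *_) (E-tight m m′ claims′ i S∋σ)) (*-identityʳ _)))
        , (λ 0<c → ≤-respects refl (*-identityʳ _) (*-monoˡ-≤ (<⇒≤ 0<c) (P⇒halfspaces (Frame.e∈P m i) m′))) ]′ (claims⇒positive m S claims i)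
      g≤ : ∀ m m′ → Claims m S → Claims m′ S → dot (normal m′) g ≤ dot (normal m) g
      g≤ m m′ claims claims′ = ≤-respects (sym (Frame.dot-expand m (normal m′) g)) (sym (Frame.normal-coordinates m g))
        (sum-mono-≤ (terms m m′ claims claims′))
      -- The two normals agree at `g`, so the termwise inequalities are equalities. Where `g` has a
      -- positive coordinate, `normal l′` must therefore be 1 at `E l i`.
      same-terms : ∀ i → coordinate l i g * dot (normal l′) (E l i) ≡ coordinate l i g
      same-terms = sum-mono-≡ (terms l l′ claims claims′) (trans (sym (Frame.dot-expand l (normal l′) g))
        (trans (≤-antisym (g≤ l l′ claims claims′) (g≤ l′ l claims′ claims)) (Frame.normal-coordinates l g)))
      tight′ : ∀ i → S ∋ σ l i ⊎ 0# < coordinate l i g → dot (normal l′) (E l i) ≡ 1#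
      tight′ i (inj₁ S∋σ) = E-tight l l′ claims′ i S∋σ
      tight′ i (inj₂ 0<c) = x-y≡0⇒x≡y (*-zero-or (trans
        (solve 2 (λ c x → c :* (x :- con (ℤ.+ 1)) := c :* x :- c) refl (coordinate l i g) (dot (normal l′) (E l i)))
        (trans (cong (λ z → z - coordinate l i g) (same-terms i)) (-‿inverseʳ _))) (<⇒≢ 0<c ∘ sym))

    -- Grouped by the value of `∣ pos l ∣`, this is the expression of the f-vector by the h-vector,
    -- Σ h_i C(i, j).
    faceCount≡sum : ∀ j → faceCount j ≡ sumList (λ l → ∣ pos l ∣ C j) (List.allFin L)
    faceCount≡sum j = trans
      (double-count (isFaceSetOfCorank? j) (λ S l → intervalOfCorank? (T l) (pos l) j S) (Unique.allFin⁺ L)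
        (λ S (isFace , ∣S∣+j≡d) → map₂ (λ {l} claims → ∈-allFin l , claims , trans ∣S∣+j≡d (sym (∣T∣≡d l))) (claimed S isFace))
        (λ S {l} _ (claims , ∣S∣+j≡) → (l , claims⇒⊆T l S claims) , trans ∣S∣+j≡ (∣T∣≡d l))
        (λ S {l} {l′} _ _ (claims , _) (claims′ , _) → claimed-once S l l′ claims claims′)
        (subsets N))
      (sumList-cong (List.allFin L) λ l _ → count-interval (T l) (pos l) (pos⊆T l) j)

  IsGeneric : Point d → Set ℓ
  IsGeneric g = ∀ l i → coordinate l i g ≢ 0#

  -- As `dot` is symmetric, the point may be found as a functional generic for the dual vectors. No
  -- signs are to be kept, so the perturbation starts at `origin`.
  generic-point : ∃ IsGeneric
  generic-point = map₂ (λ {g} (nonzero , _) → separate g nonzero) (generic-functional origin duals)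
    where
    duals : Fin (L ℕ.* d) → Point d
    duals r = embed (Frame.e* (proj₁ (remQuot {L} d r)) (proj₂ (remQuot {L} d r)))
    duals-combine : ∀ l i → duals (combine {L} {d} l i) ≡ embed (Frame.e* l i)
    duals-combine l i = cong (λ s → embed (Frame.e* (proj₁ s) (proj₂ s))) (Fin.remQuot-combine {L} {d} l i)
    dual≢origin : ∀ l i → embed (Frame.e* l i) ≢ origin
    dual≢origin l i eq = 0≢1 (begin
      0#  ≡⟨ dot-originˡ (E l i) ⟨
      dot origin (E l i)  ≡⟨ cong (λ x → dot x (E l i)) eq ⟨
      coordinate l i (E l i)  ≡⟨ Frame.dual l i i ⟩
      δ i i  ≡⟨ δ-refl i ⟩
      1#  ∎)
    separate : ∀ g → (∀ r → duals r ≢ origin → dot g (duals r) ≢ 0#) → IsGeneric g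
    separate g nonzero l i c≡0 = nonzero (combine {L} {d} l i) (dual≢origin l i ∘ trans (sym (duals-combine l i))) (begin
      dot g (duals (combine {L} {d} l i))  ≡⟨ cong (dot g) (duals-combine l i) ⟩
      dot g (embed (Frame.e* l i))  ≡⟨ dot-comm g (embed (Frame.e* l i)) ⟩
      coordinate l i g  ≡⟨ c≡0 ⟩
      0#  ∎)

  module Opposite (g : Point d) (generic : IsGeneric g) where
    coordinate-⊝ : ∀ l i → coordinate l i (⊝ g) ≡ - coordinate l i g
    coordinate-⊝ l i = dot-⊝ʳ (embed (Frame.e* l i)) g

    generic-⊝ : IsGeneric (⊝ g)
    generic-⊝ l i eq = generic l i (begin
      coordinate l i g  ≡⟨ solve 1 (λ x → x := :- :- x) refl _ ⟩
      - - coordinate l i g  ≡⟨ cong -_ (trans (sym (coordinate-⊝ l i)) eq) ⟩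
      - 0#  ≡⟨ solve 0 (:- con (ℤ.+ 0) := con (ℤ.+ 0)) refl ⟩
      0#  ∎)

    module G⁺ = Generic g generic
    module G⁻ = Generic (⊝ g) generic-⊝

    ∣pos∣+∣neg∣≡d : ∀ l → ∣ G⁺.pos l ∣ ℕ.+ ∣ G⁻.pos l ∣ ≡ d
    ∣pos∣+∣neg∣≡d l = trans (∣∣-split (T l) (G⁺.pos l) (G⁻.pos l) (λ k T∋k → inside (T∋⇒σ l T∋k))
        (λ k T∌k → T∌k ∘ G⁺.pos⊆T l k , T∌k ∘ G⁻.pos⊆T l k)) (∣T∣≡d l)
      where
      exclusive : ∀ {k} → ¬ (G⁺.Positive l k × G⁻.Positive l k)
      exclusive ((i , refl , 0<c) , (j , eq , 0<-c)) = <-asym 0<c (subst (λ j → coordinate l j g < 0#) (σ-injective l eq)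
        (<-respects (solve 1 (λ x → :- :- x := x) refl _) refl (pos-neg (<-respects refl (coordinate-⊝ l j) 0<-c))))
      inside : ∀ {k} → ∃[ i ] σ l i ≡ k → (G⁺.pos l ∋ k × ¬ G⁻.pos l ∋ k) ⊎ (G⁻.pos l ∋ k × ¬ G⁺.pos l ∋ k)
      inside {k} (i , σi≡k) = sign (compare (coordinate l i g) 0#)
        where
        sign : Tri (coordinate l i g < 0#) (coordinate l i g ≡ 0#) (0# < coordinate l i g) →
          (G⁺.pos l ∋ k × ¬ G⁻.pos l ∋ k) ⊎ (G⁻.pos l ∋ k × ¬ G⁺.pos l ∋ k)
        sign (tri> _ _ 0<c) = inj₁ (∋-comprehension⁺ (G⁺.positive? l) positive ,
          λ ∋k → exclusive (positive , ∋-comprehension⁻ (G⁻.positive? l) ∋k))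
          where
          positive : G⁺.Positive l k
          positive = i , σi≡k , 0<c
        sign (tri≈ _ c≡0 _) = contradiction c≡0 (generic l i)
        sign (tri< c<0 _ _) = inj₂ (∋-comprehension⁺ (G⁻.positive? l) negative ,
          λ ∋k → exclusive (∋-comprehension⁻ (G⁺.positive? l) ∋k , negative))
          where
          negative : G⁻.Positive l k
          negative = i , σi≡k , <-respects refl (sym (coordinate-⊝ l i)) (neg-pos c<0)

  face-relation : ∀ {m} (as bs : Vec ℕ m) →
    (∀ k l → k ℕ.+ l ≡ d → combination as (k C_) ℕ.+ combination as (l C_) ≡ combination bs (k C_) ℕ.+ combination bs (l C_)) →
    combination as faceCount ≡ combination bs faceCount
  face-relation as bs = linear-relation as bs faceCount (∣_∣ ∘ G⁺.pos) (∣_∣ ∘ G⁻.pos) (List.allFin L)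
    G⁺.faceCount≡sum G⁻.faceCount≡sum (λ l _ → ∣pos∣+∣neg∣≡d l)
    where open Opposite (proj₁ generic-point) (proj₂ generic-point)

  ∣∅∣≡0 : ∀ {n} → ∣ Subset.⊥ {n} ∣ ≡ 0
  ∣∅∣≡0 {ℕ.zero}  = refl
  ∣∅∣≡0 {ℕ.suc n} = ∣∅∣≡0 {n}

  -- At corank `d` only the empty set remains. This number is the source of the constant terms in
  -- the final formulas.
  faceCount-d : faceCount d ≡ 1
  faceCount-d = count-one (isFaceSetOfCorank? d) (subsets-unique N) (∈-subsets Subset.⊥)
    ((someFacet , λ k ∅∋k → contradiction (trans (sym (Vec.lookup-replicate k false)) ∅∋k) λ ()) , cong (ℕ._+ d) (∣∅∣≡0 {N}))
    λ {S} _ (_ , ∣S∣+d≡d) → subset-ext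
      (λ k S∋k → contradiction (element-of S S∋k (ℕ.+-cancelʳ-≡ d ∣ S ∣ 0 ∣S∣+d≡d)) λ ())
      (λ k ∅∋k → contradiction (trans (sym (Vec.lookup-replicate k false)) ∅∋k) λ ())
    where
    element-of : ∀ (S : Subset N) {k} → S ∋ k → ∣ S ∣ ≡ 0 → Fin 0
    element-of S S∋k ∣S∣≡0 = subst Fin ∣S∣≡0 (proj₁ (element-surjective S S∋k))

-- Geometric faces and their vertex sets.

module FacesAndLatticePoints {ℓ} (K : OrderedField ℓ) {d : ℕ} (P : Geometry.Region K d)
                  (smooth : Geometry.IsSmoothPolytope K P) (0<d : 0 ℕ.< d) {N : ℕ}
                  (vertices : HasCardinality (Geometry.latticePoints K (Geometry.Boundary K (Geometry.dilate K 1 P))) N) where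
  open OrderedField K
  open OrderedFieldProperties K
  open LinearAlgebraOverField K
  open Geometry K hiding (fromℤ)
  open IsSmoothPolytope smooth
  open FacetNormals K P smooth
  open FacetFrames K P smooth 0<d
  open BoundaryPoints K P smooth 0<d
  open VertexSets K P smooth 0<d vertices
  open Subsets
  open Counting
  open ≡-Reasoning

  valid-V : ∀ {a} → IsValid a → ∀ k → dot a (Vᴷ k) ≤ 1#
  valid-V {a} valid k = dot-≤ a 1# valid (V∈P k)

  FaceCone : Point d → Point d → Set ℓ
  FaceCone a x = ∃[ l ] (∀ i → coordinate l i x ≡ 0# ⊎ dot a (E l i) ≡ 1#) × sum (λ i → coordinate l i x) ≡ 1#

  -- For coordinates c of `x` in an enclosing cone, 1 = a · x = Σ c i (a · E l i) ≤ Σ c i ≤ 1.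
  -- Equality leaves weight only on vertices of the face, so the face is the convex hull of its
  -- lattice vertices.
  face-cone : ∀ a {x} → IsValid a → Face a x →
    FaceCone a x
  face-cone a {x} valid (x∈P , tight) = in-cone (enclosing-cone x)
    where
    in-cone : ∃[ l ] (∀ i → 0# ≤ coordinate l i x) →
      FaceCone a x
    in-cone (l , 0≤c) = l , weighted-≡ {g = λ i → dot a (E l i)} 0≤c Σ≡1 (λ i → inj₂ (a≤1 i)) (trans (sym (Frame.dot-expand l a x)) tight) , Σ≡1
      where
      a≤1 : ∀ i → dot a (E l i) ≤ 1#
      a≤1 i = dot-≤ a 1# valid (Frame.e∈P l i)
      Σ≡1 : sum (λ i → coordinate l i x) ≡ 1#
      Σ≡1 = ≤-antisym (≤-respects (Frame.normal-coordinates l x) refl (P⇒halfspaces x∈P l))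
        (≤-respects (trans (sym (Frame.dot-expand l a x)) tight) refl
          (sum-mono-≤ λ i → ≤-respects refl (*-identityʳ _) (*-monoˡ-≤ (0≤c i) (a≤1 i))))

  E-tight⇒ : ∀ a l i → dot a (E l i) ≡ 1# → dot a (Vᴷ (σ l i)) ≡ 1#
  E-tight⇒ a l i = trans (cong (dot a) (V-σ l i))

  Face-mono : ∀ a a′ → IsValid a → (∀ k → dot a (Vᴷ k) ≡ 1# → dot a′ (Vᴷ k) ≡ 1#) → ∀ {x} → Face a x → Face a′ x
  Face-mono a a′ valid tight {x} x∈@(x∈P , _) = x∈P , in-cone (face-cone a valid x∈)
    where
    in-cone : FaceCone a x → dot a′ x ≡ 1#
    in-cone (l , support , Σ≡1) = begin
      dot a′ x  ≡⟨ Frame.dot-expand l a′ x ⟩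
      sum (λ i → coordinate l i x * dot a′ (E l i))  ≡⟨ sum-cong-≗ (λ i → term i (support i)) ⟩
      sum (λ i → coordinate l i x)  ≡⟨ Σ≡1 ⟩
      1#  ∎
      where
      term : ∀ i → coordinate l i x ≡ 0# ⊎ dot a (E l i) ≡ 1# → coordinate l i x * dot a′ (E l i) ≡ coordinate l i x
      term i (inj₁ c≡0) = trans (cong (_* dot a′ (E l i)) c≡0) (trans (zeroˡ _) (sym c≡0))
      term i (inj₂ tightᵢ) = trans (cong (coordinate l i x *_) (trans (cong (dot a′) (sym (V-σ l i))) (tight (σ l i) (E-tight⇒ a l i tightᵢ)))) (*-identityʳ _)

  verticesOf : ∀ (S : Subset N) → Fin ∣ S ∣ → Point d
  verticesOf S = Vᴷ ∘ element S

  -- The vertices in `S` belong to the basis of one facet; the coordinate of each isolates its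
  -- coefficient.
  verticesOf-independent : ∀ S → IsFaceSet S → LinearlyIndependent (verticesOf S)
  verticesOf-independent S (l , S⊆T) c eq j = begin
    c j  ≡⟨ *-identityʳ (c j) ⟨
    c j * 1#  ≡⟨ cong (c j *_) (trans (coordinate-at (at j) j) (δ-refl (at j))) ⟨
    c j * coordinate l (at j) (verticesOf S j)
      ≡⟨ sum-single (λ j′ → c j′ * coordinate l (at j) (verticesOf S j′)) j (λ j′ j′≢j → trans (cong (c j′ *_)
           (trans (coordinate-at (at j) j′) (δ-≢ λ eq → j′≢j (at-injective (sym eq))))) (zeroʳ _)) ⟨
    sum (λ j′ → c j′ * coordinate l (at j) (verticesOf S j′))  ≡⟨ dot-lincombʳ (embed (Frame.e* l (at j))) c (verticesOf S) ⟨
    coordinate l (at j) (lincomb c (verticesOf S))  ≡⟨ cong (coordinate l (at j)) eq ⟩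
    coordinate l (at j) origin  ≡⟨ dot-originʳ (embed (Frame.e* l (at j))) ⟩
    0#  ∎
    where
    located : ∀ j → ∃[ i ] σ l i ≡ element S j
    located j = T∋⇒σ l (S⊆T _ (∋-element S j))
    at : Fin ∣ S ∣ → Fin d
    at j = proj₁ (located j)
    at-injective : ∀ {i j} → at i ≡ at j → i ≡ j
    at-injective {i} {j} eq = element-injective S (trans (sym (proj₂ (located i))) (trans (cong (σ l) eq) (proj₂ (located j))))
    coordinate-at : ∀ i j → coordinate l i (verticesOf S j) ≡ δ i (at j)
    coordinate-at i j = trans (cong (coordinate l i ∘ Vᴷ) (sym (proj₂ (located j)))) (coordinate-σ l i (at j))

  Face⊆span : ∀ a S → IsValid a → (∀ k → dot a (Vᴷ k) ≡ 1# → S ∋ k) → ∀ {x} → Face a x → InSpan (verticesOf S) x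
  Face⊆span a S valid tight⇒S {x} x∈ = in-cone (face-cone a valid x∈)
    where
    in-cone : FaceCone a x → InSpan (verticesOf S) x
    in-cone (l , support , _) = subst (InSpan (verticesOf S)) eq (InSpan-lincomb (verticesOf S) u∈ (λ i → coordinate l i x))
      where
      choose : ∀ i → Dec (S ∋ σ l i) → Point d
      choose i (yes _) = E l i
      choose i (no  _) = origin
      u : Fin d → Point d
      u i = choose i (S ∋? σ l i)
      choose∈ : ∀ i S∋σ? → InSpan (verticesOf S) (choose i S∋σ?)
      choose∈ i (no  _)   = (λ _ → 0#) , lincomb-zero (verticesOf S) (λ _ → refl)
      choose∈ i (yes S∋σ) = subst (InSpan (verticesOf S)) (trans (cong Vᴷ (proj₂ (element-surjective S S∋σ))) (V-σ l i))
                              (InSpan-∋ (verticesOf S) (proj₁ (element-surjective S S∋σ)))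
      u∈ : ∀ i → InSpan (verticesOf S) (u i)
      u∈ i = choose∈ i (S ∋? σ l i)
      choose≡E : ∀ i S∋σ? → S ∋ σ l i → choose i S∋σ? ≡ E l i
      choose≡E i (yes _)   S∋σ = refl
      choose≡E i (no ¬S∋σ) S∋σ = contradiction S∋σ ¬S∋σ
      dot-u : ∀ z i → coordinate l i x ≡ 0# ⊎ dot a (E l i) ≡ 1# → coordinate l i x * dot (u i) z ≡ coordinate l i x * dot (E l i) z
      dot-u z i (inj₁ c≡0) = trans (trans (cong (_* dot (u i) z) c≡0) (zeroˡ _)) (sym (trans (cong (_* dot (E l i) z) c≡0) (zeroˡ _)))
      dot-u z i (inj₂ tight) = cong (λ y → coordinate l i x * dot y z) (choose≡E i (S ∋? σ l i) (tight⇒S (σ l i) (E-tight⇒ a l i tight)))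
      eq : lincomb (λ i → coordinate l i x) u ≡ x
      eq = dot-ext λ z → begin
        dot (lincomb (λ i → coordinate l i x) u) z  ≡⟨ dot-lincombˡ (λ i → coordinate l i x) u z ⟩
        sum (λ i → coordinate l i x * dot (u i) z)  ≡⟨ sum-cong-≗ (λ i → dot-u z i (support i)) ⟩
        sum (λ i → coordinate l i x * dot (E l i) z)  ≡⟨ dot-lincombˡ (λ i → coordinate l i x) (E l) z ⟨
        dot (lincomb (λ i → coordinate l i x) (E l)) z  ≡⟨ cong (λ y → dot y z) (Frame.expand l x) ⟩
        dot x z  ∎

  Supports : Point d → Subset N → Set ℓ
  Supports a S = (∀ k → S ∋ k → dot a (Vᴷ k) ≡ 1#) × (∀ k → dot a (Vᴷ k) ≡ 1# → S ∋ k)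

  Face-independent-≤ : ∀ a S → IsValid a → Supports a S → ∀ {m} (q : Fin m → Point d) → AffinelyIndependent q → (∀ i → Face a (q i)) → m ℕ.≤ ∣ S ∣
  Face-independent-≤ a S valid (_ , tight⇒S) q indep q∈ = independent-in-span⇒≤ {q = q} {verticesOf S}
    (affine⇒linear a q (proj₂ ∘ q∈) indep) (λ i → Face⊆span a S valid tight⇒S (q∈ i))

  Face-dimension : ∀ {k} a S → IsValid a → Supports a S → IsFaceSet S → ∣ S ∣ ≡ ℕ.suc k → HasDim (Face a) k
  Face-dimension {k} a S valid supports isFace ∣S∣≡1+k = record
    { attained = points ∣S∣≡1+k
    ; maximal  = λ q indep q∈ → subst (_ ℕ.≤_) ∣S∣≡1+k (Face-independent-≤ a S valid supports q indep q∈)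
    }
    where
    points : ∀ {m} → ∣ S ∣ ≡ m → Σ[ q ∈ (Fin m → Point d) ] AffinelyIndependent q × (∀ i → Face a (q i))
    points refl = verticesOf S , (λ c _ → verticesOf-independent S isFace c) , λ j → V∈P _ , proj₁ supports _ (∋-element S j)

  Face-dimension⁻ : ∀ {k} a S → IsValid a → Supports a S → IsFaceSet S → HasDim (Face a) k → ∣ S ∣ ≡ ℕ.suc k
  Face-dimension⁻ a S valid supports isFace dim = ℕ.≤-antisym
    (HasDim.maximal dim (verticesOf S) (λ c _ → verticesOf-independent S isFace c) (λ j → V∈P _ , proj₁ supports _ (∋-element S j)))
    (Face-independent-≤ a S valid supports (proj₁ (HasDim.attained dim)) (proj₁ (proj₂ (HasDim.attained dim))) (proj₂ (proj₂ (HasDim.attained dim))))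

  HasDim-cong : ∀ {k} {F G : Region d} → (∀ {x} → F x → G x) → (∀ {x} → G x → F x) → HasDim F k → HasDim G k
  HasDim-cong F⊆G G⊆F dim = record
    { attained = map₂ (map₂ λ q∈F i → F⊆G (q∈F i)) (HasDim.attained dim)
    ; maximal  = λ q indep q∈G → HasDim.maximal dim q indep λ i → G⊆F (q∈G i)
    }

  -- Tilt the facet l slightly away from its vertices outside S.
  abstract
    supporting : ∀ S → IsFaceSet S → ∃[ a ] IsValid a × Supports a S
    supporting S (l , S⊆T) = tilt (small-perturbation (λ i → 1# - dot (normal l) (p i)) (λ i → dot u (p i)))
      where
      χ : Fin d → Carrier
      χ i = if lookup S (σ l i) then 0# else 1#
      0≤χ : ∀ i → 0# ≤ χ i
      0≤χ i = at (lookup S (σ l i))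
        where
        at : ∀ b → 0# ≤ (if b then 0# else 1#)
        at true  = ≤-refl
        at false = <⇒≤ 0<1
      E* : Fin d → Point d
      E* i = embed (Frame.e* l i)
      u : Point d
      -- The sum of the dual vectors of the facet's vertices outside `S`: 0 at the vertices in `S`
      -- and 1 at the others. Subtracting a small multiple lowers exactly the latter.
      u = lincomb χ E*
      u-E : ∀ i → dot u (E l i) ≡ χ i
      u-E i = trans (dot-lincombˡ χ E* (E l i)) (trans (sum-cong-≗ λ j → trans (cong (χ j *_) (Frame.dual l j i)) (*-comm (χ j) (δ j i))) (sum-δ χ i))
      u-nonneg : ∀ j → dot (normal l) (p j) ≡ 1# → 0# ≤ dot u (p j)
      u-nonneg j tight = ≤-respects refl (sym (dot-lincombˡ χ E* (p j)))
        (sum-nonneg λ i → *-nonneg (0≤χ i) (Frame.coordinate-nonneg l i (p∈P j) tight))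
      tilt : ∃[ ε ] 0# < ε × (∀ η → 0# < η → η ≤ ε → ∀ i → 0# < 1# - dot (normal l) (p i) → 0# < 1# - dot (normal l) (p i) + η * dot u (p i)) →
             ∃[ a ] IsValid a × Supports a S
      tilt (ε , 0<ε , small) = a , valid , S⇒tight , λ k tight → tight⇒S k tight (T∋⇒σ l (tight⇒T∋ (dot-≡-on-face a (normal l) 1# valid tight⇒tight (V∈P k) tight)))
        where
        a : Point d
        a = normal l ⊕ - ε ∙ u
        dot-a : ∀ x → dot a x ≡ dot (normal l) x - ε * dot u x
        dot-a x = trans (dot-⊕∙ˡ (normal l) (- ε) u x) (solve 3 (λ y e z → y :+ :- e :* z := y :- e :* z) refl (dot (normal l) x) ε (dot u x))
        strict : ∀ j → dot (normal l) (p j) ≢ 1# → dot a (p j) < 1#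
        strict j ≢1 = ≤-<-trans (≤-reflexive (dot-a (p j))) (0<-⇒< (<-respects refl
          (solve 2 (λ y z → con (ℤ.+ 1) :- y :+ z := con (ℤ.+ 1) :- (y :- z)) refl (dot (normal l) (p j)) (ε * dot u (p j)))
          (small ε 0<ε ≤-refl j (<⇒0<- (≤∧≢⇒< (valid-facet l j) ≢1)))))
        valid : IsValid a
        valid j = decide (tight? (normal l) j)
          where
          decide : Dec (dot (normal l) (p j) ≡ 1#) → dot a (p j) ≤ 1#
          decide (no ≢1)     = <⇒≤ (strict j ≢1)
          decide (yes tight) = ≤-respects (sym (dot-a (p j))) refl (0≤-⇒≤ (≤-respects refl
            (trans (solve 2 (λ x z → z := x :- (x :- z)) refl (dot (normal l) (p j)) (ε * dot u (p j))) (cong (λ z → z - (dot (normal l) (p j) - ε * dot u (p j))) tight))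
            (*-nonneg (<⇒≤ 0<ε) (u-nonneg j tight))))
        tight⇒tight : ∀ j → dot a (p j) ≡ 1# → dot (normal l) (p j) ≡ 1#
        tight⇒tight j tight = decide (tight? (normal l) j)
          where
          decide : Dec (dot (normal l) (p j) ≡ 1#) → dot (normal l) (p j) ≡ 1#
          decide (yes tightₗ) = tightₗ
          decide (no ≢1)      = contradiction tight (<⇒≢ (strict j ≢1))
        a-V : ∀ i → dot a (Vᴷ (σ l i)) ≡ 1# - ε * χ i
        a-V i = trans (cong (dot a) (V-σ l i)) (trans (dot-a (E l i)) (cong₂ (λ x y → x - ε * y) (Frame.e-tight l i) (u-E i)))
        S⇒tight : ∀ k → S ∋ k → dot a (Vᴷ k) ≡ 1#
        S⇒tight k S∋k = at (T∋⇒σ l (S⊆T k S∋k))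
          where
          at : ∃[ i ] σ l i ≡ k → dot a (Vᴷ k) ≡ 1#
          at (i , refl) = trans (a-V i) (trans (cong (λ b → 1# - ε * (if b then 0# else 1#)) S∋k)
            (solve 1 (λ e → con (ℤ.+ 1) :- e :* con (ℤ.+ 0) := con (ℤ.+ 1)) refl ε))
        tight⇒S : ∀ k → dot a (Vᴷ k) ≡ 1# → ∃[ i ] σ l i ≡ k → S ∋ k
        tight⇒S k tight (i , refl) = at (lookup S (σ l i)) refl
          where
          at : ∀ b → lookup S (σ l i) ≡ b → lookup S (σ l i) ≡ true
          at true  eq = eq
          at false eq = contradiction (trans (sym (trans (a-V i) (trans (cong (λ b → 1# - ε * (if b then 0# else 1#)) eq) (cong (λ z → 1# - z) (*-identityʳ ε))))) tight)
            (<⇒≢ (0<-⇒< (<-respects refl (solve 1 (λ e → e := con (ℤ.+ 1) :- (con (ℤ.+ 1) :- e)) refl ε) 0<ε)))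

  Normalization : Region d → Set ℓ
  Normalization F = ∃[ a ] IsValid a × (∀ {x} → F x → Face a x) × (∀ {x} → Face a x → F x)

  abstract
    -- The constant is nonnegative since the origin is in `P`. If it is 0, the functional is
    -- nonpositive on `P` and so zero, the origin being interior; then the face is all of `P`, whose
    -- dimension is too large. Otherwise one divides by it.
    normalize-face : ∀ {k} {F : Region d} → k ℕ.< d → IsFace P F → HasDim F k →
      Normalization F
    normalize-face {k} {F} k<d (h , c , bound , F⊆ , ⊆F) dim = by-sign (compare 0# c)
      where
      0≤c : 0# ≤ c
      0≤c = ≤-respects (dot-originʳ h) refl (bound origin origin∈P)
      by-sign : Tri (0# < c) (0# ≡ c) (c < 0#) → Normalization F
      by-sign (tri> _ _ c<0) = contradiction c<0 (≤⇒≯ 0≤c)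
      by-sign (tri≈ _ 0≡c _) = contradiction
          (HasDim.maximal dim q (proj₁ (proj₂ (HasDim.attained fullDimensional)))
            (λ i → ⊆F (proj₂ (proj₂ (HasDim.attained fullDimensional)) i , trans (cong (λ h → dot h (q i)) h≡0) (trans (dot-originˡ (q i)) 0≡c))))
          (ℕ.<⇒≱ (ℕ.s≤s k<d))
        where
        q : Fin (ℕ.suc d) → Point d
        q = proj₁ (HasDim.attained fullDimensional)
        h≡0 : h ≡ origin
        h≡0 = decide (h ≟ᴾ origin)
          where
          decide : Dec (h ≡ origin) → h ≡ origin
          decide (yes eq) = eq
          decide (no neq) = contradiction (positive-somewhere h neq) λ (i , 0<h) → ≤⇒≯ (≤-respects refl (sym 0≡c) (bound (p i) (p∈P i))) 0<h
      by-sign (tri< 0<c _ _) = a , (λ i → *-cancelˡ-≤ 0<c (≤-respects (sym (c-dot-a (p i))) (sym (*-identityʳ c)) (bound (p i) (p∈P i)))) ,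
        (λ {x} x∈F → proj₁ (F⊆ x∈F) , x-y≡0⇒x≡y (*-zero-or (trans (solve 2 (λ c y → c :* (y :- con (ℤ.+ 1)) := c :* y :- c) refl c (dot a x))
          (trans (cong (λ z → z - c) (trans (c-dot-a x) (proj₂ (F⊆ x∈F)))) (-‿inverseʳ c))) (<⇒≢ 0<c ∘ sym))) ,
        (λ {x} (x∈P , tight) → ⊆F (x∈P , trans (sym (c-dot-a x)) (trans (cong (c *_) tight) (*-identityʳ c))))
        where
        a : Point d
        a = origin ⊕ c ⁻¹ ∙ h
        c-dot-a : ∀ x → c * dot a x ≡ dot h x
        c-dot-a x = begin
          c * dot a x  ≡⟨ cong (c *_) (trans (dot-⊕∙ˡ origin (c ⁻¹) h x) (trans (cong (_+ c ⁻¹ * dot h x) (dot-originˡ x)) (+-identityˡ _))) ⟩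
          c * (c ⁻¹ * dot h x)  ≡⟨ *-assoc c _ _ ⟨
          c * c ⁻¹ * dot h x  ≡⟨ cong (_* dot h x) (⁻¹-inverseʳ (<⇒≢ 0<c ∘ sym)) ⟩
          1# * dot h x  ≡⟨ *-identityˡ _ ⟩
          dot h x  ∎

  -- `F` is an arbitrary predicate; the equation of its hyperplane makes it decidable at the
  -- vertices.
  V∈Region? : ∀ {F} → IsFace P F → ∀ i → Dec (F (Vᴷ i))
  V∈Region? (h , c , bound , F⊆ , ⊆F) i = Dec.map′ (λ eq → ⊆F (V∈P i , eq)) (proj₂ ∘ F⊆) (dot h (Vᴷ i) ≟ c)

  vertexSet : ∀ {F} → IsFace P F → Subset N
  vertexSet isFace = comprehension (V∈Region? isFace)

  -- A face of dimension k is a simplex with k + 1 vertices. Forwards, a face set is sent to the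
  -- face of a tilted facet; backwards, a face is sent to the vertices on it.
  faces-cardinality : ∀ k → k ℕ.< d → HasCardinality (faces P k) (faceCount (d ℕ.∸ ℕ.suc k))
  faces-cardinality k k<d = enumeration⇒cardinality (faces P k) (Unique.filter⁺ (isFaceSetOfCorank? j) (subsets-unique N))
    (λ S S∈ → face S (proj₂ (∈-filter⁻ (isFaceSetOfCorank? j) {xs = subsets N} S∈)))
    (λ (F , isFace , _) → vertexSet isFace)
    (λ (F , isFace , dim) → ∈-filter⁺ (isFaceSetOfCorank? j) (∈-subsets (vertexSet isFace)) (isFaceSet isFace dim))
    (λ {(F , isFaceF , _)} {(G , isFaceG , _)} (F⊆G , G⊆F) → subset-ext
      (λ i S∋i → ∋-comprehension⁺ (V∈Region? isFaceG) (F⊆G (∋-comprehension⁻ (V∈Region? isFaceF) S∋i)))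
      (λ i S∋i → ∋-comprehension⁺ (V∈Region? isFaceF) (G⊆F (∋-comprehension⁻ (V∈Region? isFaceG) S∋i))))
    (λ S S∈ → vertexSet-face S (proj₂ (∈-filter⁻ (isFaceSetOfCorank? j) {xs = subsets N} S∈)))
    (λ (F , isFace , dim) S∈ → face-vertexSet isFace dim (proj₂ (∈-filter⁻ (isFaceSetOfCorank? j) {xs = subsets N} S∈)))
    where
    j : ℕ
    j = d ℕ.∸ ℕ.suc k
    face : ∀ S → IsFaceSetOfCorank j S → Σ[ F ∈ Region d ] IsFace P F × HasDim F k
    face S (isFace , ∣S∣+j≡d) = from-supporting (supporting S isFace)
      where
      from-supporting : ∃[ a ] IsValid a × Supports a S → Σ[ F ∈ Region d ] IsFace P F × HasDim F k
      from-supporting (a , valid , supports) = Face a , (a , 1# , (λ x → dot-≤ a 1# valid) , id , id) ,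
        Face-dimension a S valid supports isFace (ℕ.+-cancelʳ-≡ j ∣ S ∣ (ℕ.suc k) (trans ∣S∣+j≡d (sym (ℕ.m+[n∸m]≡n k<d))))
    isFaceSet : ∀ {F} (isFace : IsFace P F) → HasDim F k → IsFaceSetOfCorank j (vertexSet isFace)
    isFaceSet {F} isFace dim = normalized (normalize-face k<d isFace dim)
      where
      S = vertexSet isFace
      normalized : Normalization F → IsFaceSetOfCorank j S
      normalized (a , valid , F⊆ , ⊆F) = faceSet , trans (cong (ℕ._+ j) (Face-dimension⁻ a S valid supports faceSet (HasDim-cong F⊆ ⊆F dim))) (ℕ.m+[n∸m]≡n k<d)
        where
        supports : Supports a S
        supports = (λ i S∋i → proj₂ (F⊆ (∋-comprehension⁻ (V∈Region? isFace) S∋i))) , λ i tight → ∋-comprehension⁺ (V∈Region? isFace) (⊆F (V∈P i , tight))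
        faceSet : IsFaceSet S
        faceSet = map₂ (λ tight i S∋i → tight⇒T∋ (tight (V∈P i) (proj₁ supports i S∋i))) (facet-above-index a valid)
    vertexSet-face : ∀ S (isFace : IsFaceSetOfCorank j S) → vertexSet (proj₁ (proj₂ (face S isFace))) ≡ S
    vertexSet-face S (isFace , ∣S∣+j≡d) = subset-ext
      (λ i ∋i → proj₂ supports i (proj₂ (∋-comprehension⁻ (V∈Region? isFace′) ∋i)))
      (λ i ∋i → ∋-comprehension⁺ (V∈Region? isFace′) (V∈P i , proj₁ supports i ∋i))
      where
      isFace′ : IsFace P (Face (proj₁ (supporting S isFace)))
      isFace′ = proj₁ (proj₂ (face S (isFace , ∣S∣+j≡d)))
      supports : Supports (proj₁ (supporting S isFace)) S
      supports = proj₂ (proj₂ (supporting S isFace))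
    face-vertexSet : ∀ {F} (isFace : IsFace P F) → HasDim F k → (c : IsFaceSetOfCorank j (vertexSet isFace)) →
      (∀ {x} → proj₁ (face (vertexSet isFace) c) x → F x) × (∀ {x} → F x → proj₁ (face (vertexSet isFace) c) x)
    face-vertexSet {F} isFace dim (faceSet , _) = normalized (normalize-face k<d isFace dim) (supporting (vertexSet isFace) faceSet)
      where
      normalized : Normalization F →
        ((b , _) : ∃[ b ] IsValid b × Supports b (vertexSet isFace)) → (∀ {x} → Face b x → F x) × (∀ {x} → F x → Face b x)
      -- The given hyperplane and the tilted one may differ, but they have the same vertices, and
      -- `Face-mono` in both directions identifies their faces.
      normalized (a , valid , F⊆ , ⊆F) (b , valid′ , S⇒tight , tight⇒S) =
        (λ x∈ → ⊆F (Face-mono b a valid′ (λ i tight → proj₂ (F⊆ (∋-comprehension⁻ (V∈Region? isFace) (tight⇒S i tight)))) x∈)) ,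
        (λ x∈ → Face-mono a b valid (λ i tight → S⇒tight i (∋-comprehension⁺ (V∈Region? isFace) (⊆F (V∈P i , tight)))) (F⊆ x∈))

-- Lattice points on the boundary of the first two dilates.

module LatticePointCount {ℓ} (K : OrderedField ℓ) {d : ℕ} (P : Geometry.Region K d)
                  (smooth : Geometry.IsSmoothPolytope K P) (0<d : 0 ℕ.< d) {N : ℕ}
                  (vertices : HasCardinality (Geometry.latticePoints K (Geometry.Boundary K (Geometry.dilate K 1 P))) N) where
  open OrderedField K
  open OrderedFieldProperties K
  open LinearAlgebraOverField K
  open Geometry K hiding (fromℤ)
  open FacetNormals K P smooth
  open FacetFrames K P smooth 0<d
  open BoundaryPoints K P smooth 0<d
  open VertexSets K P smooth 0<d vertices
  open FacesAndLatticePoints K P smooth 0<d vertices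
  open Subsets
  open Counting
  open import Data.Nat.Divisibility using (_∣_; _∣?_; divides)
  open ≡-Reasoning

  weight : ∀ {n} → Subset n → ℕ → Fin n → ℕ
  weight S q k = if lookup S k then q else 0

  total-weight : ∀ {n} (S : Subset n) q → total (weight S q) ≡ q ℕ.* ∣ S ∣
  total-weight []          q = sym (ℕ.*-zeroʳ q)
  total-weight (true ∷ S)  q = trans (cong (q ℕ.+_) (total-weight S q)) (sym (ℕ.*-suc q ∣ S ∣))
  total-weight (false ∷ S) q = total-weight S q

  -- The vertices of `S` with equal weight `q`: the barycentre of `S` scaled by `q` times `∣ S ∣`,
  -- which is the dilation factor m + 1 wherever boundary points are concerned.
  barycentre : Subset N → ℕ → Vec ℤ d
  barycentre S q = ℤ-LA.lincomb (λ k → ℤ.+ weight S q k) V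

  wᴷ : Subset N → ℕ → Fin N → Carrier
  wᴷ S q k = fromℤ (ℤ.+ weight S q k)

  dot-barycentre : ∀ h S q → dot h (embed (barycentre S q)) ≡ sum λ k → wᴷ S q k * dot h (Vᴷ k)
  dot-barycentre h S q = trans (cong (dot h) (embed-lincomb (λ k → ℤ.+ weight S q k) V)) (dot-lincombʳ h (wᴷ S q) Vᴷ)

  sum-wᴷ : ∀ {m} S q → ℕ.suc m ≡ q ℕ.* ∣ S ∣ → sum (wᴷ S q) ≡ scale m
  sum-wᴷ S q m≡ = trans (sym (fromℤ-total (weight S q))) (cong (fromℤ ∘ ℤ.+_) (trans (total-weight S q) (sym m≡)))

  wᴷ-term-≤ : ∀ S q h k → dot h (Vᴷ k) ≤ 1# → wᴷ S q k * dot h (Vᴷ k) ≤ wᴷ S q k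
  wᴷ-term-≤ S q h k h≤1 = ≤-respects refl (*-identityʳ _) (*-monoˡ-≤ (fromℤ-nonneg (weight S q k)) h≤1)

  dot-barycentre-tight : ∀ {m} h S q → ℕ.suc m ≡ q ℕ.* ∣ S ∣ → (∀ k → S ∋ k → dot h (Vᴷ k) ≡ 1#) →
    dot h (embed (barycentre S q)) ≡ scale m
  dot-barycentre-tight h S q m≡ tight = trans (dot-barycentre h S q) (trans (sum-cong-≗ λ k → term k (lookup S k) refl) (sum-wᴷ S q m≡))
    where
    term : ∀ k b → lookup S k ≡ b → wᴷ S q k * dot h (Vᴷ k) ≡ wᴷ S q k
    term k true  S∋k = trans (cong (wᴷ S q k *_) (tight k S∋k)) (*-identityʳ _)
    term k false S∌k = trans (cong (_* dot h (Vᴷ k)) w≡0) (trans (zeroˡ _) (sym w≡0))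
      where
      w≡0 : wᴷ S q k ≡ 0#
      w≡0 = cong (λ b → fromℤ (ℤ.+ (if b then q else 0))) S∌k

  barycentre-boundary : ∀ {m} S q → ℕ.suc m ≡ q ℕ.* ∣ S ∣ → IsFaceSet S → OnBoundary m (embed (barycentre S q))
  barycentre-boundary S q m≡ (l , S⊆T) =
    (λ l′ → ≤-respects (sym (dot-barycentre (normal l′) S q)) (sum-wᴷ S q m≡) (sum-mono-≤ λ k → wᴷ-term-≤ S q (normal l′) k (V≤1 k l′))) ,
    l , dot-barycentre-tight (normal l) S q m≡ (λ k S∋k → T∋⇒tight (S⊆T k S∋k))

  positive-quotient : ∀ {m} q s → ℕ.suc m ≡ q ℕ.* s → ∃[ q′ ] q ≡ ℕ.suc q′
  positive-quotient (ℕ.suc q) s _ = q , refl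

  -- The functional supporting S attains its maximum over the dilate at the
  -- barycentre of S, hence is tight on the vertices of S′ as well.
  barycentre-determines : ∀ {m} S q S′ q′ → ℕ.suc m ≡ q ℕ.* ∣ S ∣ → ℕ.suc m ≡ q′ ℕ.* ∣ S′ ∣ → IsFaceSet S →
    barycentre S q ≡ barycentre S′ q′ → ∀ k → S′ ∋ k → S ∋ k
  barycentre-determines S q S′ q′ m≡ m≡′ isFace eq = supported (supporting S isFace)
    where
    supported : ∃[ a ] IsValid a × Supports a S → ∀ k → S′ ∋ k → S ∋ k
    supported (a , valid , S⇒tight , tight⇒S) k S′∋k = tight⇒S k (x-y≡0⇒x≡y (*-zero-or (trans
        (solve 2 (λ w x → w :* (x :- con (ℤ.+ 1)) := w :* x :- w) refl (wᴷ S′ q′ k) (dot a (Vᴷ k)))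
        (trans (cong (λ z → z - wᴷ S′ q′ k) (same-terms k)) (-‿inverseʳ _))) w≢0))
      where
      same-terms : ∀ k → wᴷ S′ q′ k * dot a (Vᴷ k) ≡ wᴷ S′ q′ k
      same-terms = sum-mono-≡ (λ k → wᴷ-term-≤ S′ q′ a k (valid-V {a} valid k)) (trans (sym (dot-barycentre a S′ q′))
        (trans (cong (dot a ∘ embed) (sym eq)) (trans (dot-barycentre-tight a S q m≡ S⇒tight) (sym (sum-wᴷ S′ q′ m≡′)))))
      w≢0 : wᴷ S′ q′ k ≢ 0#
      w≢0 w≡0 = positive (positive-quotient q′ ∣ S′ ∣ m≡′)
        where
        positive : ¬ (∃[ r ] q′ ≡ ℕ.suc r)
        positive (r , q′≡) = <⇒≢ (fromℤ-pos r) (trans (sym w≡0) (cong (fromℤ ∘ ℤ.+_) (trans (cong (λ b → if b then q′ else 0) S′∋k) q′≡)))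

  barycentre-injective : ∀ {m} S q S′ q′ → ℕ.suc m ≡ q ℕ.* ∣ S ∣ → ℕ.suc m ≡ q′ ℕ.* ∣ S′ ∣ → IsFaceSet S → IsFaceSet S′ →
    barycentre S q ≡ barycentre S′ q′ → S ≡ S′
  barycentre-injective S q S′ q′ m≡ m≡′ isFace isFace′ eq = subset-ext
    (barycentre-determines S′ q′ S q m≡′ m≡ isFace′ (sym eq)) (barycentre-determines S q S′ q′ m≡ m≡′ isFace eq)

  component-≤-total : ∀ {n} (c : Fin n → ℕ) i → c i ℕ.≤ total c
  component-≤-total c zero    = ℕ.m≤m+n (c zero) _
  component-≤-total c (suc i) = ℕ.≤-trans (component-≤-total (c ∘ suc) i) (ℕ.m≤n+m _ (c zero))

  -- The only positive sums up to 2 are 1, 2 and 1 + 1, so all nonzero parts are equal. The bound is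
  -- sharp in view of 1 + 2.
  balanced : ∀ {n} (c : Fin n → ℕ) → total c ℕ.≤ 2 → ∃[ q ] ∀ i → c i ≡ 0 ⊎ c i ≡ q
  balanced {ℕ.zero}  c _   = 0 , λ ()
  balanced {ℕ.suc n} c Σ≤2 = split (c zero) refl
    where
    rest : ∀ {m} → c zero ≡ m → m ℕ.+ total (c ∘ suc) ℕ.≤ 2
    rest refl = Σ≤2
    0-or-1 : ∀ {x} → x ℕ.≤ 1 → x ≡ 0 ⊎ x ≡ 1
    0-or-1 {0} _ = inj₁ refl
    0-or-1 {1} _ = inj₂ refl
    0-or-1 {ℕ.suc (ℕ.suc _)} (ℕ.s≤s ())
    split : ∀ m → c zero ≡ m → ∃[ q ] ∀ i → c i ≡ 0 ⊎ c i ≡ q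
    split 0 eq = map₂ (λ or → λ { zero → inj₁ eq ; (suc i) → or i }) (balanced (c ∘ suc) (rest eq))
    split 1 eq = 1 , λ { zero → inj₂ eq ; (suc i) → 0-or-1 (ℕ.≤-trans (component-≤-total (c ∘ suc) i) (ℕ.s≤s⁻¹ (rest eq))) }
    split 2 eq = 2 , λ { zero → inj₂ eq ; (suc i) → inj₁ (ℕ.n≤0⇒n≡0 (ℕ.≤-trans (component-≤-total (c ∘ suc) i) (ℕ.s≤s⁻¹ (ℕ.s≤s⁻¹ (rest eq))))) }
    split (ℕ.suc (ℕ.suc (ℕ.suc m))) eq = case rest eq of λ { (ℕ.s≤s (ℕ.s≤s ())) }

  sum-σ : ∀ l (f : Fin N → Carrier) → (∀ k → ¬ T l ∋ k → f k ≡ 0#) → sum f ≡ sum (f ∘ σ l)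
  sum-σ l f outside = begin
    sum f  ≡⟨ sum-cong-≗ (λ k → decide k (T l ∋? k)) ⟩
    sum (λ k → sum λ i → δ k (σ l i) * f k)  ≡⟨ ∑-comm (λ k i → δ k (σ l i) * f k) ⟩
    sum (λ i → sum λ k → δ k (σ l i) * f k)  ≡⟨ sum-cong-≗ (λ i → sum-δ f (σ l i)) ⟩
    sum (f ∘ σ l)  ∎
    where
    decide : ∀ k → Dec (T l ∋ k) → f k ≡ sum λ i → δ k (σ l i) * f k
    decide k (no T∌k)  = trans (outside k T∌k) (sym (sum-zero λ i → trans (cong (δ k (σ l i) *_) (outside k T∌k)) (zeroʳ _)))
    decide k (yes T∋k) = at (T∋⇒σ l T∋k)
      where
      at : ∃[ i ] σ l i ≡ k → f k ≡ sum λ i → δ k (σ l i) * f k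
      at (i , refl) = sym (trans (sum-single (λ j → δ (σ l i) (σ l j) * f (σ l i)) i
          (λ j j≢i → trans (cong (_* f (σ l i)) (δ-≢ (j≢i ∘ σ-injective l ∘ sym))) (zeroˡ _)))
        (trans (cong (_* f (σ l i)) (δ-refl (σ l i))) (*-identityˡ _)))

  Barycentric : ℕ → Vec ℤ d → Set
  Barycentric m z = ∃[ S ] IsFaceSet S × ∃[ q ] ℕ.suc m ≡ q ℕ.* ∣ S ∣ × barycentre S q ≡ z

  abstract
    -- `S` consists of the vertices with nonzero coordinate in a cone containing the point;
    -- `balanced` makes these coordinates equal to one `q`.
    barycentric : ∀ {m} → ℕ.suc m ℕ.≤ 2 → ∀ z → OnBoundary m (embed z) →
      Barycentric m z
    barycentric {m} m≤2 z z∈ = in-cone (boundary-lattice-point m z z∈)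
      where
      in-cone : ∃[ l ] Σ[ c ∈ (Fin d → ℕ) ] (∀ i → coordinate l i (embed z) ≡ fromℤ (ℤ.+ c i)) × total c ≡ ℕ.suc m →
        Barycentric m z
      in-cone (l , c , c≡ , Σ≡) = with-weight (balanced c (subst (ℕ._≤ 2) (sym Σ≡) m≤2))
        where
        Supported : Fin N → Set
        Supported k = ∃[ i ] σ l i ≡ k × c i ≢ 0
        supported? : ∀ k → Dec (Supported k)
        supported? k = Fin.any? λ i → (σ l i Fin.≟ k) ×-dec ¬? (c i ℕ.≟ 0)
        S : Subset N
        S = comprehension supported?
        S⊆T : ∀ k → S ∋ k → T l ∋ k
        S⊆T k S∋k = at (∋-comprehension⁻ supported? S∋k)
          where
          at : Supported k → T l ∋ k
          at (i , refl , _) = T∋σ l i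
        with-weight : ∃[ q ] (∀ i → c i ≡ 0 ⊎ c i ≡ q) → Barycentric m z
        with-weight (q , 0-or-q) = S , (l , S⊆T) , q , size , embed-injective (dot-ext combination≡)
          where
          weight-σ : ∀ i → weight S q (σ l i) ≡ c i
          weight-σ i = decide (lookup S (σ l i)) refl
            where
            decide : ∀ b → lookup S (σ l i) ≡ b → (if lookup S (σ l i) then q else 0) ≡ c i
            decide true S∋σ = trans (cong (if_then q else 0) S∋σ) (sym (at (∋-comprehension⁻ supported? S∋σ)))
              where
              at : Supported (σ l i) → c i ≡ q
              at (j , eq , c≢0) = Sum.[ (λ c≡0 → contradiction (subst (λ j → c j ≡ 0) (sym (σ-injective l eq)) c≡0) c≢0) , id ]′ (0-or-q i)
            decide false S∌σ = trans (cong (if_then q else 0) S∌σ) (sym (zero-at (c i ℕ.≟ 0)))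
              where
              zero-at : Dec (c i ≡ 0) → c i ≡ 0
              zero-at (yes c≡0) = c≡0
              zero-at (no c≢0)  = contradiction (trans (sym (∋-comprehension⁺ supported? (i , refl , c≢0))) S∌σ) λ ()
          outside : ∀ k → ¬ T l ∋ k → wᴷ S q k ≡ 0#
          outside k T∌k = decide (lookup S k) refl
            where
            decide : ∀ b → lookup S k ≡ b → wᴷ S q k ≡ 0#
            decide true  S∋k = contradiction (S⊆T k S∋k) T∌k
            decide false S∌k = cong (λ b → fromℤ (ℤ.+ (if b then q else 0))) S∌k
          size : ℕ.suc m ≡ q ℕ.* ∣ S ∣
          size = trans (ℤ.+-injective (fromℤ-injective (begin
            fromℤ (ℤ.+ ℕ.suc m)  ≡⟨ cong (fromℤ ∘ ℤ.+_) Σ≡ ⟨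
            fromℤ (ℤ.+ total c)  ≡⟨ fromℤ-total c ⟩
            sum (λ i → fromℤ (ℤ.+ c i))  ≡⟨ sum-cong-≗ (λ i → cong (fromℤ ∘ ℤ.+_) (weight-σ i)) ⟨
            sum (wᴷ S q ∘ σ l)  ≡⟨ sum-σ l (wᴷ S q) outside ⟨
            sum (wᴷ S q)  ≡⟨ fromℤ-total (weight S q) ⟨
            fromℤ (ℤ.+ total (weight S q))  ∎))) (total-weight S q)
          combination≡ : ∀ y → dot (embed (barycentre S q)) y ≡ dot (embed z) y
          combination≡ y = begin
            dot (embed (barycentre S q)) y  ≡⟨ dot-comm (embed (barycentre S q)) y ⟩
            dot y (embed (barycentre S q))  ≡⟨ dot-barycentre y S q ⟩
            sum (λ k → wᴷ S q k * dot y (Vᴷ k))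
              ≡⟨ sum-σ l (λ k → wᴷ S q k * dot y (Vᴷ k)) (λ k T∌k → trans (cong (_* dot y (Vᴷ k)) (outside k T∌k)) (zeroˡ _)) ⟩
            sum (λ i → wᴷ S q (σ l i) * dot y (Vᴷ (σ l i)))
              ≡⟨ sum-cong-≗ (λ i → cong₂ _*_ (trans (cong (fromℤ ∘ ℤ.+_) (weight-σ i)) (sym (c≡ i))) (cong (dot y) (V-σ l i))) ⟩
            sum (λ i → coordinate l i (embed z) * dot y (E l i)) ≡⟨ Frame.dot-expand l y (embed z) ⟨
            dot y (embed z)  ≡⟨ dot-comm y (embed z) ⟩
            dot (embed z) y  ∎

  quotient-unique : ∀ {m} s q q′ → ℕ.suc m ≡ q ℕ.* s → ℕ.suc m ≡ q′ ℕ.* s → q ≡ q′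
  quotient-unique ℕ.zero    q q′ eq _   = case trans eq (ℕ.*-zeroʳ q) of λ ()
  quotient-unique (ℕ.suc s) q q′ eq eq′ = ℕ.*-cancelʳ-≡ q q′ (ℕ.suc s) (trans (sym eq) eq′)

  module _ (m : ℕ) (m≤2 : ℕ.suc m ℕ.≤ 2) where
    -- The condition for a weight `q` with q ∣S∣ = m + 1 to exist. The empty set drops out, as 0
    -- does not divide m + 1.
    Divides : Subset N → Set
    Divides S = IsFaceSet S × ∣ S ∣ ∣ ℕ.suc m

    divides? : ∀ S → Dec (Divides S)
    divides? S = isFaceSet? S ×-dec (∣ S ∣ ∣? ℕ.suc m)

    lattice-cardinality : HasCardinality (latticePoints (Boundary (dilate (ℕ.suc m) P))) (count divides? (subsets N))
    lattice-cardinality = enumeration⇒cardinality (latticePoints (Boundary (dilate (ℕ.suc m) P)))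
      (Unique.filter⁺ divides? (subsets-unique N))
      (λ S S∈ → point S (proj₂ (∈-filter⁻ divides? {xs = subsets N} S∈)))
      (λ s → faceSet s)
      (λ s → ∈-filter⁺ divides? (∈-subsets (faceSet s)) (faceSet-divides s))
      (λ {s} {t} → faceSet-cong s t)
      (λ S S∈ → faceSet-point S (proj₂ (∈-filter⁻ divides? {xs = subsets N} S∈)))
      (λ s S∈ → point-faceSet s (proj₂ (∈-filter⁻ divides? {xs = subsets N} S∈)))
      where
      LatticePoint : Set ℓ
      LatticePoint = Σ[ z ∈ Vec ℤ d ] Boundary (dilate (ℕ.suc m) P) (embed z)
      point : ∀ S → Divides S → LatticePoint
      point S (isFace , divides q m≡) = barycentre S q , OnBoundary⇒Boundary m {embed (barycentre S q)} (barycentre-boundary S q m≡ isFace)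
      representation : ((z , _) : LatticePoint) → Barycentric m z
      representation (z , z∈) = barycentric m≤2 z (Boundary⇒OnBoundary m {embed z} z∈)
      faceSet : LatticePoint → Subset N
      faceSet s = proj₁ (representation s)
      faceSet-divides : ∀ s → Divides (faceSet s)
      faceSet-divides s = proj₁ (proj₂ (representation s)) , divides (proj₁ (proj₂ (proj₂ (representation s)))) (proj₁ (proj₂ (proj₂ (proj₂ (representation s)))))
      -- `faceSet` is computed from a proof that the point lies on the boundary, which the equality
      -- of lattice points ignores. Uniqueness of the representation makes it depend on the point
      -- alone.
      faceSet-unique : ∀ s S q → ℕ.suc m ≡ q ℕ.* ∣ S ∣ → IsFaceSet S → barycentre S q ≡ proj₁ s → faceSet s ≡ S
      faceSet-unique s S q m≡ isFace eq = unique (representation s)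
        where
        unique : ((S′ , _) : Barycentric m (proj₁ s)) → S′ ≡ S
        unique (S′ , isFace′ , q′ , m≡′ , eq′) = barycentre-injective S′ q′ S q m≡′ m≡ isFace′ isFace (trans eq′ (sym eq))
      faceSet-cong : ∀ s t → proj₁ s ≡ proj₁ t → faceSet s ≡ faceSet t
      faceSet-cong s t s≡t = from (representation t) refl
        where
        from : (r : Barycentric m (proj₁ t)) → proj₁ r ≡ faceSet t → faceSet s ≡ faceSet t
        from (S , isFace , q , m≡ , eq) S≡ = trans (faceSet-unique s S q m≡ isFace (trans eq (sym s≡t))) S≡
      faceSet-point : ∀ S S| → faceSet (point S S|) ≡ S
      faceSet-point S S|@(isFace , divides q m≡) = faceSet-unique (point S S|) S q m≡ isFace refl
      point-faceSet : ∀ s S| → proj₁ (point (faceSet s) S|) ≡ proj₁ s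
      point-faceSet s (isFace , divides q m≡) = same (representation s) refl
        where
        same : (r : Barycentric m (proj₁ s)) → proj₁ r ≡ faceSet s → barycentre (faceSet s) q ≡ proj₁ s
        same (S , _ , q′ , m≡′ , eq) refl = trans (cong (barycentre (faceSet s)) (quotient-unique ∣ faceSet s ∣ q q′ m≡ m≡′)) eq

  ofSize⇒corank : ∀ {s} → s ℕ.≤ d → ∀ S → IsFaceSet S → ∣ S ∣ ≡ s → IsFaceSetOfCorank (d ℕ.∸ s) S
  ofSize⇒corank s≤d S isFace refl = isFace , ℕ.m+[n∸m]≡n s≤d

  corank⇒ofSize : ∀ {s} → s ℕ.≤ d → ∀ S → IsFaceSetOfCorank (d ℕ.∸ s) S → IsFaceSet S × ∣ S ∣ ≡ s
  corank⇒ofSize {s} s≤d S (isFace , eq) = isFace , ℕ.+-cancelʳ-≡ (d ℕ.∸ s) ∣ S ∣ s (trans eq (sym (ℕ.m+[n∸m]≡n s≤d)))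

  b₁≡ : N ≡ faceCount (d ℕ.∸ 1)
  b₁≡ = trans (cardinality-unique vertices (lattice-cardinality 0 (ℕ.s≤s ℕ.z≤n)))
    (count-cong (divides? 0 (ℕ.s≤s ℕ.z≤n)) (isFaceSetOfCorank? (d ℕ.∸ 1)) (subsets N)
      (λ S (isFace , divides q 1≡) → ofSize⇒corank 0<d S isFace (ℕ.m*n≡1⇒n≡1 q ∣ S ∣ (sym 1≡)))
      (λ S corank → map₂ (λ ∣S∣≡1 → divides 1 (sym (trans (ℕ.+-identityʳ ∣ S ∣) ∣S∣≡1))) (corank⇒ofSize 0<d S corank)))

  -- The divisors of 2: a single vertex has weight 2 and gives 2 v, an edge has weight 1 and gives v
  -- + w.
  b₂≡ : ∀ {b₂} → 2 ℕ.≤ d → HasCardinality (latticePoints (Boundary (dilate 2 P))) b₂ →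
    b₂ ≡ faceCount (d ℕ.∸ 1) ℕ.+ faceCount (d ℕ.∸ 2)
  b₂≡ 2≤d card = trans (cardinality-unique card (lattice-cardinality 1 (ℕ.s≤s (ℕ.s≤s ℕ.z≤n))))
    (trans (count-cong (divides? 1 (ℕ.s≤s (ℕ.s≤s ℕ.z≤n))) either? (subsets N) to from)
      (count-⊎ (isFaceSetOfCorank? (d ℕ.∸ 1)) (isFaceSetOfCorank? (d ℕ.∸ 2)) either? disjoint (subsets N)))
    where
    Either : Subset N → Set
    Either S = IsFaceSetOfCorank (d ℕ.∸ 1) S ⊎ IsFaceSetOfCorank (d ℕ.∸ 2) S
    either? : ∀ S → Dec (Either S)
    either? S = isFaceSetOfCorank? (d ℕ.∸ 1) S ⊎-dec isFaceSetOfCorank? (d ℕ.∸ 2) S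
    divisor-of-2 : ∀ q s → 2 ≡ q ℕ.* s → s ≡ 1 ⊎ s ≡ 2
    divisor-of-2 q 0 eq = case trans eq (ℕ.*-zeroʳ q) of λ ()
    divisor-of-2 q 1 eq = inj₁ refl
    divisor-of-2 q 2 eq = inj₂ refl
    divisor-of-2 (ℕ.suc q) (ℕ.suc (ℕ.suc (ℕ.suc s))) eq = case eq of λ ()
    to : ∀ S → Divides 1 (ℕ.s≤s (ℕ.s≤s ℕ.z≤n)) S → Either S
    to S (isFace , divides q 2≡) = Sum.map (ofSize⇒corank 0<d S isFace) (ofSize⇒corank 2≤d S isFace) (divisor-of-2 q ∣ S ∣ 2≡)
    from : ∀ S → Either S → Divides 1 (ℕ.s≤s (ℕ.s≤s ℕ.z≤n)) S
    from S (inj₁ corank) = map₂ (λ ∣S∣≡1 → divides 2 (sym (cong (2 ℕ.*_) ∣S∣≡1))) (corank⇒ofSize 0<d S corank)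
    from S (inj₂ corank) = map₂ (λ ∣S∣≡2 → divides 1 (sym (trans (ℕ.+-identityʳ ∣ S ∣) ∣S∣≡2))) (corank⇒ofSize 2≤d S corank)
    disjoint : ∀ S → IsFaceSetOfCorank (d ℕ.∸ 1) S → ¬ IsFaceSetOfCorank (d ℕ.∸ 2) S
    disjoint S corank₁ corank₂ = case trans (sym (proj₂ (corank⇒ofSize 0<d S corank₁))) (proj₂ (corank⇒ofSize 2≤d S corank₂)) of λ ()

-- Binomial identities checked by evaluation.

module FaceNumberRelations where
  open Counting using (combination)
  open import Data.Nat.Combinatorics using (_C_)

  SymmetricallyEqual : ∀ {m} → ℕ → (as bs : Vec ℕ m) → Set
  SymmetricallyEqual d as bs = ∀ k l → k ℕ.+ l ≡ d →
    combination as (k C_) ℕ.+ combination as (l C_) ≡ combination bs (k C_) ℕ.+ combination bs (l C_)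

  symmetricallyEqual? : ∀ {m} d (as bs : Vec ℕ m) →
    Dec ((k : Fin (ℕ.suc d)) → combination as (toℕ k C_) ℕ.+ combination as ((d ℕ.∸ toℕ k) C_) ≡
                               combination bs (toℕ k C_) ℕ.+ combination bs ((d ℕ.∸ toℕ k) C_))
  symmetricallyEqual? d as bs = Fin.all? λ k → _ ℕ.≟ _

  -- For fixed d, the pairs with k + l = d are finitely many, so evaluation at k = 0, ..., d proves
  -- the identity.
  symmetricallyEqual : ∀ {m} d (as bs : Vec ℕ m) → True (symmetricallyEqual? d as bs) → SymmetricallyEqual d as bs
  symmetricallyEqual d as bs check k l refl = subst₂ (λ k l → combination as (k C_) ℕ.+ combination as (l C_) ≡ combination bs (k C_) ℕ.+ combination bs (l C_))
    (Fin.toℕ-fromℕ< k<1+d) (trans (cong (d ℕ.∸_) (Fin.toℕ-fromℕ< k<1+d)) (ℕ.m+n∸m≡n k l)) (toWitness check (fromℕ< k<1+d))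
    where
    k<1+d : k ℕ.< ℕ.suc d
    k<1+d = ℕ.s≤s (ℕ.m≤m+n k l)

  -- M j is the number of faces with d − j vertices, i.e. of dimension d − j − 1.
  record FaceNumbers {ℓ} (K : OrderedField ℓ) {d : ℕ} (P : Geometry.Region K d) (b : ℕ → ℕ) : Set (lsuc ℓ) where
    field
      M           : ℕ → ℕ
      cardinality : ∀ k → k ℕ.< d → HasCardinality (Geometry.faces K P k) (M (d ℕ.∸ ℕ.suc k))
      relation    : ∀ {m} (as bs : Vec ℕ m) → SymmetricallyEqual d as bs → combination as M ≡ combination bs M
      Md≡1        : M d ≡ 1
      b₁≡M        : b 1 ≡ M (d ℕ.∸ 1)
      b₂≡M        : 2 ℕ.≤ d → b 2 ≡ M (d ℕ.∸ 1) ℕ.+ M (d ℕ.∸ 2)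

  module _ {ℓ} (K : OrderedField ℓ) {d : ℕ} (P : Geometry.Region K d) (smooth : Geometry.IsSmoothPolytope K P) (b : ℕ → ℕ)
           (boundary : ∀ m → 1 ℕ.≤ m → HasCardinality (Geometry.latticePoints K (Geometry.Boundary K (Geometry.dilate K m P))) (b m)) where
    abstract
      faceNumbers : 0 ℕ.< d → FaceNumbers K P b
      faceNumbers 0<d = record
        { M           = VertexSets.faceCount K P smooth 0<d vertices
        ; cardinality = FacesAndLatticePoints.faces-cardinality K P smooth 0<d vertices
        ; relation    = VertexSets.face-relation K P smooth 0<d vertices
        ; Md≡1        = VertexSets.faceCount-d K P smooth 0<d vertices
        ; b₁≡M        = LatticePointCount.b₁≡ K P smooth 0<d vertices
        ; b₂≡M        = λ 2≤d → LatticePointCount.b₂≡ K P smooth 0<d vertices 2≤d (boundary 2 (ℕ.s≤s ℕ.z≤n))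
        }
        where
        vertices : HasCardinality (Geometry.latticePoints K (Geometry.Boundary K (Geometry.dilate K 1 P))) (b 1)
        vertices = boundary 1 (ℕ.s≤s ℕ.z≤n)

open import Data.Integer using (ℤ; +_; _+_; _-_; _*_)
open import Data.Nat using (_≤_)

-- The Dehn-Sommerville equations solved in dimensions 3, 4 and 5.

module DehnSommerville where
  open Counting using (combination)
  open FaceNumberRelations
  open import Data.Integer.Solver using (module +-*-Solver)
  open +-*-Solver

  combinationℤ : ∀ {m} → Vec ℕ m → (ℕ → ℤ) → ℤ
  combinationℤ []       g = + 0
  combinationℤ (c ∷ cs) g = + c * g 0 + combinationℤ cs (g ∘ ℕ.suc)

  +-combination : ∀ {m} (cs : Vec ℕ m) g → + combination cs g ≡ combinationℤ cs (+_ ∘ g)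
  +-combination []       g = refl
  +-combination (c ∷ cs) g = cong₂ _+_ (ℤ.pos-* c (g 0)) (+-combination cs (g ∘ ℕ.suc))

  -- A ring solver cannot use hypotheses. A relation therefore enters as a summand, the difference
  -- of its two sides, which is removed here.
  modulo-relation : ∀ {ℓ} {K : OrderedField ℓ} {d} {P : Geometry.Region K d} {b} (numbers : FaceNumbers K P b) →
    let open FaceNumbers numbers in
    ∀ {m} (as bs : Vec ℕ m) {check : True (symmetricallyEqual? d as bs)} x →
    combinationℤ as (+_ ∘ M) - combinationℤ bs (+_ ∘ M) + x ≡ x
  modulo-relation {d = d} numbers as bs {check} x = trans
    (cong (_+ x) (trans (cong (_- combinationℤ bs (+_ ∘ M)) (trans (sym (+-combination as M)) (trans (cong +_ (relation as bs (symmetricallyEqual d as bs check))) (+-combination bs M))))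
      (ℤ.+-inverseʳ (combinationℤ bs (+_ ∘ M)))))
    (ℤ.+-identityˡ x)
    where open FaceNumbers numbers

  combinationᴾ : ∀ {m n} → Vec ℕ m → Vec (Polynomial n) m → Polynomial n
  combinationᴾ []       []       = con (+ 0)
  combinationᴾ (c ∷ cs) (x ∷ xs) = con (+ c) :* x :+ combinationᴾ cs xs

  difference : ∀ {m n} → Vec ℕ m → Vec ℕ m → Vec (Polynomial n) m → Polynomial n
  difference as bs xs = combinationᴾ as xs :- combinationᴾ bs xs

  module _ {ℓ} (K : OrderedField ℓ) (b : ℕ → ℕ) where
    open Geometry K

    private
      b₁ b₂ : ℤ
      b₁ = + b 1
      b₂ = + b 2

    dimension3 : ∀ {P : Region 3} → FaceNumbers K P b → HasFVector P (b₁ ∷ + 3 * b₁ - + 6 ∷ + 2 * b₁ - + 4 ∷ [])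
    dimension3 {P} numbers = M 2 ∷ M 1 ∷ M 0 ∷ [] ,
      (λ { zero → cardinality 0 (ℕ.s≤s ℕ.z≤n)
         ; (suc zero) → cardinality 1 (ℕ.s≤s (ℕ.s≤s ℕ.z≤n))
         ; (suc (suc zero)) → cardinality 2 (ℕ.s≤s (ℕ.s≤s (ℕ.s≤s ℕ.z≤n))) }) ,
      cong₂ _∷_ (cong +_ (sym b₁≡M)) (cong₂ _∷_ f₁ (cong₂ _∷_ f₂ refl))
      where
      open FaceNumbers numbers
      -- The relation is f₁ + 6 = 3 f₀, made homogeneous by the number `M 3` of empty faces.
      f₁ : + M 1 ≡ + 3 * b₁ - + 6
      f₁ = trans (solve 4 (λ x₀ x₁ x₂ x₃ → x₁ := difference (0 ∷ 1 ∷ 0 ∷ 6 ∷ []) (0 ∷ 0 ∷ 3 ∷ 0 ∷ []) (x₀ ∷ x₁ ∷ x₂ ∷ x₃ ∷ []) :+ (con (+ 3) :* x₂ :- con (+ 6) :* x₃)) refl (+ M 0) (+ M 1) (+ M 2) (+ M 3))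
        (trans (modulo-relation numbers (0 ∷ 1 ∷ 0 ∷ 6 ∷ []) (0 ∷ 0 ∷ 3 ∷ 0 ∷ [])
            (+ 3 * + M 2 - + 6 * + M 3))
          (cong₂ (λ x y → + 3 * + x - + 6 * + y) (sym b₁≡M) Md≡1))
      -- The relation is f₂ + 4 = 2 f₀.
      f₂ : + M 0 ≡ + 2 * b₁ - + 4
      f₂ = trans (solve 4 (λ x₀ x₁ x₂ x₃ → x₀ := difference (1 ∷ 0 ∷ 0 ∷ 4 ∷ []) (0 ∷ 0 ∷ 2 ∷ 0 ∷ []) (x₀ ∷ x₁ ∷ x₂ ∷ x₃ ∷ []) :+ (con (+ 2) :* x₂ :- con (+ 4) :* x₃)) refl (+ M 0) (+ M 1) (+ M 2) (+ M 3))
        (trans (modulo-relation numbers (1 ∷ 0 ∷ 0 ∷ 4 ∷ []) (0 ∷ 0 ∷ 2 ∷ 0 ∷ [])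
            (+ 2 * + M 2 - + 4 * + M 3))
          (cong₂ (λ x y → + 2 * + x - + 4 * + y) (sym b₁≡M) Md≡1))

    dimension4 : ∀ {P : Region 4} → FaceNumbers K P b →
      HasFVector P (b₁ ∷ b₂ - b₁ ∷ + 2 * b₂ - + 4 * b₁ ∷ b₂ - + 2 * b₁ ∷ [])
    dimension4 {P} numbers = M 3 ∷ M 2 ∷ M 1 ∷ M 0 ∷ [] ,
      (λ { zero → cardinality 0 (ℕ.s≤s ℕ.z≤n)
         ; (suc zero) → cardinality 1 (ℕ.s≤s (ℕ.s≤s ℕ.z≤n))
         ; (suc (suc zero)) → cardinality 2 (ℕ.s≤s (ℕ.s≤s (ℕ.s≤s ℕ.z≤n)))
         ; (suc (suc (suc zero))) → cardinality 3 (ℕ.s≤s (ℕ.s≤s (ℕ.s≤s (ℕ.s≤s ℕ.z≤n)))) }) ,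
      cong₂ _∷_ (cong +_ (sym b₁≡M)) (cong₂ _∷_ f₁ (cong₂ _∷_ f₂ (cong₂ _∷_ f₃ refl)))
      where
      open FaceNumbers numbers
      in-b : (t : ℤ → ℤ → ℤ) → t (+ M 3) (+ M 3 + + M 2) ≡ t b₁ b₂
      in-b t = cong₂ (λ x y → t (+ x) (+ y)) (sym b₁≡M) (sym (b₂≡M (ℕ.s≤s (ℕ.s≤s ℕ.z≤n))))
      f₁ : + M 2 ≡ b₂ - b₁
      f₁ = trans (solve 2 (λ x₃ x₂ → x₂ := x₃ :+ x₂ :- x₃) refl (+ M 3) (+ M 2)) (in-b λ b₁ b₂ → b₂ - b₁)
      -- From f₂ + 2 f₀ = 2 f₁ with f₁ = b₂ - b₁. In this dimension the empty face does not enter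
      -- the relations, hence no constant terms.
      f₂ : + M 1 ≡ + 2 * b₂ - + 4 * b₁
      f₂ = trans (solve 4 (λ x₀ x₁ x₂ x₃ → x₁ := difference (0 ∷ 1 ∷ 0 ∷ 2 ∷ []) (0 ∷ 0 ∷ 2 ∷ 0 ∷ []) (x₀ ∷ x₁ ∷ x₂ ∷ x₃ ∷ []) :+ (con (+ 2) :* (x₃ :+ x₂) :- con (+ 4) :* x₃)) refl (+ M 0) (+ M 1) (+ M 2) (+ M 3))
        (trans (modulo-relation numbers (0 ∷ 1 ∷ 0 ∷ 2 ∷ []) (0 ∷ 0 ∷ 2 ∷ 0 ∷ [])
            (+ 2 * (+ M 3 + + M 2) - + 4 * + M 3))
          (in-b λ b₁ b₂ → + 2 * b₂ - + 4 * b₁))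
      -- From f₃ + f₀ = f₁.
      f₃ : + M 0 ≡ b₂ - + 2 * b₁
      f₃ = trans (solve 4 (λ x₀ x₁ x₂ x₃ → x₀ := difference (1 ∷ 0 ∷ 0 ∷ 1 ∷ []) (0 ∷ 0 ∷ 1 ∷ 0 ∷ []) (x₀ ∷ x₁ ∷ x₂ ∷ x₃ ∷ []) :+ (x₃ :+ x₂ :- con (+ 2) :* x₃)) refl (+ M 0) (+ M 1) (+ M 2) (+ M 3))
        (trans (modulo-relation numbers (1 ∷ 0 ∷ 0 ∷ 1 ∷ []) (0 ∷ 0 ∷ 1 ∷ 0 ∷ [])
            (+ M 3 + + M 2 - + 2 * + M 3))
          (in-b λ b₁ b₂ → b₂ - + 2 * b₁))

    dimension5 : ∀ {P : Region 5} → FaceNumbers K P b →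
      HasFVector P (b₁ ∷ b₂ - b₁ ∷ + 4 * b₂ - + 14 * b₁ + + 20 ∷ + 5 * b₂ - + 20 * b₁ + + 30 ∷ + 2 * b₂ - + 8 * b₁ + + 12 ∷ [])
    dimension5 {P} numbers = M 4 ∷ M 3 ∷ M 2 ∷ M 1 ∷ M 0 ∷ [] ,
      (λ { zero → cardinality 0 (ℕ.s≤s ℕ.z≤n)
         ; (suc zero) → cardinality 1 (ℕ.s≤s (ℕ.s≤s ℕ.z≤n))
         ; (suc (suc zero)) → cardinality 2 (ℕ.s≤s (ℕ.s≤s (ℕ.s≤s ℕ.z≤n)))
         ; (suc (suc (suc zero))) → cardinality 3 (ℕ.s≤s (ℕ.s≤s (ℕ.s≤s (ℕ.s≤s ℕ.z≤n))))
         ; (suc (suc (suc (suc zero)))) → cardinality 4 (ℕ.s≤s (ℕ.s≤s (ℕ.s≤s (ℕ.s≤s (ℕ.s≤s ℕ.z≤n))))) }) ,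
      cong₂ _∷_ (cong +_ (sym b₁≡M)) (cong₂ _∷_ f₁ (cong₂ _∷_ f₂ (cong₂ _∷_ f₃ (cong₂ _∷_ f₄ refl))))
      where
      open FaceNumbers numbers
      -- The third argument carries the number of empty faces, so that constant terms stay
      -- homogeneous until it is replaced by 1.
      in-b : (t : ℤ → ℤ → ℤ → ℤ) → t (+ M 4) (+ M 4 + + M 3) (+ M 5) ≡ t b₁ b₂ (+ 1)
      in-b t = trans (cong₂ (λ x y → t (+ x) (+ y) (+ M 5)) (sym b₁≡M) (sym (b₂≡M (ℕ.s≤s (ℕ.s≤s ℕ.z≤n))))) (cong (t b₁ b₂ ∘ +_) Md≡1)
      f₁ : + M 3 ≡ b₂ - b₁
      f₁ = trans (solve 2 (λ x₄ x₃ → x₃ := x₄ :+ x₃ :- x₄) refl (+ M 4) (+ M 3)) (in-b λ b₁ b₂ _ → b₂ - b₁)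
      -- From f₂ + 10 f₀ = 4 f₁ + 20; the coefficient -14 is -10 - 4, by f₁ = b₂ - b₁.
      f₂ : + M 2 ≡ + 4 * b₂ - + 14 * b₁ + + 20
      f₂ = trans (solve 6 (λ x₀ x₁ x₂ x₃ x₄ x₅ → x₂ := difference (0 ∷ 0 ∷ 1 ∷ 0 ∷ 10 ∷ 0 ∷ []) (0 ∷ 0 ∷ 0 ∷ 4 ∷ 0 ∷ 20 ∷ []) (x₀ ∷ x₁ ∷ x₂ ∷ x₃ ∷ x₄ ∷ x₅ ∷ []) :+ (con (+ 4) :* (x₄ :+ x₃) :- con (+ 14) :* x₄ :+ con (+ 20) :* x₅)) refl (+ M 0) (+ M 1) (+ M 2) (+ M 3) (+ M 4) (+ M 5))
        (trans (modulo-relation numbers (0 ∷ 0 ∷ 1 ∷ 0 ∷ 10 ∷ 0 ∷ []) (0 ∷ 0 ∷ 0 ∷ 4 ∷ 0 ∷ 20 ∷ [])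
            (+ 4 * (+ M 4 + + M 3) - + 14 * + M 4 + + 20 * + M 5))
          (in-b λ b₁ b₂ c → + 4 * b₂ - + 14 * b₁ + + 20 * c))
      -- From f₃ + 15 f₀ = 5 f₁ + 30.
      f₃ : + M 1 ≡ + 5 * b₂ - + 20 * b₁ + + 30
      f₃ = trans (solve 6 (λ x₀ x₁ x₂ x₃ x₄ x₅ → x₁ := difference (0 ∷ 1 ∷ 0 ∷ 0 ∷ 15 ∷ 0 ∷ []) (0 ∷ 0 ∷ 0 ∷ 5 ∷ 0 ∷ 30 ∷ []) (x₀ ∷ x₁ ∷ x₂ ∷ x₃ ∷ x₄ ∷ x₅ ∷ []) :+ (con (+ 5) :* (x₄ :+ x₃) :- con (+ 20) :* x₄ :+ con (+ 30) :* x₅)) refl (+ M 0) (+ M 1) (+ M 2) (+ M 3) (+ M 4) (+ M 5))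
        (trans (modulo-relation numbers (0 ∷ 1 ∷ 0 ∷ 0 ∷ 15 ∷ 0 ∷ []) (0 ∷ 0 ∷ 0 ∷ 5 ∷ 0 ∷ 30 ∷ [])
            (+ 5 * (+ M 4 + + M 3) - + 20 * + M 4 + + 30 * + M 5))
          (in-b λ b₁ b₂ c → + 5 * b₂ - + 20 * b₁ + + 30 * c))
      -- From f₄ + 6 f₀ = 2 f₁ + 12.
      f₄ : + M 0 ≡ + 2 * b₂ - + 8 * b₁ + + 12
      f₄ = trans (solve 6 (λ x₀ x₁ x₂ x₃ x₄ x₅ → x₀ := difference (1 ∷ 0 ∷ 0 ∷ 0 ∷ 6 ∷ 0 ∷ []) (0 ∷ 0 ∷ 0 ∷ 2 ∷ 0 ∷ 12 ∷ []) (x₀ ∷ x₁ ∷ x₂ ∷ x₃ ∷ x₄ ∷ x₅ ∷ []) :+ (con (+ 2) :* (x₄ :+ x₃) :- con (+ 8) :* x₄ :+ con (+ 12) :* x₅)) refl (+ M 0) (+ M 1) (+ M 2) (+ M 3) (+ M 4) (+ M 5))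
        (trans (modulo-relation numbers (1 ∷ 0 ∷ 0 ∷ 0 ∷ 6 ∷ 0 ∷ []) (0 ∷ 0 ∷ 0 ∷ 2 ∷ 0 ∷ 12 ∷ [])
            (+ 2 * (+ M 4 + + M 3) - + 8 * + M 4 + + 12 * + M 5))
          (in-b λ b₁ b₂ c → + 2 * b₂ - + 8 * b₁ + + 12 * c))

theorem4p2 :
  ∀ {ℓ} (K : OrderedField ℓ) → let open Geometry K in
  ∀ {d} (P : Region d) → IsSmoothPolytope P →
  (b : ℕ → ℕ) → (∀ m → 1 ≤ m → HasCardinality (latticePoints (Boundary (dilate m P))) (b m)) →
  let b₁ = + b 1
      b₂ = + b 2
  in
  (d ≡ 3 → HasFVector P (b₁ ∷ + 3 * b₁ - + 6 ∷ + 2 * b₁ - + 4 ∷ []))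
  × (d ≡ 4 → HasFVector P (b₁ ∷ b₂ - b₁ ∷ + 2 * b₂ - + 4 * b₁ ∷ b₂ - + 2 * b₁ ∷ []))
  × (d ≡ 5 → HasFVector P (b₁ ∷ b₂ - b₁ ∷ + 4 * b₂ - + 14 * b₁ + + 20 ∷ + 5 * b₂ - + 20 * b₁ + + 30 ∷ + 2 * b₂ - + 8 * b₁ + + 12 ∷ []))
theorem4p2 K P smooth b boundary =
  (λ { refl → dimension3 K b (faceNumbers K P smooth b boundary (ℕ.s≤s ℕ.z≤n)) }) ,
  (λ { refl → dimension4 K b (faceNumbers K P smooth b boundary (ℕ.s≤s ℕ.z≤n)) }) ,
  (λ { refl → dimension5 K b (faceNumbers K P smooth b boundary (ℕ.s≤s ℕ.z≤n)) })
  where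
  open DehnSommerville
  open FaceNumberRelations
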